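{- For integers $k>2$, $k\ge r\ge1$ and every $n\ge0$, $\overline{A}_0(1;2,k,r;n)=\overline{B}_0(1;2,k,r;n)$.
   Context: An overpartition of $n$ is a partition of $n$ in which the first occurrence of a part size may be overlined. Parts are totally ordered by $1<\bar1<2<\bar2<\cdots$; overpartitions are written $(\pi_1,\dots,\pi_s)$ with $\pi_i\ge\pi_{i+1}$ in this order, and all inequalities between parts are in this order, where $x+2$ denotes the part of size $|x|+2$ overlined iff $x$ is. $[x/2]=\lfloor|x|/2\rfloor$. $\overline{V}_\pi(N)$ is the number of overlined parts of $\pi$ that are $\le N$. $\overline{B}_0(1;2,k,r;n)$ is the number of overpartitions $(\pi_1,\dots,\pi_s)$ of $n$ such that only even parts may be non-overlined, $\pi_i\ge\pi_{i+k-1}+2$ (whenever $i+k-1\le s$) with strict inequality if $\pi_i$ is non-overlined, at most $r-1$ of the $\pi_i$ satisfy $\pi_i\le2$, and whenever $i+k-2\le s$ and $\pi_i\le\pi_{i+k-2}+2$ with strict inequality if $\pi_i$ is overlined, then $[\pi_i/2]+\cdots+[\pi_{i+k-2}/2]\equiv r-1+\overline{V}_\pi(\pi_i)\pmod2$. $\overline{A}_0(1;2,k,r;n)$ is the number of overpartitions of $n$ in which only even parts may be overlined, and the non-overlined parts are $\not\equiv2\pmod4$ and $\not\equiv0,\pm(2r-1)\pmod{4k-4}$. -}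

module Defs where

open import Data.Nat using (ℕ; zero; suc; _+_; _*_; _∸_; _≤_; _<_; _/_)
open import Data.Bool using (Bool; true; false; if_then_else_)
open import Data.Product using (_×_; _,_; proj₁; proj₂; Σ; Σ-syntax)
open import Data.Sum using (_⊎_)
open import Data.List using (List; []; _∷_; length; map; take; drop; lookup)
open import Data.Nat.ListAction using (sum)
open import Data.List.Relation.Unary.All using (All)
open import Data.List.Relation.Unary.Linked using (Linked)
open import Data.List.Relation.Unary.Unique.Propositional using (Unique)
open import Data.List.Membership.Propositional using (_∈_)
open import Data.Fin using (Fin; toℕ)
open import Data.Integer using (ℤ; +_; _-_; -_)
open import Data.Integer.Divisibility using (_∣_)
open import Relation.Nullary using (¬_)
open import Relation.Binary.PropositionalEquality using (_≡_)
open import Function.Bundles using (_⇔_)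

Part : Set
Part = ℕ × Bool

size : Part → ℕ
size = proj₁

IsOverlined : Part → Set
IsOverlined p = proj₂ p ≡ true

NonOverlined : Part → Set
NonOverlined p = proj₂ p ≡ false

-- Total order 1 < 1̄ < 2 < 2̄ < ⋯ : compare via the key 2·size + [overlined].
key : Part → ℕ
key (m , b) = 2 * m + (if b then 1 else 0)

_≼_ : Part → Part → Set
x ≼ y = key x ≤ key y

_≺_ : Part → Part → Set
x ≺ y = key x < key y

_+2 : Part → Part
(m , b) +2 = (m + 2 , b)

half : Part → ℕ
half p = size p / 2

_≡_[mod_] : ℤ → ℤ → ℕ → Set
a ≡ b [mod M ] = (+ M) ∣ (a - b)

-- Overpartitions: lists (π₁, …, π_s) with π_i ≥ π_{i+1} in the order above,
-- where only the first occurrence of a size may be overlined (so an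
-- overlined part never equals its successor).

Overpartition : Set
Overpartition = List Part

ConsecOK : Part → Part → Set
ConsecOK x y = (y ≺ x) ⊎ ((y ≡ x) × NonOverlined y)

IsOverpartition : Overpartition → Set
IsOverpartition π = All (λ p → 1 ≤ size p) π × Linked ConsecOK π

weight : Overpartition → ℕ
weight π = sum (map size π)

OverpartitionOf : ℕ → Overpartition → Set
OverpartitionOf n π = IsOverpartition π × weight π ≡ n

CountIs : (Part → Set) → Overpartition → ℕ → Set
CountIs P π c = Σ[ L ∈ List (Fin (length π)) ]
  (Unique L × (∀ i → (i ∈ L) ⇔ P (lookup π i)) × length L ≡ c)

VbarIs : Overpartition → Part → ℕ → Set
VbarIs π N c = CountIs (λ p → IsOverlined p × (p ≼ N)) π c

LeqPlus2 : Part → Part → Set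
LeqPlus2 a b = (IsOverlined a × (a ≺ (b +2))) ⊎ (NonOverlined a × (a ≼ (b +2)))

GeqPlus2 : Part → Part → Set
GeqPlus2 a b = (IsOverlined a × ((b +2) ≼ a)) ⊎ (NonOverlined a × ((b +2) ≺ a))

-- \overline{B}_0(1;2,k,r;n)  (indices are 0-based: π_i = lookup π i)

two : Part
two = (2 , false)

IsEven : ℕ → Set
IsEven m = (+ m) ≡ (+ 0) [mod 2 ]

B-cond : ℕ → ℕ → Overpartition → Set
B-cond k r π =
    All (λ p → NonOverlined p → IsEven (size p)) π
  × (∀ (i j : Fin (length π)) → toℕ j ≡ toℕ i + (k ∸ 1) →
       GeqPlus2 (lookup π i) (lookup π j))
  × (∀ c → CountIs (λ p → p ≼ two) π c → c ≤ r ∸ 1)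
  × (∀ (i j : Fin (length π)) → toℕ j ≡ toℕ i + (k ∸ 2) →
       LeqPlus2 (lookup π i) (lookup π j) →
       ∀ v → VbarIs π (lookup π i) v →
       (+ sum (map half (take (k ∸ 1) (drop (toℕ i) π))))
         ≡ (+ (r ∸ 1 + v)) [mod 2 ])

B-set : ℕ → ℕ → ℕ → Overpartition → Set
B-set k r n π = OverpartitionOf n π × B-cond k r π

A-part : ℕ → ℕ → Part → Set
A-part k r p =
    (IsOverlined p → IsEven (size p))
  × (NonOverlined p →
        ¬ ((+ size p) ≡ (+ 2) [mod 4 ])
      × ¬ ((+ size p) ≡ (+ 0) [mod (4 * k ∸ 4) ])
      × ¬ ((+ size p) ≡ (+ (2 * r ∸ 1)) [mod (4 * k ∸ 4) ])
      × ¬ ((+ size p) ≡ (- (+ (2 * r ∸ 1))) [mod (4 * k ∸ 4) ]))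

A-set : ℕ → ℕ → ℕ → Overpartition → Set
A-set k r n π = OverpartitionOf n π × All (A-part k r) π

NumberIs : (Overpartition → Set) → ℕ → Set
NumberIs P c = Σ[ L ∈ List Overpartition ]
  (Unique L × (∀ π → (π ∈ L) ⇔ P π) × length L ≡ c)

{-# OPTIONS --safe #-}
module Submission where

-- Put K = k - 1 and x = q ^ (2N).  Grouping the parts of sizes 2m+1 and 2m+2 turns
-- the conditions of B into a finite automaton.  Let D(i) be the generating function,
-- by weight, of the overpartitions with parts > 2N which it accepts from the state i,
-- a prime meaning x → x q².  Removing the smallest block gives
--   D(i) - D(i-2) = x^(i-2) q^(2i-5) (1 + x q²) (q E′(K-i+2) + E′(K-i+3)),
-- E(i) = D(i) + x D(i-1), for 3 ≤ i ≤ K, and similar equations for i = 1, 2, K + 1.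
-- They are satisfied by D(i) = (-x q² ; q²) G(i) and D(K+1) = D(K), where G solves the
-- Göllnitz–Gordon system
--   G(i) - G(i-1) = x^(i-1) q^(2i-3) (q G′(K-i+1) + G′(K-i+2)),   G(1) = G′(K),
-- which Andrews's function J solves explicitly.  At x = 1 the function J is, up to an elementary
-- factor, a theta series, hence a product by the Jacobi triple product, and the result is the
-- generating function of A.
--
-- Everything takes place in ℤ[q] / (q ^ (n + 1)), where all sums and products are finite.

-- The parity condition costs one bit. A full window below a non-overlined 2m+2 holds K parts of
-- sizes 2m, 2m+1 and 2m+2, so its halves add up to mK plus the number of parts 2m+2. Together with
-- the overlined parts counted by V this compares `bit g + f` with a bit δ fixed by the smaller
-- parts. A state is therefore one number: its size records the room left by the parts 2m, and its
-- parity records δ.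
--
-- The product (-x q² ; q²) solves the system because 1 + x q² is its ratio to its shift, and the
-- rest of the formula for D(i) - D(i-2) is the sum of the equations for G(i) and G(i-1).
--
-- G has no index K + 1. On the side of A, D(K+1) = D(K) is the congruence 2k-1 ≡ -(2k-3) modulo
-- 4k-4: the values k and k-1 of r exclude the same residues.
--
-- The variable x only takes the values q ^ (2N). Multiplied by (q² ; q²), Andrews's functions then
-- have no denominators, so their recurrences are identities between finite sums of finite products.

open import Defs
open import Data.Nat using (ℕ; _≤_; _<_)
open import Data.Product using (_×_; Σ-syntax)

open import Algebra.Bundles using (CommutativeRing)
import Algebra.Properties.Semiring.Exp as Exp
open import Data.Bool.Base using (Bool; true; false; if_then_else_; _∨_; not)
import Data.Bool.Properties as Boolₚ
open import Data.Empty using (⊥; ⊥-elim)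
import Data.Fin.Properties as Finₚ
open import Data.Integer.Base as ℤ using (ℤ; 0ℤ; 1ℤ)
import Data.Integer.Divisibility.Signed as ℤ∣
import Data.Integer.Properties as ℤₚ
import Data.Integer.Solver as ℤ-Solver
open import Data.List.Base using (List; []; _∷_; _++_; map; concatMap; length; filter; replicate; lookup; take; drop; allFin; upTo; applyUpTo; cartesianProduct; cartesianProductWith)
open import Data.List.Membership.Propositional using (_∈_; find; lose)
open import Data.List.Membership.Propositional.Properties using (∈-map⁺; ∈-map⁻; ∈-++⁺ˡ; ∈-++⁺ʳ; ∈-++⁻; ∈-filter⁺; ∈-filter⁻; ∈-concatMap⁺; ∈-concatMap⁻; ∈-allFin; ∈-lookup; ∈-upTo⁺; ∈-cartesianProduct⁺; ∈-cartesianProduct⁻; ∈-cartesianProductWith⁺; ∈-cartesianProductWith⁻)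
open import Data.List.Membership.Propositional.Properties.WithK using (unique∧set⇒bag)
import Data.List.Properties as Listₚ
open import Data.List.Relation.Binary.BagAndSetEquality using (∼bag⇒↭)
open import Data.List.Relation.Binary.Permutation.Propositional.Properties using (↭-length)
open import Data.List.Relation.Unary.All as All using (All; []; _∷_)
import Data.List.Relation.Unary.All.Properties as Allₚ
open import Data.List.Relation.Unary.AllPairs using ([]; _∷_)
open import Data.List.Relation.Unary.Any using (here; there)
open import Data.List.Relation.Unary.Linked using (Linked; []; [-]; _∷_)
open import Data.List.Relation.Unary.Unique.Propositional using (Unique)
import Data.List.Relation.Unary.Unique.Propositional.Properties as Uniqueₚ
open import Data.Maybe.Base using (Maybe; just; nothing)
open import Data.Nat.Base as ℕ using (zero; suc; z≤n; s≤s)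
import Data.Nat.DivMod as DivMod
import Data.Nat.Divisibility as ℕ∣
open import Data.Nat.ListAction using (sum)
open import Data.Nat.ListAction.Properties using (sum-++)
import Data.Nat.Properties as ℕₚ
open import Data.Nat.Solver using (module +-*-Solver)
open import Data.Product using (_,_; proj₁; proj₂; ∃-syntax)
import Data.Product.Properties as Productₚ
open import Data.Sum using (_⊎_; inj₁; inj₂)
open import Data.Unit using (⊤; tt)
open import Function.Base using (_∘_)
open import Function.Bundles using (mk⇔)
import Function.Properties.Equivalence as ⇔ₚ
open import Level using (0ℓ)
open import Relation.Binary.PropositionalEquality as ≡ using (_≡_; _≢_; refl; cong; cong₂; subst)
open import Relation.Nullary using (Dec; yes; no; does; ¬_)
open import Relation.Nullary.Decidable using (dec-true; dec-false; toWitnessFalse; _×-dec_)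
open import Relation.Unary using (Decidable)

-- Power series

module Series where
  open import Data.Integer.Base using (_+_; _*_; -_)
  open ℤ-Solver.+-*-Solver using (solve; _:+_; _:*_; _:=_)

  Series : Set
  Series = ℕ → ℤ

  infixl 6 _⊕_
  infixl 7 _⊛_

  _⊕_ _⊛_ : Series → Series → Series
  (f ⊕ g) n = f n + g n
  (f ⊛ g) zero    = f 0 * g 0
  (f ⊛ g) (suc n) = f 0 * g (suc n) + ((f ∘ suc) ⊛ g) n

  ⊖_ : Series → Series
  (⊖ f) n = - f n

  const : ℤ → Series
  const c zero    = c
  const c (suc _) = 0ℤ

  X : Series
  X 1 = 1ℤ
  X _ = 0ℤ

  -- The coefficient of degree n of a product sees only coefficients up to n of the factors. This is
  -- what lets the product descend to truncated series.
  ⊛-congᵇ : ∀ {f f′ g g′} n → (∀ m → m ℕ.≤ n → f m ≡ f′ m) → (∀ m → m ℕ.≤ n → g m ≡ g′ m) →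
            (f ⊛ g) n ≡ (f′ ⊛ g′) n
  ⊛-congᵇ zero    f≈ g≈ = cong₂ _*_ (f≈ 0 z≤n) (g≈ 0 z≤n)
  ⊛-congᵇ (suc n) f≈ g≈ = cong₂ _+_ (cong₂ _*_ (f≈ 0 z≤n) (g≈ (suc n) ℕₚ.≤-refl))
    (⊛-congᵇ n (λ m m≤n → f≈ (suc m) (s≤s m≤n)) (λ m m≤n → g≈ m (ℕₚ.m≤n⇒m≤1+n m≤n)))

  ⊛-distribʳ-⊕ : ∀ h f g n → ((f ⊕ g) ⊛ h) n ≡ (f ⊛ h) n + (g ⊛ h) n
  ⊛-distribʳ-⊕ h f g zero    = ℤₚ.*-distribʳ-+ (h 0) (f 0) (g 0)
  ⊛-distribʳ-⊕ h f g (suc n) rewrite ⊛-distribʳ-⊕ h (f ∘ suc) (g ∘ suc) n =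
    solve 5 (λ a b c x y → (a :+ b) :* c :+ (x :+ y) := a :* c :+ x :+ (b :* c :+ y)) refl
      (f 0) (g 0) (h (suc n)) (((f ∘ suc) ⊛ h) n) (((g ∘ suc) ⊛ h) n)

  ⊛-scaleˡ : ∀ c f g n → ((λ m → c * f m) ⊛ g) n ≡ c * (f ⊛ g) n
  ⊛-scaleˡ c f g zero    = ℤₚ.*-assoc c (f 0) (g 0)
  ⊛-scaleˡ c f g (suc n) rewrite ⊛-scaleˡ c (f ∘ suc) g n =
    solve 4 (λ c a b x → c :* a :* b :+ c :* x := c :* (a :* b :+ x)) refl
      c (f 0) (g (suc n)) (((f ∘ suc) ⊛ g) n)

  ⊛-assoc : ∀ f g h n → ((f ⊛ g) ⊛ h) n ≡ (f ⊛ (g ⊛ h)) n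
  ⊛-assoc f g h zero    = ℤₚ.*-assoc (f 0) (g 0) (h 0)
  ⊛-assoc f g h (suc n)
    rewrite ⊛-distribʳ-⊕ h (λ m → f 0 * g (suc m)) ((f ∘ suc) ⊛ g) n
          | ⊛-scaleˡ (f 0) (g ∘ suc) h n
          | ⊛-assoc (f ∘ suc) g h n =
    solve 5 (λ a b c x y → a :* b :* c :+ (a :* x :+ y) := a :* (b :* c :+ x) :+ y) refl
      (f 0) (g 0) (h (suc n)) (((g ∘ suc) ⊛ h) n) (((f ∘ suc) ⊛ (g ⊛ h)) n)

  -- The definition peels coefficients off the left factor. Commutativity needs this mirror image,
  -- which peels them off the right one.
  ⊛-sucʳ : ∀ f g n → (f ⊛ g) (suc n) ≡ f (suc n) * g 0 + (f ⊛ (g ∘ suc)) n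
  ⊛-sucʳ f g zero    = ℤₚ.+-comm (f 0 * g 1) (f 1 * g 0)
  ⊛-sucʳ f g (suc n) rewrite ⊛-sucʳ (f ∘ suc) g n =
    solve 3 (λ a b c → a :+ (b :+ c) := b :+ (a :+ c)) refl
      (f 0 * g (suc (suc n))) (f (suc (suc n)) * g 0) (((f ∘ suc) ⊛ (g ∘ suc)) n)

  ⊛-comm : ∀ f g n → (f ⊛ g) n ≡ (g ⊛ f) n
  ⊛-comm f g zero    = ℤₚ.*-comm (f 0) (g 0)
  ⊛-comm f g (suc n) rewrite ⊛-sucʳ g f n =
    cong₂ _+_ (ℤₚ.*-comm (f 0) (g (suc n))) (⊛-comm (f ∘ suc) g n)

  ⊛-zeroˡ : ∀ g n → ((λ _ → 0ℤ) ⊛ g) n ≡ 0ℤ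
  ⊛-zeroˡ g zero    = refl
  ⊛-zeroˡ g (suc n) = ≡.trans (ℤₚ.+-identityˡ _) (⊛-zeroˡ g n)

  const-⊛ : ∀ c g n → (const c ⊛ g) n ≡ c * g n
  const-⊛ c g zero    = refl
  const-⊛ c g (suc n) = ≡.trans (cong (_+_ (c * g (suc n))) (⊛-zeroˡ g n)) (ℤₚ.+-identityʳ _)

  X-⊛-suc : ∀ g n → (X ⊛ g) (suc n) ≡ g n
  X-⊛-suc g n = ≡.trans (ℤₚ.+-identityˡ _)
    (≡.trans (⊛-congᵇ n (λ { zero _ → refl ; (suc _) _ → refl }) (λ _ _ → refl))
      (≡.trans (const-⊛ 1ℤ g n) (ℤₚ.*-identityˡ (g n))))

  -- ℤ[X] / (X ^ (n + 1)), presented as power series compared up to degree n.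
  truncatedRing : ℕ → CommutativeRing 0ℓ 0ℓ
  truncatedRing n = record
    { Carrier = Series
    ; _≈_     = λ f g → ∀ m → m ℕ.≤ n → f m ≡ g m
    ; _+_     = _⊕_
    ; _*_     = _⊛_
    ; -_      = ⊖_
    ; 0#      = λ _ → 0ℤ
    ; 1#      = const 1ℤ
    ; isCommutativeRing = record
      { isRing = record
        { +-isAbelianGroup = record
          { isGroup = record
            { isMonoid = record
              { isSemigroup = record
                { isMagma = record
                  { isEquivalence = record
                    { refl  = λ _ _ → refl
                    ; sym   = λ f≈g m m≤n → ≡.sym (f≈g m m≤n)
                    ; trans = λ f≈g g≈h m m≤n → ≡.trans (f≈g m m≤n) (g≈h m m≤n)
                    }
                  ; ∙-cong = λ f≈ g≈ m m≤n → cong₂ _+_ (f≈ m m≤n) (g≈ m m≤n)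
                  }
                ; assoc = λ f g h m _ → ℤₚ.+-assoc (f m) (g m) (h m)
                }
              ; identity = (λ f m _ → ℤₚ.+-identityˡ (f m)) , (λ f m _ → ℤₚ.+-identityʳ (f m))
              }
            ; inverse = (λ f m _ → ℤₚ.+-inverseˡ (f m)) , (λ f m _ → ℤₚ.+-inverseʳ (f m))
            ; ⁻¹-cong = λ f≈ m m≤n → cong -_ (f≈ m m≤n)
            }
          ; comm = λ f g m _ → ℤₚ.+-comm (f m) (g m)
          }
        ; *-cong     = λ f≈ g≈ m m≤n → ⊛-congᵇ m (λ i i≤m → f≈ i (ℕₚ.≤-trans i≤m m≤n))
                                                  (λ i i≤m → g≈ i (ℕₚ.≤-trans i≤m m≤n))
        ; *-assoc    = λ f g h m _ → ⊛-assoc f g h m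
        ; *-identity = (λ f m _ → 1-⊛ f m) , (λ f m _ → ≡.trans (⊛-comm f (const 1ℤ) m) (1-⊛ f m))
        ; distrib    = (λ f g h m _ → ≡.trans (⊛-comm f (g ⊕ h) m)
                           (≡.trans (⊛-distribʳ-⊕ f g h m) (cong₂ _+_ (⊛-comm g f m) (⊛-comm h f m))))
                     , (λ f g h m _ → ⊛-distribʳ-⊕ f g h m)
        }
      ; *-comm = λ f g m _ → ⊛-comm f g m
      }
    }
    where
    1-⊛ : ∀ f m → (const 1ℤ ⊛ f) m ≡ f m
    1-⊛ f m = ≡.trans (const-⊛ 1ℤ f m) (ℤₚ.*-identityˡ (f m))

-- Normalising polynomial identities with integer coefficients over a commutative ring

module IntegerSolver (R : CommutativeRing 0ℓ 0ℓ) where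
  open import Data.Integer.Base using (+_; -[1+_])
  open CommutativeRing R renaming (refl to ≈-refl)
  open import Algebra.Solver.Ring.AlmostCommutativeRing
    using (fromCommutativeRing; _-Raw-AlmostCommutative⟶_)
  open import Algebra.Properties.Ring ring
  open import Algebra.Properties.AbelianGroup +-abelianGroup using (⁻¹-∙-comm)
  open import Relation.Binary.Reasoning.Setoid setoid

  -- The clause for 1 makes the image of 1ℤ definitionally 1#, so that solver
  -- constants match the ring's own unit.
  fromℕ : ℕ → Carrier
  fromℕ 0             = 0#
  fromℕ 1             = 1#
  fromℕ (suc (suc n)) = 1# + fromℕ (suc n)

  fromℕ-suc : ∀ n → fromℕ (suc n) ≈ 1# + fromℕ n
  fromℕ-suc zero    = sym (+-identityʳ 1#)
  fromℕ-suc (suc n) = ≈-refl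

  fromℕ-+ : ∀ m n → fromℕ (m ℕ.+ n) ≈ fromℕ m + fromℕ n
  fromℕ-+ zero    n = sym (+-identityˡ _)
  fromℕ-+ (suc m) n = begin
    fromℕ (suc (m ℕ.+ n))       ≈⟨ fromℕ-suc (m ℕ.+ n) ⟩
    1# + fromℕ (m ℕ.+ n)        ≈⟨ +-congˡ (fromℕ-+ m n) ⟩
    1# + (fromℕ m + fromℕ n)    ≈⟨ +-assoc _ _ _ ⟨
    1# + fromℕ m + fromℕ n      ≈⟨ +-congʳ (fromℕ-suc m) ⟨
    fromℕ (suc m) + fromℕ n     ∎

  fromℕ-* : ∀ m n → fromℕ (m ℕ.* n) ≈ fromℕ m * fromℕ n
  fromℕ-* zero    n = sym (zeroˡ _)
  fromℕ-* (suc m) n = begin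
    fromℕ (n ℕ.+ m ℕ.* n)              ≈⟨ fromℕ-+ n (m ℕ.* n) ⟩
    fromℕ n + fromℕ (m ℕ.* n)          ≈⟨ +-cong (sym (*-identityˡ _)) (fromℕ-* m n) ⟩
    1# * fromℕ n + fromℕ m * fromℕ n   ≈⟨ distribʳ _ _ _ ⟨
    (1# + fromℕ m) * fromℕ n           ≈⟨ *-congʳ (fromℕ-suc m) ⟨
    fromℕ (suc m) * fromℕ n            ∎

  fromℤ : ℤ → Carrier
  fromℤ (+ n)    = fromℕ n
  fromℤ -[1+ n ] = - fromℕ (suc n)

  fromℤ-neg : ∀ i → fromℤ (ℤ.- i) ≈ - fromℤ i
  fromℤ-neg (+ zero)  = sym -0#≈0#
  fromℤ-neg (+ suc n) = ≈-refl
  fromℤ-neg -[1+ n ]  = sym (-‿involutive _)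

  fromℤ-⊖ : ∀ m n → fromℤ (m ℤ.⊖ n) ≈ fromℕ m - fromℕ n
  fromℤ-⊖ m       zero    = sym (trans (+-congˡ -0#≈0#) (+-identityʳ _))
  fromℤ-⊖ zero    (suc n) = sym (+-identityˡ _)
  fromℤ-⊖ (suc m) (suc n) = begin
    fromℤ (suc m ℤ.⊖ suc n)                ≡⟨ cong fromℤ (ℤₚ.[1+m]⊖[1+n]≡m⊖n m n) ⟩
    fromℤ (m ℤ.⊖ n)                        ≈⟨ fromℤ-⊖ m n ⟩
    fromℕ m - fromℕ n                      ≈⟨ +-congʳ (+-identityʳ _) ⟨
    fromℕ m + 0# - fromℕ n                 ≈⟨ +-congʳ (+-congˡ (-‿inverseʳ 1#)) ⟨
    fromℕ m + (1# - 1#) - fromℕ n          ≈⟨ +-congʳ (+-assoc _ _ _) ⟨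
    fromℕ m + 1# - 1# - fromℕ n            ≈⟨ +-assoc _ _ _ ⟩
    fromℕ m + 1# + (- 1# - fromℕ n)        ≈⟨ +-cong (+-comm _ _) (⁻¹-∙-comm 1# (fromℕ n)) ⟩
    1# + fromℕ m - (1# + fromℕ n)          ≈⟨ +-cong (fromℕ-suc m) (-‿cong (fromℕ-suc n)) ⟨
    fromℕ (suc m) - fromℕ (suc n)          ∎

  fromℤ-+ : ∀ i j → fromℤ (i ℤ.+ j) ≈ fromℤ i + fromℤ j
  fromℤ-+ (+ m)    (+ n)    = fromℕ-+ m n
  fromℤ-+ (+ m)    -[1+ n ] = fromℤ-⊖ m (suc n)
  fromℤ-+ -[1+ m ] (+ n)    = trans (fromℤ-⊖ n (suc m)) (+-comm _ _)
  fromℤ-+ -[1+ m ] -[1+ n ] = begin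
    - fromℕ (suc (suc (m ℕ.+ n)))          ≡⟨ cong (λ k → - fromℕ (suc k)) (ℕₚ.+-suc m n) ⟨
    - fromℕ (suc m ℕ.+ suc n)              ≈⟨ -‿cong (fromℕ-+ (suc m) (suc n)) ⟩
    - (fromℕ (suc m) + fromℕ (suc n))      ≈⟨ ⁻¹-∙-comm _ _ ⟨
    - fromℕ (suc m) - fromℕ (suc n)        ∎

  fromℤ-*⁺ : ∀ m j → fromℤ (+ m ℤ.* j) ≈ fromℕ m * fromℤ j
  fromℤ-*⁺ m (+ n) = trans (reflexive (cong fromℤ (≡.sym (ℤₚ.pos-* m n)))) (fromℕ-* m n)
  fromℤ-*⁺ m -[1+ n ] = begin
    fromℤ (+ m ℤ.* -[1+ n ])             ≡⟨ cong fromℤ (≡.sym (ℤₚ.neg-distribʳ-* (+ m) (+ suc n))) ⟩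
    fromℤ (ℤ.- (+ m ℤ.* + suc n))        ≈⟨ fromℤ-neg (+ m ℤ.* + suc n) ⟩
    - fromℤ (+ m ℤ.* + suc n)            ≈⟨ -‿cong (fromℤ-*⁺ m (+ suc n)) ⟩
    - (fromℕ m * fromℕ (suc n))          ≈⟨ -‿distribʳ-* _ _ ⟩
    fromℕ m * - fromℕ (suc n)            ∎
  fromℤ-* : ∀ i j → fromℤ (i ℤ.* j) ≈ fromℤ i * fromℤ j
  fromℤ-* (+ m)    j = fromℤ-*⁺ m j
  fromℤ-* -[1+ m ] j = begin
    fromℤ (-[1+ m ] ℤ.* j)               ≡⟨ cong fromℤ (≡.sym (ℤₚ.neg-distribˡ-* (+ suc m) j)) ⟩
    fromℤ (ℤ.- (+ suc m ℤ.* j))          ≈⟨ fromℤ-neg (+ suc m ℤ.* j) ⟩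
    - fromℤ (+ suc m ℤ.* j)              ≈⟨ -‿cong (fromℤ-*⁺ (suc m) j) ⟩
    - (fromℕ (suc m) * fromℤ j)          ≈⟨ -‿distribˡ-* _ _ ⟩
    - fromℕ (suc m) * fromℤ j            ∎

  -- Coefficients come from the integers because their equality is decidable, so that opposite terms
  -- cancel during normalisation.
  morphism : ℤ.+-*-rawRing -Raw-AlmostCommutative⟶ fromCommutativeRing R
  morphism = record
    { ⟦_⟧ = fromℤ ; +-homo = fromℤ-+ ; *-homo = fromℤ-* ; -‿homo = fromℤ-neg
    ; 0-homo = ≈-refl ; 1-homo = ≈-refl }

  coeff≟ : ∀ i j → Maybe (fromℤ i ≈ fromℤ j)
  coeff≟ i j with i ℤₚ.≟ j
  ... | yes i≡j = just (reflexive (cong fromℤ i≡j))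
  ... | no  _   = nothing

  open import Algebra.Solver.Ring ℤ.+-*-rawRing (fromCommutativeRing R) morphism coeff≟ public
    using (solve; _:=_; _:+_; _:*_; _:-_; :-_; con)

power : (R : CommutativeRing 0ℓ 0ℓ) → CommutativeRing.Carrier R → ℕ → CommutativeRing.Carrier R
power R = Exp._^_ (CommutativeRing.semiring R)

-- Finite sums and products, and cancellation of units

module BigOperators (R : CommutativeRing 0ℓ 0ℓ) where
  open CommutativeRing R renaming (refl to ≈-refl)
  open IntegerSolver R
  open import Relation.Binary.Reasoning.Setoid setoid

  ∑ ∏ : ℕ → (ℕ → Carrier) → Carrier
  ∑ zero    f = 0#
  ∑ (suc n) f = f 0 + ∑ n (f ∘ suc)
  ∏ zero    f = 1#
  ∏ (suc n) f = f 0 * ∏ n (f ∘ suc)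

  ∑-cong : ∀ n {f g} → (∀ t → t ℕ.< n → f t ≈ g t) → ∑ n f ≈ ∑ n g
  ∑-cong zero    f≈g = ≈-refl
  ∑-cong (suc n) f≈g = +-cong (f≈g 0 (s≤s z≤n)) (∑-cong n (λ t t<n → f≈g (suc t) (s≤s t<n)))

  ∑-congᵃ : ∀ n {f g} → (∀ t → f t ≈ g t) → ∑ n f ≈ ∑ n g
  ∑-congᵃ n f≈g = ∑-cong n (λ t _ → f≈g t)

  ∏-congᵇ : ∀ n {f g} → (∀ t → t ℕ.< n → f t ≈ g t) → ∏ n f ≈ ∏ n g
  ∏-congᵇ zero    f≈g = ≈-refl
  ∏-congᵇ (suc n) f≈g = *-cong (f≈g 0 (s≤s z≤n)) (∏-congᵇ n (λ t t<n → f≈g (suc t) (s≤s t<n)))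

  ∏-cong : ∀ n {f g} → (∀ t → f t ≈ g t) → ∏ n f ≈ ∏ n g
  ∏-cong n f≈g = ∏-congᵇ n (λ t _ → f≈g t)

  ∑-snoc : ∀ n f → ∑ (suc n) f ≈ ∑ n f + f n
  ∑-snoc zero    f = +-comm (f 0) 0#
  ∑-snoc (suc n) f = trans (+-congˡ (∑-snoc n (f ∘ suc))) (sym (+-assoc _ _ _))

  ∏-snoc : ∀ n f → ∏ (suc n) f ≈ ∏ n f * f n
  ∏-snoc zero    f = *-comm (f 0) 1#
  ∏-snoc (suc n) f = trans (*-congˡ (∏-snoc n (f ∘ suc))) (sym (*-assoc _ _ _))

  ∑-+ : ∀ n f g → ∑ n (λ t → f t + g t) ≈ ∑ n f + ∑ n g
  ∑-+ zero    f g = sym (+-identityˡ 0#)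
  ∑-+ (suc n) f g = trans (+-congˡ (∑-+ n (f ∘ suc) (g ∘ suc)))
    (solve 4 (λ a b c d → (a :+ b) :+ (c :+ d) := (a :+ c) :+ (b :+ d)) ≈-refl _ _ _ _)

  ∑-*ˡ : ∀ n c f → ∑ n (λ t → c * f t) ≈ c * ∑ n f
  ∑-*ˡ zero    c f = sym (zeroʳ c)
  ∑-*ˡ (suc n) c f = trans (+-congˡ (∑-*ˡ n c (f ∘ suc))) (sym (distribˡ _ _ _))

  ∑-zero : ∀ n {f} → (∀ t → f t ≈ 0#) → ∑ n f ≈ 0#
  ∑-zero zero    f≈0 = ≈-refl
  ∑-zero (suc n) f≈0 = trans (+-cong (f≈0 0) (∑-zero n (f≈0 ∘ suc))) (+-identityˡ 0#)

  ∏-* : ∀ n f g → ∏ n (λ t → f t * g t) ≈ ∏ n f * ∏ n g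
  ∏-* zero    f g = sym (*-identityˡ 1#)
  ∏-* (suc n) f g = trans (*-congˡ (∏-* n (f ∘ suc) (g ∘ suc)))
    (solve 4 (λ a b c d → (a :* b) :* (c :* d) := (a :* c) :* (b :* d)) ≈-refl _ _ _ _)

  ∏-one : ∀ n {f} → (∀ t → f t ≈ 1#) → ∏ n f ≈ 1#
  ∏-one zero    f≈1 = ≈-refl
  ∏-one (suc n) f≈1 = trans (*-cong (f≈1 0) (∏-one n (f≈1 ∘ suc))) (*-identityˡ 1#)

  ∏-split : ∀ m n f → ∏ (m ℕ.+ n) f ≈ ∏ m f * ∏ n (λ t → f (m ℕ.+ t))
  ∏-split zero    n f = sym (*-identityˡ _)
  ∏-split (suc m) n f = trans (*-congˡ (∏-split m n (f ∘ suc))) (sym (*-assoc _ _ _))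

  sgn : ℕ → Carrier
  sgn zero    = 1#
  sgn (suc n) = - sgn n

  -- With q nilpotent the ring has zero divisors, so a factor can be cancelled only through an
  -- explicit inverse.
  Unit : Carrier → Set
  Unit u = Σ[ v ∈ Carrier ] v * u ≈ 1#

  unit-* : ∀ {u v} → Unit u → Unit v → Unit (u * v)
  unit-* {u} {v} (u⁻ , u⁻u≈1) (v⁻ , v⁻v≈1) = u⁻ * v⁻ , (begin
    u⁻ * v⁻ * (u * v)    ≈⟨ solve 4 (λ a b c d → a :* b :* (c :* d) := a :* c :* (b :* d)) ≈-refl _ _ _ _ ⟩
    u⁻ * u * (v⁻ * v)    ≈⟨ *-cong u⁻u≈1 v⁻v≈1 ⟩
    1# * 1#              ≈⟨ *-identityˡ 1# ⟩
    1#                   ∎)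

  unit-∏ : ∀ n {f} → (∀ t → Unit (f t)) → Unit (∏ n f)
  unit-∏ zero    uf = 1# , *-identityˡ 1#
  unit-∏ (suc n) uf = unit-* (uf 0) (unit-∏ n (uf ∘ suc))

  unit-cancel : ∀ {u x y} → Unit u → u * x ≈ u * y → x ≈ y
  unit-cancel {u} {x} {y} (u⁻ , u⁻u≈1) ux≈uy = begin
    x              ≈⟨ *-identityˡ x ⟨
    1# * x         ≈⟨ *-congʳ u⁻u≈1 ⟨
    u⁻ * u * x     ≈⟨ *-assoc _ _ _ ⟩
    u⁻ * (u * x)   ≈⟨ *-congˡ ux≈uy ⟩
    u⁻ * (u * y)   ≈⟨ *-assoc _ _ _ ⟨
    u⁻ * u * y     ≈⟨ *-congʳ u⁻u≈1 ⟩
    1# * y         ≈⟨ *-identityˡ y ⟩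
    y              ∎

-- A nilpotent q makes every q-series a finite sum and every infinite product
-- a finite one, so that no notion of convergence is needed.
module Nilpotent
  (R : CommutativeRing 0ℓ 0ℓ) (q : CommutativeRing.Carrier R) (M : ℕ)
  (q^M≈0 : CommutativeRing._≈_ R (power R q M) (CommutativeRing.0# R)) where

  open CommutativeRing R renaming (refl to ≈-refl) public
  open IntegerSolver R public
  open BigOperators R public
  open Exp semiring public using (_^_; ^-homo-*; ^-assocʳ)
  open import Relation.Binary.Reasoning.Setoid setoid

  q^-cong : ∀ {m n} → m ≡ n → q ^ m ≈ q ^ n
  q^-cong refl = ≈-refl

  q^-+ : ∀ m n {o} → m ℕ.+ n ≡ o → q ^ m * q ^ n ≈ q ^ o
  q^-+ m n refl = sym (^-homo-* q m n)

  q^-vanish : ∀ {e} → M ℕ.≤ e → q ^ e ≈ 0#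
  q^-vanish {e} M≤e = begin
    q ^ e                       ≈⟨ q^-+ M (e ℕ.∸ M) (ℕₚ.m+[n∸m]≡n M≤e) ⟨
    q ^ M * q ^ (e ℕ.∸ M)       ≈⟨ *-congʳ q^M≈0 ⟩
    0# * q ^ (e ℕ.∸ M)          ≈⟨ zeroˡ _ ⟩
    0#                          ∎

  1+q^-one : ∀ {e} → M ℕ.≤ e → 1# + q ^ e ≈ 1#
  1+q^-one M≤e = trans (+-congˡ (q^-vanish M≤e)) (+-identityʳ 1#)

  1-≈0 : ∀ {x} → x ≈ 0# → 1# - x ≈ 1#
  1-≈0 x≈0 = trans (+-congˡ (-‿cong x≈0)) (solve 0 (con 1ℤ :- con 0ℤ := con 1ℤ) ≈-refl)

  1-q^-one : ∀ {e} → M ℕ.≤ e → 1# - q ^ e ≈ 1#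
  1-q^-one M≤e = 1-≈0 (q^-vanish M≤e)

  geometric : ∀ e N → (1# - q ^ e) * ∑ N (λ t → q ^ (e ℕ.* t)) ≈ 1# - q ^ (e ℕ.* N)
  geometric e zero    = begin
    (1# - q ^ e) * 0#     ≈⟨ zeroʳ _ ⟩
    0#                    ≈⟨ -‿inverseʳ 1# ⟨
    1# - 1#               ≈⟨ +-congˡ (-‿cong (q^-cong {0} (≡.sym (ℕₚ.*-zeroʳ e)))) ⟩
    1# - q ^ (e ℕ.* 0)    ∎
  geometric e (suc N) = begin
    (1# - q ^ e) * ∑ (suc N) g                   ≈⟨ *-congˡ (∑-snoc N g) ⟩
    (1# - q ^ e) * (∑ N g + g N)                 ≈⟨ distribˡ _ _ _ ⟩
    (1# - q ^ e) * ∑ N g + (1# - q ^ e) * g N    ≈⟨ +-congʳ (geometric e N) ⟩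
    1# - g N + (1# - q ^ e) * g N                ≈⟨ solve 2 (λ x y → con 1ℤ :- y :+ (con 1ℤ :- x) :* y :=
        con 1ℤ :- x :* y) ≈-refl _ _ ⟩
    1# - q ^ e * g N                             ≈⟨ +-congˡ (-‿cong (q^-+ e (e ℕ.* N) (≡.sym (ℕₚ.*-suc e N)))) ⟩
    1# - q ^ (e ℕ.* suc N)                       ∎
    where
    g : ℕ → Carrier
    g t = q ^ (e ℕ.* t)

  -- The exponent of the remainder is at least N, so the remainder vanishes and the cut series is an
  -- exact inverse.
  geometric-inverse : ∀ e N → M ℕ.≤ N → (1# - q ^ suc e) * ∑ N (λ t → q ^ (suc e ℕ.* t)) ≈ 1#
  geometric-inverse e N M≤N = trans (geometric (suc e) N)
    (1-q^-one (ℕₚ.≤-trans M≤N (ℕₚ.m≤m+n N (e ℕ.* N))))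

  unit-1-q^ : ∀ e → Unit (1# - q ^ suc e)
  unit-1-q^ e = _ , trans (*-comm _ _) (geometric-inverse e M ℕₚ.≤-refl)

  -- Stands for the infinite product of `F` from index `a` on. It is faithful for those `F` that
  -- equal 1 from index `M` on.
  tail : (ℕ → Carrier) → ℕ → Carrier
  tail F a = ∏ M (λ t → F (a ℕ.+ t))

  module _ {F : ℕ → Carrier} (F≈1 : ∀ t → M ℕ.≤ t → F t ≈ 1#) where

    ∏-stable : ∀ {n} → M ℕ.≤ n → ∏ n F ≈ ∏ M F
    ∏-stable {n} M≤n = begin
      ∏ n F                                              ≡⟨ cong (λ n → ∏ n F) (ℕₚ.m+[n∸m]≡n M≤n) ⟨
      ∏ (M ℕ.+ (n ℕ.∸ M)) F                              ≈⟨ ∏-split M (n ℕ.∸ M) F ⟩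
      ∏ M F * ∏ (n ℕ.∸ M) (λ t → F (M ℕ.+ t))            ≈⟨ *-congˡ (∏-one (n ℕ.∸ M) (λ t → F≈1 _ (ℕₚ.m≤m+n M t))) ⟩
      ∏ M F * 1#                                         ≈⟨ *-identityʳ _ ⟩
      ∏ M F                                              ∎

    -- Moving the start by one brings in the new last factor `F (a + M)`, which is 1.
    tail-step : ∀ a → tail F a ≈ F a * tail F (suc a)
    tail-step a = begin
      ∏ M G                    ≈⟨ *-identityʳ _ ⟨
      ∏ M G * 1#               ≈⟨ *-congˡ (F≈1 _ (ℕₚ.m≤n+m M a)) ⟨
      ∏ M G * G M              ≈⟨ ∏-snoc M G ⟨
      ∏ (suc M) G              ≈⟨ *-cong (reflexive (cong F (ℕₚ.+-identityʳ a)))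
                                         (∏-cong M (λ t → reflexive (cong F (ℕₚ.+-suc a t)))) ⟩
      F a * tail F (suc a)     ∎
      where
      G : ℕ → Carrier
      G t = F (a ℕ.+ t)

    tail-one : ∀ {a} → M ℕ.≤ a → tail F a ≈ 1#
    tail-one M≤a = ∏-one M (λ t → F≈1 _ (ℕₚ.≤-trans M≤a (ℕₚ.m≤m+n _ t)))

    tail-split : ∀ n → tail F 0 ≈ ∏ n F * tail F n
    tail-split zero    = sym (*-identityˡ _)
    tail-split (suc n) = begin
      tail F 0                           ≈⟨ tail-split n ⟩
      ∏ n F * tail F n                   ≈⟨ *-congˡ (tail-step n) ⟩
      ∏ n F * (F n * tail F (suc n))     ≈⟨ *-assoc _ _ _ ⟨
      ∏ n F * F n * tail F (suc n)       ≈⟨ *-congʳ (∏-snoc n F) ⟨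
      ∏ (suc n) F * tail F (suc n)       ∎

-- The Jacobi triple product

-- The numbers n (n - 1) / 2, the exponents of the theta series.
tri : ℕ → ℕ
tri zero    = 0
tri (suc n) = n ℕ.+ tri n

module JacobiTriple
  (R : CommutativeRing 0ℓ 0ℓ) (q : CommutativeRing.Carrier R) (M : ℕ)
  (q^M≈0 : CommutativeRing._≈_ R (power R q M) (CommutativeRing.0# R)) (a b : ℕ) where

  open Nilpotent R q M q^M≈0
  open import Relation.Binary.Reasoning.Setoid setoid

  s : ℕ
  s = suc a ℕ.+ suc b

  u v p : Carrier
  u = q ^ suc a
  v = q ^ suc b
  p = q ^ s

  uv≈p : u * v ≈ p
  uv≈p = q^-+ (suc a) (suc b) refl

  p^≈q^ : ∀ t → p ^ t ≈ q ^ (s ℕ.* t)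
  p^≈q^ = ^-assocʳ q s

  1-p^-one : ∀ t → M ℕ.≤ t → 1# - p ^ t ≈ 1#
  1-p^-one t M≤t = 1-≈0 (trans (p^≈q^ t) (q^-vanish (ℕₚ.≤-trans M≤t (ℕₚ.m≤n*m t s))))

  unit-1-p^ : ∀ t → Unit (1# - p ^ suc t)
  unit-1-p^ t with unit-1-q^ (t ℕ.+ (a ℕ.+ suc b) ℕ.* suc t)
  ... | w , eq = w , trans (*-congˡ (+-congˡ (-‿cong (p^≈q^ (suc t))))) eq

  τ : ℕ → Carrier
  τ = tail (λ t → 1# - p ^ t)

  τ-step : ∀ t → τ t ≈ (1# - p ^ t) * τ (suc t)
  τ-step = tail-step 1-p^-one

  -- T m j stands for τ (m - j + 1), and is 0 when j > m.
  T : ℕ → ℕ → Carrier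
  T m       zero    = τ (suc m)
  T zero    (suc j) = 0#
  T (suc m) (suc j) = T m j

  -- Truncated subtraction is what is wanted here: for `j ≥ m` the factor is 1 - p ^ 0 = 0, in
  -- agreement with the value 0 of `T` beyond `m`.
  T-step : ∀ m j → T m (suc j) ≈ (1# - p ^ (m ℕ.∸ j)) * T m j
  T-step zero    zero    = sym (trans (*-congʳ (-‿inverseʳ 1#)) (zeroˡ _))
  T-step (suc m) zero    = τ-step (suc m)
  T-step zero    (suc j) = sym (zeroʳ _)
  T-step (suc m) (suc j) = T-step m j

  T-zero : ∀ {m j} → m ℕ.< j → T m j ≈ 0#
  T-zero {zero}  (s≤s _)   = ≈-refl
  T-zero {suc m} (s≤s m<j) = T-zero m<j

  T-one : ∀ {m j} → M ℕ.+ j ℕ.≤ suc m → T m j ≈ 1#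
  T-one {m}     {zero}  h = tail-one 1-p^-one (subst (ℕ._≤ suc m) (ℕₚ.+-identityʳ M) h)
  -- The bound forces M = 0, and then q ^ M ≈ 0 says that the ring is trivial.
  T-one {zero}  {suc j} h = contra (ℕₚ.≤-trans (ℕₚ.≤-reflexive (≡.sym (ℕₚ.+-suc M j))) h)
    where
    contra : suc (M ℕ.+ j) ℕ.≤ 1 → 0# ≈ 1#
    contra (s≤s M+j≤0) = sym (trans (sym (*-identityʳ 1#))
        (trans (*-congʳ (sym (reflexive (cong (q ^_) (ℕₚ.m+n≡0⇒m≡0 M (ℕₚ.n≤0⇒n≡0 M+j≤0))))))
      (trans (*-identityʳ _) q^M≈0)))
  T-one {suc m} {suc j} h = T-one {m} {j} (ℕₚ.≤-pred (ℕₚ.≤-trans (ℕₚ.≤-reflexive (≡.sym (ℕₚ.+-suc M j))) h))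

  c : ℕ → ℕ → Carrier
  c m j = τ (suc (m ℕ.+ j)) * T m j

  c-zero : ∀ {m j} → m ℕ.< j → c m j ≈ 0#
  c-zero m<j = trans (*-congˡ (T-zero m<j)) (zeroʳ _)

  -- The two factors by which (p ; p)₂ₘ grows when m increases by one.
  Q : ℕ → Carrier
  Q m = (1# - p ^ suc (m ℕ.+ m)) * (1# - p ^ suc (suc (m ℕ.+ m)))

  -- The central case of the recurrence: by symmetry the neighbours at -1 and at 1 coincide, whence
  -- the factor 2.
  c-step-0 : ∀ m → Q m * c (suc m) 0 ≈
    (1# + p ^ suc (m ℕ.+ m)) * c m 0 + (1# + 1#) * (p ^ suc m * c m 1)
  c-step-0 m rewrite ℕₚ.+-identityʳ m | ℕₚ.+-comm m 1 = begin
    (1# - p * P) * (1# - p * (p * P)) * (y * y)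
      ≈⟨ *-congʳ (*-cong (+-congˡ (-‿cong (*-congˡ P≈ww))) (+-congˡ (-‿cong (*-congˡ (*-congˡ P≈ww))))) ⟩
    (1# - p * (w * w)) * (1# - p * (p * (w * w))) * (y * y)
      ≈⟨ solve 3 (λ p w y →
            (con 1ℤ :- p :* (w :* w)) :* (con 1ℤ :- p :* (p :* (w :* w))) :* (y :* y)
         := (con 1ℤ :+ p :* (w :* w)) :* (((con 1ℤ :- p :* w) :* y) :* ((con 1ℤ :- p :* w) :* y))
            :+ (con 1ℤ :+ con 1ℤ) :* (p :* w :* (y :* ((con 1ℤ :- w) :* ((con 1ℤ :- p :* w) :* y))))) ≈-refl p w y ⟩
    (1# + p * (w * w)) * (((1# - p * w) * y) * ((1# - p * w) * y)) + (1# + 1#) *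
        (p * w * (y * ((1# - w) * ((1# - p * w) * y))))
      ≈⟨ +-cong (*-cong (+-congˡ (*-congˡ (sym P≈ww))) (*-cong (sym τ1) (sym τ1)))
               (*-congˡ (*-congˡ (*-congˡ (sym (trans (T-step m 0) (*-congˡ τ1)))))) ⟩
    (1# + p * P) * (τ (suc m) * τ (suc m)) + (1# + 1#) * (p * w * (y * T m 1)) ∎
    where
    w y P : Carrier
    w = p ^ m
    P = p ^ (m ℕ.+ m)
    y = τ (suc (suc m))
    P≈ww : P ≈ w * w
    P≈ww = ^-homo-* p m m
    τ1 : τ (suc m) ≈ (1# - p * w) * y
    τ1 = τ-step (suc m)

  -- Two applications of the q-Pascal rule to the Gaussian binomial [2m + 2, m + j + 2], cleared of
  -- denominators.
  c-step : ∀ m j → Q m * c (suc m) (suc j) ≈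
    (1# + p ^ suc (m ℕ.+ m)) * c m (suc j) + p ^ (m ℕ.∸ j) * c m j + p ^ suc (m ℕ.+ suc j) * c m (suc (suc j))
  c-step m j with j ℕₚ.≤? m
  ... | no j≰m = begin
    Q m * c (suc m) (suc j) ≈⟨ *-congˡ (c-zero (s≤s m<j)) ⟩
    Q m * 0#                ≈⟨ solve 4 (λ x y z w → x :* con 0ℤ := y :* con 0ℤ :+ z :* con 0ℤ :+ w :* con 0ℤ) ≈-refl
        _ _ _ _ ⟩
    _ * 0# + _ * 0# + _ * 0# ≈⟨ +-cong (+-cong (*-congˡ (c-zero (ℕₚ.m≤n⇒m≤1+n m<j))) (*-congˡ (c-zero m<j)))
                                   (*-congˡ (c-zero (ℕₚ.m≤n⇒m≤1+n (ℕₚ.m≤n⇒m≤1+n m<j)))) ⟨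
    _ ∎
    where m<j = ℕₚ.≰⇒> j≰m
  ... | yes j≤m rewrite ℕₚ.+-suc m j | ℕₚ.+-suc m (suc j) | ℕₚ.+-suc m j = begin
    (1# - p * P) * (1# - p * (p * P)) * (y * z)
      ≈⟨ *-congʳ (*-cong (+-congˡ (-‿cong (*-congˡ P≈wb))) (+-congˡ (-‿cong (*-congˡ (*-congˡ P≈wb))))) ⟩
    (1# - p * (w * b′)) * (1# - p * (p * (w * b′))) * (y * z)
      ≈⟨ solve 5 (λ p w b y z →
           (con 1ℤ :- p :* (w :* b)) :* (con 1ℤ :- p :* (p :* (w :* b))) :* (y :* z)
        := (con 1ℤ :+ p :* (w :* b)) :* (((con 1ℤ :- p :* (p :* b)) :* y) :* ((con 1ℤ :- w) :* z))
           :+ w :* (((con 1ℤ :- p :* b) :* ((con 1ℤ :- p :* (p :* b)) :* y)) :* z)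
           :+ p :* b :* (y :* ((p :- w) :* ((con 1ℤ :- w) :* z)))) ≈-refl p w b′ y z ⟩
    (1# + p * (w * b′)) * (((1# - p * (p * b′)) * y) * ((1# - w) * z))
      + w * (((1# - p * b′) * ((1# - p * (p * b′)) * y)) * z)
      + p * b′ * (y * ((p - w) * ((1# - w) * z)))
      ≈⟨ +-cong (+-cong (*-cong (+-congˡ (*-congˡ (sym P≈wb))) (*-cong (sym τ2) (sym (T-step m j))))
                        (*-congˡ (*-congʳ (sym (trans (τ-step (suc (m ℕ.+ j))) (*-congˡ τ2))))))
                (trans (*-congˡ (*-congˡ T2)) (solve 4 (λ p b y t → p :* b :* (y :* (p :* t)) := p :* (p :* b) :*
                    (y :* t)) ≈-refl _ _ _ _)) ⟩
    (1# + p * P) * (τ (suc (suc (m ℕ.+ j))) * T m (suc j)) + w * (τ (suc (m ℕ.+ j)) * z)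
      + p * (p * b′) * (y * T m (suc (suc j))) ∎
    where
    w b′ y z P : Carrier
    w  = p ^ (m ℕ.∸ j)
    b′ = p ^ (m ℕ.+ j)
    P  = p ^ (m ℕ.+ m)
    y  = τ (suc (suc (suc (m ℕ.+ j))))
    z  = T m j
    P≈wb : P ≈ w * b′
    P≈wb = trans (reflexive (cong (p ^_) (≡.trans (cong (m ℕ.+_) (≡.sym (ℕₚ.m+[n∸m]≡n j≤m)))
             (≡.trans (≡.sym (ℕₚ.+-assoc m j _)) (ℕₚ.+-comm (m ℕ.+ j) _))))) (^-homo-* p (m ℕ.∸ j) (m ℕ.+ j))
    τ2 : τ (suc (suc (m ℕ.+ j))) ≈ (1# - p * (p * b′)) * y
    τ2 = τ-step (suc (suc (m ℕ.+ j)))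
    T2′ : ∀ {d} → m ℕ.∸ j ≡ d → (p - w) * ((1# - w) * z) ≈ p * ((1# - p ^ (d ℕ.∸ 1)) * ((1# - w) * z))
    -- Here `d ∸ 1` truncates, but w = p ^ 0 makes the common factor 1 - w vanish on both sides.
    T2′ {zero}  eq = begin
      (p - w) * ((1# - w) * z)           ≈⟨ *-congˡ w0 ⟩
      (p - w) * 0#                       ≈⟨ solve 2 (λ x y → x :* con 0ℤ := y :* ((con 1ℤ :- con 1ℤ) :* con 0ℤ))
          ≈-refl _ _ ⟩
      p * ((1# - 1#) * 0#)               ≈⟨ *-congˡ (*-congˡ w0) ⟨
      p * ((1# - 1#) * ((1# - w) * z))   ∎
      where
      w0 : (1# - w) * z ≈ 0#
      w0 = trans (*-congʳ (trans (+-congˡ (-‿cong (reflexive (cong (p ^_) eq)))) (-‿inverseʳ 1#))) (zeroˡ z)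
    T2′ {suc d} eq = trans (*-congʳ (+-congˡ (-‿cong (reflexive (cong (p ^_) eq)))))
      (solve 3 (λ p w t → (p :- p :* w) :* t := p :* ((con 1ℤ :- w) :* t)) ≈-refl _ _ _)
    T2 : (p - w) * ((1# - w) * z) ≈ p * T m (suc (suc j))
    T2 = trans (T2′ refl) (*-congˡ (trans (*-congʳ (+-congˡ (-‿cong (reflexive (cong (p ^_)
           (≡.trans (ℕₚ.∸-+-assoc m j 1) (cong (m ℕ.∸_) (ℕₚ.+-comm j 1))))))))
           (trans (*-congˡ (sym (T-step m j))) (sym (T-step m (suc j))))))

  thetaTerm : Carrier → ℕ → Carrier
  thetaTerm x zero    = 1#
  thetaTerm x (suc j) = - (x * p ^ j * thetaTerm x j)

  thetaTerm-closed : ∀ e j → thetaTerm (q ^ e) j ≈ sgn j * q ^ (e ℕ.* j ℕ.+ s ℕ.* tri j)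
  thetaTerm-closed e zero    = sym (trans (*-identityˡ _)
      (q^-cong {n = 0} (cong₂ ℕ._+_ (ℕₚ.*-zeroʳ e) (ℕₚ.*-zeroʳ s))))
  thetaTerm-closed e (suc j) = begin
    - (q ^ e * p ^ j * thetaTerm (q ^ e) j)
      ≈⟨ -‿cong (*-cong (*-congˡ (p^≈q^ j)) (thetaTerm-closed e j)) ⟩
    - (q ^ e * q ^ (s ℕ.* j) * (sgn j * q ^ (e ℕ.* j ℕ.+ s ℕ.* tri j)))
      ≈⟨ solve 4 (λ x y z w → :- (x :* y :* (z :* w)) := :- z :* (x :* y :* w)) ≈-refl _ _ _ _ ⟩
    - sgn j * (q ^ e * q ^ (s ℕ.* j) * q ^ (e ℕ.* j ℕ.+ s ℕ.* tri j))
      ≈⟨ *-congˡ (trans (*-congʳ (q^-+ e (s ℕ.* j) refl)) (q^-+ (e ℕ.+ s ℕ.* j) _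
           (N.solve 4 (λ e s j t → e N.:+ s N.:* j N.:+ (e N.:* j N.:+ s N.:* t)
                N.:= e N.:* (N.con 1 N.:+ j) N.:+ s N.:* (j N.:+ t)) refl e s j (tri j)))) ⟩
    - sgn j * q ^ (e ℕ.* suc j ℕ.+ s ℕ.* tri (suc j)) ∎
    where module N = +-*-Solver

  thetaTerm-vanish : ∀ e j → M ℕ.≤ j → thetaTerm (q ^ suc e) j ≈ 0#
  thetaTerm-vanish e j M≤j = trans (thetaTerm-closed (suc e) j)
    (trans (*-congˡ (q^-vanish (ℕₚ.≤-trans M≤j (ℕₚ.≤-trans (ℕₚ.m≤m+n j (e ℕ.* j)) (ℕₚ.m≤m+n _ _))))) (zeroʳ _))

  E : ℕ → Carrier
  E j = thetaTerm u j + thetaTerm v j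

  -- Multiplying by u + v moves the summation index by one in both directions.
  E-shift : ∀ m j → - ((u + v) * p ^ m) * (c m (suc j) * E (suc j)) ≈
    p ^ (m ℕ.∸ suc j) * c m (suc j) * E (suc (suc j)) + p ^ suc (m ℕ.+ j) * c m (suc j) * E j
  E-shift m j with suc j ℕₚ.≤? m
  ... | no  j≰m = begin
    _ * (c m (suc j) * E (suc j))   ≈⟨ *-congˡ (*-congʳ z) ⟩
    _ * (0# * E (suc j))            ≈⟨ solve 6 (λ x y z w e f → x :* (con 0ℤ :* y) := z :* con 0ℤ :* e :+ w :*
        con 0ℤ :* f) ≈-refl _ _ _ _ _ _ ⟩
    _ * 0# * _ + _ * 0# * _         ≈⟨ +-cong (*-congʳ (*-congˡ z)) (*-congʳ (*-congˡ z)) ⟨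
    _                               ∎
    where
    z : c m (suc j) ≈ 0#
    z = c-zero (ℕₚ.≰⇒> j≰m)
  ... | yes j<m = begin
    - ((u + v) * p ^ m) * (C * E (suc j))
      ≈⟨ *-congʳ (-‿cong (*-congˡ pm)) ⟩
    - ((u + v) * (w * (p * pj))) * (C * (- (u * pj * U) + - (v * pj * V)))
      ≈⟨ solve 8 (λ u v p w pj C U V →
           :- ((u :+ v) :* (w :* (p :* pj))) :* (C :* (:- (u :* pj :* U) :+ :- (v :* pj :* V)))
        := w :* C :* (:- (u :* (p :* pj) :* (:- (u :* pj :* U))) :+ :- (v :* (p :* pj) :* (:- (v :* pj :* V))))
           :+ (w :* (p :* pj)) :* pj :* (u :* v) :* C :* (U :+ V)) ≈-refl u v p w pj C U V ⟩
    w * C * E (suc (suc j)) + (w * (p * pj)) * pj * (u * v) * C * E j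
      ≈⟨ +-congˡ (*-congʳ (*-congʳ (trans (*-cong (*-congʳ (sym pm)) uv≈p)
           (trans (*-comm _ _) (*-congˡ (sym (^-homo-* p m j))))))) ⟩
    w * C * E (suc (suc j)) + p ^ suc (m ℕ.+ j) * C * E j ∎
    where
    C w pj U V : Carrier
    C  = c m (suc j)
    w  = p ^ (m ℕ.∸ suc j)
    pj = p ^ j
    U  = thetaTerm u j
    V  = thetaTerm v j
    pm : p ^ m ≈ w * (p * pj)
    pm = trans (reflexive (cong (p ^_) (≡.sym (ℕₚ.m∸n+n≡m j<m)))) (^-homo-* p (m ℕ.∸ suc j) (suc j))

  -- τ 1 * τ 1 * ∏ m F ≈ (p ; p)₂ₘ * S m is the finite triple product, the Gaussian
  -- binomials being cleared of denominators: τ 1 * τ 1 * [2m, m + j] = (p ; p)₂ₘ * c m j.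
  module _ (J : ℕ) where

    S : ℕ → Carrier
    S m = c m 0 + ∑ J (λ j → c m (suc j) * E (suc j))

    -- `c-step` spreads every term over three neighbours. After shifting the summation index,
    -- `c m (suc j)` meets both `E j` and `E (suc (suc j))`, which `E-shift` turns into the factor
    -- -(u + v) p ^ m. Then 1 - (u + v) p ^ m + u v p ^ (2m) splits into two factors. The condition
    -- `m < J` makes the boundary terms of the shifts vanish.
    S-step : ∀ m → m ℕ.< J → Q m * S (suc m) ≈ (1# - u * p ^ m) * (1# - v * p ^ m) * S m
    S-step m m<J = begin
      Q m * S (suc m)
        ≈⟨ trans (distribˡ _ _ _) (+-cong (c-step-0 m) (sym (∑-*ˡ J (Q m) _))) ⟩
      (P₁ * c m 0 + (1# + 1#) * (p ^ suc m * c m 1)) + ∑ J (λ j → Q m * (c (suc m) (suc j) * E (suc j)))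
        ≈⟨ +-congˡ (∑-congᵃ J (λ j → trans (sym (*-assoc _ _ _)) (trans (*-congʳ (c-step m j))
             (solve 4 (λ x y z e → (x :+ y :+ z) :* e := x :* e :+ y :* e :+ z :* e) ≈-refl _ _ _ _)))) ⟩
      (P₁ * c m 0 + (1# + 1#) * (p ^ suc m * c m 1)) + ∑ J (λ j → P₁ * c m (suc j) * E (suc j) + f j + g (suc j))
        ≈⟨ +-congˡ (trans (∑-+ J _ _) (+-congʳ (∑-+ J _ _))) ⟩
      (P₁ * c m 0 + (1# + 1#) * (p ^ suc m * c m 1)) + (∑ J (λ j → P₁ * c m (suc j) * E (suc j)) + ∑ J f + ∑ J
          (g ∘ suc))
        ≈⟨ +-cong (+-congˡ g0) (+-congʳ (+-cong (trans (∑-congᵃ J (λ j → *-assoc _ _ _)) (∑-*ˡ J P₁ _)) fJ)) ⟩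
      (P₁ * c m 0 + g 0) + (P₁ * Σc + (f 0 + ∑ J (f ∘ suc)) + ∑ J (g ∘ suc))
        ≈⟨ solve 7 (λ P c₀ g₀ Σ f₀ Σf Σg → (P :* c₀ :+ g₀) :+ (P :* Σ :+ (f₀ :+ Σf) :+ Σg)
             := P :* (c₀ :+ Σ) :+ (f₀ :+ (Σf :+ (g₀ :+ Σg)))) ≈-refl P₁ (c m 0) (g 0) Σc (f 0) (∑ J (f ∘ suc))
                 (∑ J (g ∘ suc)) ⟩
      P₁ * S m + (f 0 + (∑ J (f ∘ suc) + (g 0 + ∑ J (g ∘ suc))))
        ≈⟨ +-congˡ (+-cong f0 (trans (+-congˡ gJ) (trans (sym (∑-+ J _ _))
             (trans (∑-congᵃ J (λ j → sym (E-shift m j))) (∑-*ˡ J _ _))))) ⟩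
      P₁ * S m + (- ((u + v) * p ^ m) * c m 0 + - ((u + v) * p ^ m) * Σc)
        ≈⟨ +-cong (*-congʳ (+-congˡ (trans (*-cong (sym uv≈p) (^-homo-* p m m)) (≈-refl))))
                  (sym (distribˡ _ _ _)) ⟩
      (1# + u * v * (p ^ m * p ^ m)) * S m + - ((u + v) * p ^ m) * S m
        ≈⟨ solve 4 (λ u v w s → (con 1ℤ :+ u :* v :* (w :* w)) :* s :+ :- ((u :+ v) :* w) :* s
             := (con 1ℤ :- u :* w) :* (con 1ℤ :- v :* w) :* s) ≈-refl u v (p ^ m) (S m) ⟩
      (1# - u * p ^ m) * (1# - v * p ^ m) * S m ∎
      where
      P₁ Σc : Carrier
      P₁ = 1# + p ^ suc (m ℕ.+ m)
      Σc = ∑ J (λ j → c m (suc j) * E (suc j))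
      f g : ℕ → Carrier
      f j = p ^ (m ℕ.∸ j) * c m j * E (suc j)
      g j = p ^ suc (m ℕ.+ j) * c m (suc j) * E j
      g0 : (1# + 1#) * (p ^ suc m * c m 1) ≈ g 0
      g0 = trans (*-comm _ _) (*-congʳ (*-congʳ (reflexive (cong (λ t → p ^ suc t) (≡.sym (ℕₚ.+-identityʳ m))))))
      f0 : f 0 ≈ - ((u + v) * p ^ m) * c m 0
      f0 = solve 4 (λ u v w c → w :* c :* (:- (u :* con 1ℤ :* con 1ℤ) :+ :- (v :* con 1ℤ :* con 1ℤ)) := :-
          ((u :+ v) :* w) :* c)
             ≈-refl u v (p ^ m) (c m 0)
      drop-last : ∀ h → h J ≈ 0# → ∑ (suc J) h ≈ ∑ J h
      drop-last h hJ≈0 = trans (∑-snoc J h) (trans (+-congˡ hJ≈0) (+-identityʳ _))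
      vanish : ∀ {x y z} → y ≈ 0# → x * y * z ≈ 0#
      vanish y≈0 = trans (*-congʳ (trans (*-congˡ y≈0) (zeroʳ _))) (zeroˡ _)
      fJ : ∑ J f ≈ f 0 + ∑ J (f ∘ suc)
      fJ = sym (drop-last f (vanish (c-zero m<J)))
      gJ : g 0 + ∑ J (g ∘ suc) ≈ ∑ J g
      gJ = drop-last g (vanish (c-zero (ℕₚ.m≤n⇒m≤1+n m<J)))

    F : ℕ → Carrier
    F t = (1# - u * p ^ t) * (1# - v * p ^ t)

    ∏F≈S : ∀ m → m ℕ.≤ J → τ 1 * τ 1 * ∏ m F ≈ ∏ (m ℕ.+ m) (λ t → 1# - p ^ suc t) * S m
    ∏F≈S zero    _   = begin
      τ 1 * τ 1 * 1#                 ≈⟨ solve 1 (λ t → t :* t :* con 1ℤ := con 1ℤ :* (t :* t :+ con 0ℤ)) ≈-refl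
          (τ 1) ⟩
      1# * (τ 1 * τ 1 + 0#)          ≈⟨ *-congˡ
          (+-congˡ (∑-zero J (λ j → trans (*-congʳ (c-zero {0} {suc j} (s≤s z≤n))) (zeroˡ _)))) ⟨
      1# * S 0                       ∎
    ∏F≈S (suc m) m<J = begin
      τ 1 * τ 1 * ∏ (suc m) F                            ≈⟨ *-congˡ (∏-snoc m F) ⟩
      τ 1 * τ 1 * (∏ m F * F m)                          ≈⟨ *-assoc _ _ _ ⟨
      τ 1 * τ 1 * ∏ m F * F m                            ≈⟨ *-congʳ (∏F≈S m (ℕₚ.<⇒≤ m<J)) ⟩
      ∏ (m ℕ.+ m) h * S m * F m                          ≈⟨ trans (*-assoc _ _ _) (*-congˡ (*-comm _ _)) ⟩
      ∏ (m ℕ.+ m) h * (F m * S m)                        ≈⟨ *-congˡ (S-step m m<J) ⟨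
      ∏ (m ℕ.+ m) h * (Q m * S (suc m))                  ≈⟨ solve 4 (λ x y z w → x :* (y :* z :* w) := x :* y :*
          z :* w) ≈-refl _ _ _ _ ⟩
      ∏ (m ℕ.+ m) h * h (m ℕ.+ m) * h (suc (m ℕ.+ m)) * S (suc m)
        ≈⟨ *-congʳ (trans (*-congʳ (sym (∏-snoc (m ℕ.+ m) h))) (sym (∏-snoc (suc (m ℕ.+ m)) h))) ⟩
      ∏ (suc (suc (m ℕ.+ m))) h * S (suc m)              ≡⟨ cong (λ n → ∏ (suc n) h * S (suc m)) (ℕₚ.+-suc m m) ⟨
      ∏ (suc m ℕ.+ suc m) h * S (suc m)                  ∎
      where
      h : ℕ → Carrier
      h t = 1# - p ^ suc t

  J₀ : ℕ
  J₀ = M ℕ.+ M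

  -- The choice of `J₀` as 2M leaves two cases. If j + 1 ≥ M, the theta terms vanish. Otherwise J₀ -
  -- j ≥ M, and both products that make up `c` are 1.
  S-limit : S J₀ J₀ ≈ 1# + ∑ J₀ (λ j → E (suc j))
  S-limit = +-cong (trans (*-cong (τ-one _ M≤1+J₀) (T-one {J₀} {0} (ℕₚ.≤-trans (ℕₚ.+-monoʳ-≤ M z≤n) (ℕₚ.n≤1+n J₀))))
      (*-identityˡ 1#))
    (∑-congᵃ J₀ term)
    where
    τ-one : ∀ t → M ℕ.≤ t → τ t ≈ 1#
    τ-one t = tail-one 1-p^-one
    M≤1+J₀ : M ℕ.≤ suc (J₀ ℕ.+ 0)
    M≤1+J₀ = ℕₚ.≤-trans (ℕₚ.m≤m+n M M) (ℕₚ.≤-trans (ℕₚ.m≤m+n J₀ 0) (ℕₚ.n≤1+n _))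
    term : ∀ j → c J₀ (suc j) * E (suc j) ≈ E (suc j)
    term j with M ℕₚ.≤? suc j
    ... | yes M≤j = trans (*-congˡ E≈0) (trans (zeroʳ _) (sym E≈0))
      where
      E≈0 : E (suc j) ≈ 0#
      E≈0 = trans (+-cong (thetaTerm-vanish a (suc j) M≤j) (thetaTerm-vanish b (suc j) M≤j)) (+-identityˡ 0#)
    ... | no  M≰j = trans (*-congʳ (trans (*-cong
        (τ-one _ (ℕₚ.≤-trans (ℕₚ.m≤m+n M M) (ℕₚ.≤-trans (ℕₚ.m≤m+n J₀ (suc j)) (ℕₚ.n≤1+n _))))
                      (T-one {J₀} {suc j} (ℕₚ.≤-trans (ℕₚ.+-monoʳ-≤ M (ℕₚ.<⇒≤ (ℕₚ.≰⇒> M≰j))) (ℕₚ.n≤1+n J₀))))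
                          (*-identityˡ 1#))) (*-identityˡ _)

  -- Of the two factors `τ 1` in the finite form, one is the product (p ; p) of the identity. The
  -- other cancels against the limit of (p ; p)₂ₘ.
  triple-product : ∏ M (λ t → 1# - p ^ suc t) * ∏ M (λ t → (1# - u * p ^ t) * (1# - v * p ^ t))
                   ≈ 1# + ∑ J₀ (λ j → E (suc j))
  triple-product = unit-cancel {τ 1} (unit-∏ M unit-1-p^) (begin
    τ 1 * (τ 1 * ∏ M F₀)                            ≈⟨ *-assoc _ _ _ ⟨
    τ 1 * τ 1 * ∏ M F₀                              ≈⟨ *-congˡ (∏-stable F₀≈1 (ℕₚ.m≤m+n M M)) ⟨
    τ 1 * τ 1 * ∏ J₀ F₀                             ≈⟨ ∏F≈S J₀ J₀ ℕₚ.≤-refl ⟩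
    ∏ (J₀ ℕ.+ J₀) (λ t → 1# - p ^ suc t) * S J₀ J₀
        ≈⟨ *-cong (∏-stable (λ t M≤t → 1-p^-one (suc t) (ℕₚ.m≤n⇒m≤1+n M≤t)) (ℕₚ.≤-trans (ℕₚ.m≤m+n M M)
        (ℕₚ.m≤m+n J₀ J₀))) S-limit ⟩
    τ 1 * (1# + ∑ J₀ (λ j → E (suc j)))             ∎)
    where
    F₀ : ℕ → Carrier
    F₀ = F J₀
    F₀≈1 : ∀ t → M ℕ.≤ t → F₀ t ≈ 1#
    F₀≈1 t M≤t = trans (*-cong (one u) (one v)) (*-identityˡ 1#)
      where
      one : ∀ x → 1# - x * p ^ t ≈ 1#
      one x = 1-≈0 (trans (*-congˡ (trans (p^≈q^ t) (q^-vanish (ℕₚ.≤-trans M≤t (ℕₚ.m≤n*m t s))))) (zeroʳ x))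

-- Andrews's functions H and J for the Göllnitz–Gordon recurrences

module Exponents (K : ℕ) where
  open import Data.Nat.Base using (_+_; _*_; _≤_)
  open +-*-Solver using (solve; _:+_; _:*_; _:=_; con)

  -- The exponents in the n-th term of Andrews's H of index i at x = q ^ (2 (N + 1)),
  -- with d = K - i to avoid subtraction.
  lo : ℕ → ℕ → ℕ → ℕ
  lo N n d = 2 * K * (n * n) + 2 * K * (N * n) + 2 * d * n + n

  hi : ℕ → ℕ → ℕ → ℕ
  hi N n i = 2 * K * (n * n) + 2 * K * (N * n) + 2 * K * n + n + 2 * suc N * i + 2 * i * n

  lo-suc : ∀ N n d → lo N n d + 2 * n ≡ lo N n (suc d)
  lo-suc N n d = solve 4 (λ K N n d →
    con 2 :* K :* (n :* n) :+ con 2 :* K :* (N :* n) :+ con 2 :* d :* n :+ n :+ con 2 :* n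
    := con 2 :* K :* (n :* n) :+ con 2 :* K :* (N :* n) :+ con 2 :* (con 1 :+ d) :* n :+ n) refl K N n d

  hi-suc : ∀ N n i → hi N n i + 2 * suc (N + n) ≡ hi N n (suc i)
  hi-suc N n i = solve 4 (λ K N n i →
    con 2 :* K :* (n :* n) :+ con 2 :* K :* (N :* n) :+ con 2 :* K :* n :+ n :+ con 2 :* (con 1 :+ N) :* i :+
        con 2 :* i :* n :+ con 2 :* (con 1 :+ (N :+ n))
    := con 2 :* K :* (n :* n) :+ con 2 :* K :* (N :* n) :+ con 2 :* K :* n :+ n :+ con 2 :* (con 1 :+ N) :*
        (con 1 :+ i) :+ con 2 :* (con 1 :+ i) :* n) refl K N n i

  hi-lo : ∀ N n i → hi N n i ≡ 2 * suc N * i + lo (suc N) n i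
  hi-lo N n i = solve 4 (λ K N n i →
    con 2 :* K :* (n :* n) :+ con 2 :* K :* (N :* n) :+ con 2 :* K :* n :+ n :+ con 2 :* (con 1 :+ N) :* i :+
        con 2 :* i :* n
    := con 2 :* (con 1 :+ N) :* i :+ (con 2 :* K :* (n :* n) :+ con 2 :* K :* ((con 1 :+ N) :* n) :+ con 2 :* i :*
        n :+ n)) refl K N n i

  lo-hi : ∀ N n i d → suc i + d ≡ K → lo N (suc n) d ≡ 2 * suc N * i + (2 * suc N + 1) + hi (suc N) n d
  lo-hi N n i d refl = solve 4 (λ N n i d →
    con 2 :* (con 1 :+ i :+ d) :* ((con 1 :+ n) :* (con 1 :+ n)) :+ con 2 :* (con 1 :+ i :+ d) :*
        (N :* (con 1 :+ n)) :+ con 2 :* d :* (con 1 :+ n) :+ (con 1 :+ n)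
    := con 2 :* (con 1 :+ N) :* i :+ (con 2 :* (con 1 :+ N) :+ con 1)
       :+ (con 2 :* (con 1 :+ i :+ d) :* (n :* n) :+ con 2 :* (con 1 :+ i :+ d) :* ((con 1 :+ N) :* n) :+ con 2 :*
           (con 1 :+ i :+ d) :* n :+ n
       :+ con 2 :* (con 1 :+ (con 1 :+ N)) :* d :+ con 2 :* d :* n)) refl N n i d

  n≤lo : ∀ N n d → n ≤ lo N n d
  n≤lo N n d = ℕₚ.m≤n+m n _

  N≤lo : ∀ {k} → K ≡ suc k → ∀ N n d → N ≤ lo N (suc n) d
  N≤lo {k} refl N n d = ℕₚ.≤-trans (ℕₚ.m≤m*n N (suc n)) (ℕₚ.≤-trans (ℕₚ.m≤n*m (N * suc n) (2 * suc k))
    (ℕₚ.≤-trans (ℕₚ.m≤n+m (2 * suc k * (N * suc n)) (2 * suc k * (suc n * suc n)))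
      (ℕₚ.≤-trans (ℕₚ.m≤m+n _ (2 * d * suc n)) (ℕₚ.m≤m+n _ (suc n)))))

  n≤hi : ∀ N n i → n ≤ hi N n i
  n≤hi N n i = subst (n ≤_) (≡.sym (hi-lo N n i)) (ℕₚ.≤-trans (n≤lo (suc N) n i) (ℕₚ.m≤n+m (lo (suc N) n i)
      (2 * suc N * i)))

  N≤hi : ∀ N n i → N ≤ hi N n (suc i)
  N≤hi N n i = subst (N ≤_) (hi-suc N n i) (ℕₚ.≤-trans (ℕₚ.≤-trans (ℕₚ.≤-trans (ℕₚ.m≤m+n N n) (ℕₚ.n≤1+n _))
      (ℕₚ.m≤m+n _ _)) (ℕₚ.m≤n+m _ (hi N n i)))

  tri-double : ∀ n → 2 * tri n + n ≡ n * n
  tri-double zero    = refl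
  tri-double (suc n) = ≡.trans (solve 2 (λ n t → con 2 :* (n :+ t) :+ (con 1 :+ n) := (con 2 :* t :+ n) :+
      (con 2 :* n :+ con 1)) refl n (tri n))
    (≡.trans (cong (_+ (2 * n + 1)) (tri-double n)) (solve 1 (λ n → n :* n :+ (con 2 :* n :+ con 1) := (con 1 :+ n)
        :* (con 1 :+ n)) refl n))

  -- The exponent of the n-th theta term for v = q ^ (4K - 2i - 1) in base q ^ (4K). In the
  -- companion `hi-tri` the term for u = q ^ (2i + 1) has index n + 1.
  lo-tri : ∀ n i d → suc i + d ≡ K →
    suc (2 * i + 4 * d + 2) * n + (suc (2 * i) + suc (2 * i + 4 * d + 2)) * tri n ≡ lo 0 n d
  lo-tri n i d refl = ≡.trans (solve 4 (λ n i d t →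
      (con 1 :+ (con 2 :* i :+ con 4 :* d :+ con 2)) :* n :+ ((con 1 :+ con 2 :* i) :+
          (con 1 :+ (con 2 :* i :+ con 4 :* d :+ con 2))) :* t
      := con 2 :* (con 1 :+ i :+ d) :* (con 2 :* t :+ n) :+ (con 2 :* d :* n :+ n)) refl n i d (tri n))
    (≡.trans (cong (λ m → 2 * K * m + (2 * d * n + n)) (tri-double n))
      (solve 3 (λ n i d → con 2 :* (con 1 :+ i :+ d) :* (n :* n) :+ (con 2 :* d :* n :+ n)
        := con 2 :* (con 1 :+ i :+ d) :* (n :* n) :+ con 2 :* (con 1 :+ i :+ d) :* con 0 :+ con 2 :* d :* n :+ n)
            refl n i d))

  hi-tri : ∀ n i d → suc i + d ≡ K →
    suc (2 * i) * suc n + (suc (2 * i) + suc (2 * i + 4 * d + 2)) * tri (suc n) ≡ suc (hi 0 n i)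
  hi-tri n i d refl = ≡.trans (solve 4 (λ n i d t →
      (con 1 :+ con 2 :* i) :* (con 1 :+ n) :+ ((con 1 :+ con 2 :* i) :+
          (con 1 :+ (con 2 :* i :+ con 4 :* d :+ con 2))) :* (n :+ t)
      := con 2 :* (con 1 :+ i :+ d) :* (con 2 :* t :+ n) :+ (con 2 :* (con 1 :+ i :+ d) :* n :+
          (con 1 :+ con 2 :* i) :* (con 1 :+ n))) refl n i d (tri n))
    (≡.trans (cong (λ m → 2 * K * m + (2 * K * n + suc (2 * i) * suc n)) (tri-double n))
      (solve 3 (λ n i d → con 2 :* (con 1 :+ i :+ d) :* (n :* n) :+ (con 2 :* (con 1 :+ i :+ d) :* n :+
          (con 1 :+ con 2 :* i) :* (con 1 :+ n))
        := con 1 :+ (con 2 :* (con 1 :+ i :+ d) :* (n :* n) :+ con 2 :* (con 1 :+ i :+ d) :* con 0 :+ con 2 :*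
            (con 1 :+ i :+ d) :* n :+ n :+ con 2 :* con 1 :* i :+ con 2 :* i :* n)) refl n i d))

module AndrewsSeries
  (R : CommutativeRing 0ℓ 0ℓ) (q : CommutativeRing.Carrier R) (M : ℕ)
  (q^M≈0 : CommutativeRing._≈_ R (power R q M) (CommutativeRing.0# R)) (K : ℕ) where

  open Nilpotent R q M q^M≈0
  open Exponents K
  open import Relation.Binary.Reasoning.Setoid setoid

  od ev : ℕ → Carrier
  od t = 1# + q ^ (2 ℕ.* t ℕ.+ 1)
  ev t = 1# - q ^ (2 ℕ.* t)

  od-one : ∀ t → M ℕ.≤ t → od t ≈ 1#
  od-one t M≤t = 1+q^-one (ℕₚ.≤-trans M≤t (ℕₚ.≤-trans (ℕₚ.m≤m+n t _) (ℕₚ.m≤m+n (2 ℕ.* t) 1)))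

  oddTail oddHead : ℕ → Carrier
  oddTail   = tail od
  oddHead n = ∏ n od

  evenRun : ℕ → ℕ → Carrier
  evenRun N n = ∏ N (λ t → ev (suc n ℕ.+ t))

  evenRun-front : ∀ N n → evenRun (suc N) n ≈ ev (suc n) * evenRun N (suc n)
  evenRun-front N n = *-cong (reflexive (cong (ev ∘ suc) (ℕₚ.+-identityʳ n)))
    (∏-cong N (λ t → reflexive (cong (ev ∘ suc) (ℕₚ.+-suc n t))))

  evenRun-back : ∀ N n → evenRun (suc N) n ≈ evenRun N n * ev (suc (N ℕ.+ n))
  evenRun-back N n = trans (∏-snoc N _) (*-congˡ (reflexive (cong (ev ∘ suc) (ℕₚ.+-comm n N))))

  -- Up to sign and powers of q, with Q = q², this is (a x Q ^ (n+1) ; Q) (1/a ; Q)ₙ / ((Q ; Q)ₙ (x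
  -- Q ^ n ; Q)) from Andrews's series, times (Q ; Q). At x = q ^ (2 (N + 1)) this multiplication
  -- turns the denominator into the finite product `evenRun N n`.
  C : ℕ → ℕ → Carrier
  C N n = oddTail (suc (N ℕ.+ n)) * oddHead n * evenRun N n

  -- (q² ; q²) times Andrews's H of index i, with a = -1/q, base q² and x = q ^ (2 (N + 1)).
  H : ℕ → ℕ → ℕ → Carrier
  H N i d = ∑ M (λ n → sgn n * C N n * (q ^ lo N n d - q ^ hi N n i))

  -- Andrews's J of index i + 1 at x = q ^ (2N), which combines H of indices i + 1 and i at x q².
  -- Its coefficient - a x q² is q ^ (2N + 1).
  J : ℕ → ℕ → ℕ → Carrier
  J N i d = H N (suc i) d + q ^ (2 ℕ.* N ℕ.+ 1) * H N i (suc d)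

  H-zero : ∀ N d → d ≡ K → H N 0 d ≈ 0#
  H-zero N d refl = ∑-zero M (λ n → trans (*-congˡ (trans (+-congˡ (-‿cong (q^-cong (
      N.solve 3 (λ K N n → N.con 2 N.:* K N.:* (n N.:* n) N.:+ N.con 2 N.:* K N.:* (N N.:* n) N.:+ N.con 2 N.:*
          K N.:* n N.:+ n N.:+ N.con 2 N.:* (N.con 1 N.:+ N) N.:* N.con 0 N.:+ N.con 2 N.:* N.con 0 N.:* n
        N.:= N.con 2 N.:* K N.:* (n N.:* n) N.:+ N.con 2 N.:* K N.:* (N N.:* n) N.:+ N.con 2 N.:* K N.:* n N.:+ n)
            refl K N n)))) (-‿inverseʳ _))) (zeroʳ _))
    where module N = +-*-Solver

  H-rec : ∀ N i d → suc i ℕ.+ d ≡ K →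
    H N (suc i) d ≈ H N i (suc d) + q ^ (2 ℕ.* suc N ℕ.* i) * J (suc N) d i
  -- The difference of the n-th terms splits into left n + right n; the terms left (n + 1)
  -- and right n share the factor C (N + 1) n.
  H-rec N i d i+d≡K = begin
    H N (suc i) d
      ≈⟨ ∑-congᵃ M split ⟩
    ∑ M (λ n → sgn n * C N n * (q ^ lo N n (suc d) - q ^ hi N n i) + (left n + right n))
      ≈⟨ trans (∑-+ M _ _) (+-congˡ (∑-+ M left right)) ⟩
    H N i (suc d) + (∑ M left + ∑ M right)
      ≈⟨ +-congˡ (+-congʳ shift) ⟩
    H N i (suc d) + (∑ M (left ∘ suc) + ∑ M right)
      ≈⟨ +-congˡ (∑-+ M (left ∘ suc) right) ⟨
    H N i (suc d) + ∑ M (λ n → left (suc n) + right n)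
      ≈⟨ +-congˡ (∑-congᵃ M merge) ⟩
    H N i (suc d) + ∑ M (λ n → q ^ (2 ℕ.* suc N ℕ.* i) * (h₁ n + q ^ (2 ℕ.* suc N ℕ.+ 1) * h₂ n))
      ≈⟨ +-congˡ (trans (∑-*ˡ M _ _) (*-congˡ (trans (∑-+ M _ _) (+-congˡ (∑-*ˡ M _ _))))) ⟩
    H N i (suc d) + q ^ (2 ℕ.* suc N ℕ.* i) * J (suc N) d i ∎
    where
    left right h₁ h₂ : ℕ → Carrier
    left n  = sgn n * C N n * (q ^ lo N n d * ev n)
    right n = sgn n * C N n * (q ^ hi N n i * ev (suc (N ℕ.+ n)))
    h₁ n = sgn n * C (suc N) n * (q ^ lo (suc N) n i - q ^ hi (suc N) n (suc d))
    h₂ n = sgn n * C (suc N) n * (q ^ lo (suc N) n (suc i) - q ^ hi (suc N) n d)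

    split : ∀ n → sgn n * C N n * (q ^ lo N n d - q ^ hi N n (suc i)) ≈
                  sgn n * C N n * (q ^ lo N n (suc d) - q ^ hi N n i) + (left n + right n)
    split n = begin
      s * (x - q ^ hi N n (suc i))
        ≈⟨ *-congˡ (+-congˡ (-‿cong (sym (q^-+ (hi N n i) (2 ℕ.* suc (N ℕ.+ n)) (hi-suc N n i))))) ⟩
      s * (x - y * z)
        ≈⟨ solve 5 (λ s x y z w → s :* (x :- y :* z) := s :* (x :* w :- y) :+ (s :* (x :* (con 1ℤ :- w)) :+ s :*
            (y :* (con 1ℤ :- z)))) ≈-refl s x y z w ⟩
      s * (x * w - y) + (left n + right n)
        ≈⟨ +-congʳ (*-congˡ (+-congʳ (q^-+ (lo N n d) (2 ℕ.* n) (lo-suc N n d)))) ⟩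
      s * (q ^ lo N n (suc d) - y) + (left n + right n) ∎
      where
      s x y z w : Carrier
      s = sgn n * C N n
      x = q ^ lo N n d
      y = q ^ hi N n i
      z = q ^ (2 ℕ.* suc (N ℕ.+ n))
      w = q ^ (2 ℕ.* n)

    shift : ∑ M left ≈ ∑ M (left ∘ suc)
    shift = begin
      ∑ M left                    ≈⟨ +-identityʳ _ ⟨
      ∑ M left + 0#               ≈⟨ +-congˡ (trans (*-congˡ (trans (*-congʳ (q^-vanish (n≤lo N M d))) (zeroˡ _)))
          (zeroʳ _)) ⟨
      ∑ M left + left M           ≈⟨ ∑-snoc M left ⟨
      left 0 + ∑ M (left ∘ suc)   ≈⟨ +-congʳ (trans (*-congˡ (trans (*-congˡ (-‿inverseʳ 1#)) (zeroʳ _))) (zeroʳ _))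
          ⟩
      0# + ∑ M (left ∘ suc)       ≈⟨ +-identityˡ _ ⟩
      ∑ M (left ∘ suc)            ∎

    merge : ∀ n → left (suc n) + right n ≈
                  q ^ (2 ℕ.* suc N ℕ.* i) * (h₁ n + q ^ (2 ℕ.* suc N ℕ.+ 1) * h₂ n)
    merge n = begin
      - σ * (oddTail (suc (N ℕ.+ suc n)) * oddHead (suc n) * evenRun N (suc n)) * (q ^ lo N (suc n) d * ev (suc n))
        + σ * (oddTail (suc (N ℕ.+ n)) * oddHead n * evenRun N n) * (q ^ hi N n i * ev (suc (N ℕ.+ n)))
        ≈⟨ +-cong
             (*-cong (*-congˡ (*-congʳ (*-cong (reflexive (cong (oddTail ∘ suc) (ℕₚ.+-suc N n))) (∏-snoc n od))))
                     (*-congʳ (trans (q^-cong (lo-hi N n i d i+d≡K))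
                         (trans (sym (q^-+ (2 ℕ.* suc N ℕ.* i ℕ.+ (2 ℕ.* suc N ℕ.+ 1)) (hi (suc N) n d) refl))
                        (*-congʳ (sym (q^-+ (2 ℕ.* suc N ℕ.* i) (2 ℕ.* suc N ℕ.+ 1) refl)))))))
             (*-cong (*-congˡ (*-congʳ (*-congʳ (tail-step od-one (suc (N ℕ.+ n))))))
                     (*-congʳ (trans (q^-cong (hi-lo N n i)) (sym (q^-+ (2 ℕ.* suc N ℕ.* i) (lo (suc N) n i)
                         refl))))) ⟩
      - σ * (O * (o * (1# + z)) * evenRun N (suc n)) * (x * w * y₂ * ev (suc n))
        + σ * (od (suc (N ℕ.+ n)) * O * o * evenRun N n) * (x * y₁ * ev (suc (N ℕ.+ n)))
        ≈⟨ solve 13 (λ σ O o z r e x w y₂ v r′ e′ y₁ →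
             :- σ :* (O :* (o :* (con 1ℤ :+ z)) :* r) :* (x :* w :* y₂ :* e) :+ σ :* ((con 1ℤ :+ v) :* O :* o :* r′)
                 :* (x :* y₁ :* e′)
             := σ :* (O :* o) :* (x :* (y₁ :+ v :* y₁)) :* (r′ :* e′) :- σ :* (O :* o) :*
                 (x :* (w :* y₂ :+ w :* y₂ :* z)) :* (e :* r)) ≈-refl
             σ O o z (evenRun N (suc n)) (ev (suc n)) x w y₂ v (evenRun N n) (ev (suc (N ℕ.+ n))) y₁ ⟩
      σ * (O * o) * (x * (y₁ + v * y₁)) * (evenRun N n * ev (suc (N ℕ.+ n)))
        - σ * (O * o) * (x * (w * y₂ + w * y₂ * z)) * (ev (suc n) * evenRun N (suc n))
        ≈⟨ +-cong (*-cong (*-congˡ (*-congˡ (+-congˡ vy₁))) (sym (evenRun-back N n)))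
                  (-‿cong (*-cong (*-congˡ (*-congˡ (+-congˡ wy₂z))) (sym (evenRun-front N n)))) ⟩
      σ * (O * o) * (x * (y₁ + w * y₃)) * r″ - σ * (O * o) * (x * (w * y₂ + y₄)) * r″
        ≈⟨ solve 8 (λ s x y₁ y₂ y₃ y₄ w r → s :* (x :* (y₁ :+ w :* y₃)) :* r :- s :* (x :* (w :* y₂ :+ y₄)) :* r
             := x :* (s :* r :* (y₁ :- y₄) :+ w :* (s :* r :* (y₃ :- y₂)))) ≈-refl (σ * (O * o)) x y₁ y₂ y₃ y₄ w r″
                 ⟩
      x * (σ * (O * o) * r″ * (y₁ - y₄) + w * (σ * (O * o) * r″ * (y₃ - y₂)))
        ≈⟨ *-congˡ (+-cong (*-congʳ (*-assoc _ _ _)) (*-congˡ (*-congʳ (*-assoc _ _ _)))) ⟩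
      x * (h₁ n + w * h₂ n) ∎
      where
      σ O o z x w v y₁ y₂ y₃ y₄ r″ : Carrier
      σ = sgn n
      O = oddTail (suc (suc (N ℕ.+ n)))
      o = oddHead n
      z = q ^ (2 ℕ.* n ℕ.+ 1)
      x = q ^ (2 ℕ.* suc N ℕ.* i)
      w = q ^ (2 ℕ.* suc N ℕ.+ 1)
      v = q ^ (2 ℕ.* suc (N ℕ.+ n) ℕ.+ 1)
      y₁ = q ^ lo (suc N) n i
      y₂ = q ^ hi (suc N) n d
      y₃ = q ^ lo (suc N) n (suc i)
      y₄ = q ^ hi (suc N) n (suc d)
      r″ = evenRun (suc N) n
      module N = +-*-Solver
      vy₁ : v * y₁ ≈ w * y₃
      vy₁ = trans (q^-+ (2 ℕ.* suc (N ℕ.+ n) ℕ.+ 1) (lo (suc N) n i) (≡.trans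
        (N.solve 3 (λ N n l → N.con 2 N.:* (N.con 1 N.:+ (N N.:+ n)) N.:+ N.con 1 N.:+ l N.:= N.con 2 N.:*
            (N.con 1 N.:+ N) N.:+ N.con 1 N.:+ (l N.:+ N.con 2 N.:* n)) refl N n (lo (suc N) n i))
        (cong (2 ℕ.* suc N ℕ.+ 1 ℕ.+_) (lo-suc (suc N) n i))))
            (sym (q^-+ (2 ℕ.* suc N ℕ.+ 1) (lo (suc N) n (suc i)) refl))
      wy₂z : w * y₂ * z ≈ y₄
      wy₂z = trans (*-congʳ (q^-+ (2 ℕ.* suc N ℕ.+ 1) (hi (suc N) n d) refl))
        (q^-+ (2 ℕ.* suc N ℕ.+ 1 ℕ.+ hi (suc N) n d) (2 ℕ.* n ℕ.+ 1) (≡.trans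
          (N.solve 3 (λ N n h → N.con 2 N.:* (N.con 1 N.:+ N) N.:+ N.con 1 N.:+ h N.:+ (N.con 2 N.:* n N.:+ N.con 1)
              N.:= h N.:+ N.con 2 N.:* (N.con 1 N.:+ (N.con 1 N.:+ N N.:+ n))) refl N n (hi (suc N) n d))
          (hi-suc (suc N) n d)))

  J-first : ∀ N d → suc d ≡ K → J N 0 d ≈ J (suc N) d 0
  J-first N d 1+d≡K = begin
    H N 1 d + q ^ (2 ℕ.* N ℕ.+ 1) * H N 0 (suc d)
      ≈⟨ +-cong (H-rec N 0 d 1+d≡K) (*-congˡ (H-zero N (suc d) 1+d≡K)) ⟩
    H N 0 (suc d) + q ^ (2 ℕ.* suc N ℕ.* 0) * J (suc N) d 0 + q ^ (2 ℕ.* N ℕ.+ 1) * 0#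
      ≈⟨ +-congʳ (+-cong (H-zero N (suc d) 1+d≡K) (*-congʳ (q^-cong (ℕₚ.*-zeroʳ (2 ℕ.* suc N))))) ⟩
    0# + 1# * J (suc N) d 0 + q ^ (2 ℕ.* N ℕ.+ 1) * 0#
      ≈⟨ solve 2 (λ x y → con 0ℤ :+ con 1ℤ :* x :+ y :* con 0ℤ := x) ≈-refl _ _ ⟩
    J (suc N) d 0 ∎

  J-rec : ∀ N i d → suc (suc i) ℕ.+ d ≡ K →
    J N (suc i) d ≈ J N i (suc d) + (q ^ (2 ℕ.* suc N ℕ.* suc i) * J (suc N) d (suc i)
                                     + q ^ (2 ℕ.* N ℕ.+ 1) * (q ^ (2 ℕ.* suc N ℕ.* i) * J (suc N) (suc d) i))
  J-rec N i d i+d≡K = begin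
    H N (suc (suc i)) d + y * H N (suc i) (suc d)
      ≈⟨ +-cong (H-rec N (suc i) d i+d≡K) (*-congˡ (H-rec N i (suc d) (≡.trans (ℕₚ.+-suc (suc i) d) i+d≡K))) ⟩
    H N (suc i) (suc d) + _ + y * (H N i (suc (suc d)) + _)
      ≈⟨ solve 5 (λ a b y c d → a :+ b :+ y :* (c :+ d) := a :+ y :* c :+ (b :+ y :* d)) ≈-refl _ _ _ _ _ ⟩
    _ ∎
    where
    y : Carrier
    y = q ^ (2 ℕ.* N ℕ.+ 1)

  -- At x = q ^ (2M) every positive power of x vanishes, so only the term n = 0 of the series
  -- survives. This is the initial value that pins down the solution of the recurrences.
  J-limit : ∀ i d → suc i ℕ.+ d ≡ K → J M i d ≈ evenRun M 0
  J-limit i d i+d≡K = begin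
    H M (suc i) d + q ^ (2 ℕ.* M ℕ.+ 1) * H M i (suc d)
      ≈⟨ +-cong (∑-cong M first) (*-congʳ (q^-vanish (ℕₚ.≤-trans (ℕₚ.m≤m+n M _) (ℕₚ.m≤m+n (2 ℕ.* M) 1)))) ⟩
    ∑ M only₀ + 0# * H M i (suc d)
      ≈⟨ +-cong (∑-only₀ M q^M≈0) (zeroˡ _) ⟩
    evenRun M 0 + 0# ≈⟨ +-identityʳ _ ⟩
    evenRun M 0 ∎
    where
    only₀ : ℕ → Carrier
    only₀ zero    = evenRun M 0
    only₀ (suc _) = 0#

    first : ∀ n → n ℕ.< M → sgn n * C M n * (q ^ lo M n d - q ^ hi M n (suc i)) ≈ only₀ n
    first zero    _ = begin
      1# * (oddTail (suc (M ℕ.+ 0)) * 1# * evenRun M 0) * (q ^ lo M 0 d - q ^ hi M 0 (suc i))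
        ≈⟨ *-cong (*-congˡ (*-congʳ (*-congʳ (tail-one od-one (ℕₚ.≤-trans (ℕₚ.m≤m+n M 0) (ℕₚ.n≤1+n _))))))
                  (+-cong (q^-cong {n = 0} (N.solve 3 (λ K M d → N.con 2 N.:* K N.:* N.con 0 N.:+ N.con 2 N.:*
                      K N.:* (M N.:* N.con 0) N.:+ N.con 2 N.:* d N.:* N.con 0 N.:+ N.con 0 N.:= N.con 0) refl K M
                      d))
                          (-‿cong (q^-vanish (N≤hi M 0 i)))) ⟩
      1# * (1# * 1# * evenRun M 0) * (1# - 0#)
        ≈⟨ solve 1 (λ x → con 1ℤ :* (con 1ℤ :* con 1ℤ :* x) :* (con 1ℤ :- con 0ℤ) := x) ≈-refl _ ⟩
      evenRun M 0 ∎
      where module N = +-*-Solver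
    first (suc n) _ = trans (*-congˡ (trans (+-cong (q^-vanish (N≤lo (≡.sym i+d≡K) M n d))
        (-‿cong (q^-vanish (N≤hi M (suc n) i)))) (-‿inverseʳ 0#))) (zeroʳ _)

    ∑-only₀ : ∀ m → q ^ m ≈ 0# → ∑ m only₀ ≈ evenRun M 0
    -- For M = 0 the sum is empty, but the ring is trivial.
    ∑-only₀ zero    1≈0 = trans (sym (zeroˡ _)) (trans (*-congʳ (sym 1≈0)) (*-identityˡ _))
    ∑-only₀ (suc m) _   = trans (+-congˡ (∑-zero m (λ _ → ≈-refl))) (+-identityʳ _)

  theta : ℕ → ℕ → Carrier
  theta i d = ∑ M (λ n → sgn n * (q ^ lo 0 n d - q ^ suc (hi 0 n i)))

  -- At N = 0 the even run is empty, and the odd factors in `C` lack exactly `od n`. The two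
  -- H-series supply it: with w = q ^ (2n), (x - q² y w) + q (x w - y) = (1 + q w) (x - q y).
  J-theta : ∀ i d → J 0 i d ≈ oddTail 0 * theta i d
  J-theta i d = begin
    H 0 (suc i) d + q ^ 1 * H 0 i (suc d)
      ≈⟨ trans (+-congˡ (sym (∑-*ˡ M _ _))) (sym (∑-+ M _ _)) ⟩
    ∑ M (λ n → sgn n * C 0 n * (q ^ lo 0 n d - q ^ hi 0 n (suc i)) + q ^ 1 *
        (sgn n * C 0 n * (q ^ lo 0 n (suc d) - q ^ hi 0 n i)))
      ≈⟨ ∑-congᵃ M term ⟩
    ∑ M (λ n → oddTail 0 * (sgn n * (q ^ lo 0 n d - q ^ suc (hi 0 n i))))
      ≈⟨ ∑-*ˡ M _ _ ⟩
    oddTail 0 * theta i d ∎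
    where
    term : ∀ n → sgn n * C 0 n * (q ^ lo 0 n d - q ^ hi 0 n (suc i)) + q ^ 1 *
        (sgn n * C 0 n * (q ^ lo 0 n (suc d) - q ^ hi 0 n i))
               ≈ oddTail 0 * (sgn n * (q ^ lo 0 n d - q ^ suc (hi 0 n i)))
    term n = begin
      σ * (O * o * 1#) * (x - q ^ hi 0 n (suc i)) + q ^ 1 * (σ * (O * o * 1#) * (q ^ lo 0 n (suc d) - y))
        ≈⟨ +-cong (*-congˡ (+-congˡ (-‿cong (sym hi′)))) (*-cong (*-identityʳ q) (*-congˡ (+-congʳ (sym lo′)))) ⟩
      σ * (O * o * 1#) * (x - q * y * (q * w)) + q * (σ * (O * o * 1#) * (x * w - y))
        ≈⟨ solve 7 (λ σ O o x y q w → σ :* (O :* o :* con 1ℤ) :* (x :- q :* y :* (q :* w)) :+ q :*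
            (σ :* (O :* o :* con 1ℤ) :* (x :* w :- y))
             := o :* ((con 1ℤ :+ q :* w) :* O) :* (σ :* (x :- q :* y))) ≈-refl σ O o x y q w ⟩
      o * ((1# + q * w) * O) * (σ * (x - q * y))
        ≈⟨ *-congʳ (trans (*-congˡ (trans (*-congʳ (+-congˡ (reflexive (cong (q ^_) (ℕₚ.+-comm 1 (2 ℕ.* n))))))
            (sym (tail-step od-one n)))) (sym (tail-split od-one n))) ⟩
      oddTail 0 * (σ * (x - q * y)) ∎
      where
      σ O o x y w : Carrier
      σ = sgn n
      O = oddTail (suc n)
      o = oddHead n
      x = q ^ lo 0 n d
      y = q ^ hi 0 n i
      w = q ^ (2 ℕ.* n)
      lo′ : x * w ≈ q ^ lo 0 n (suc d)
      lo′ = q^-+ (lo 0 n d) (2 ℕ.* n) (lo-suc 0 n d)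
      module N = +-*-Solver
      hi′ : q * y * (q * w) ≈ q ^ hi 0 n (suc i)
      hi′ = q^-+ (suc (hi 0 n i)) (suc (2 ℕ.* n))
          (≡.trans (N.solve 2 (λ h n → N.con 1 N.:+ h N.:+ (N.con 1 N.:+ N.con 2 N.:* n) N.:= h N.:+ N.con 2 N.:*
          (N.con 1 N.:+ n)) refl (hi 0 n i) n) (hi-suc 0 n i))

  theta-product : ∀ i d → suc i ℕ.+ d ≡ K →
    theta i d ≈ (∏ M (λ t → 1# - q ^ (4 ℕ.* K ℕ.* suc t)) *
      ∏ M (λ t → 1# - q ^ (4 ℕ.* K ℕ.* t ℕ.+ suc (2 ℕ.* i)))) * ∏ M
          (λ t → 1# - q ^ (4 ℕ.* K ℕ.* t ℕ.+ suc (2 ℕ.* i ℕ.+ 4 ℕ.* d ℕ.+ 2)))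
  theta-product i d i+d≡K = begin
    theta i d
      ≈⟨ ∑-stable ⟨
    ∑ J₀ f
      ≈⟨ ∑-congᵃ J₀ (λ n → trans (+-cong (V-term n) (U-term n)) (sym (distribˡ _ _ _))) ⟨
    -- The branch `V` starts at 0 and the branch `U` at 1, so together they run once through a theta
    -- series indexed by all integers.
    ∑ J₀ (λ n → V n + U (suc n))
      ≈⟨ ∑-+ J₀ V (U ∘ suc) ⟩
    ∑ J₀ V + ∑ J₀ (U ∘ suc)
      ≈⟨ +-congʳ (trans (∑-snoc J₀ V) (trans (+-congˡ (thetaTerm-vanish (2 ℕ.* i ℕ.+ 4 ℕ.* d ℕ.+ 2) J₀
          (ℕₚ.m≤m+n M M))) (+-identityʳ _))) ⟨
    1# + ∑ J₀ (V ∘ suc) + ∑ J₀ (U ∘ suc)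
      ≈⟨ trans (+-assoc _ _ _) (+-congˡ (trans (+-comm _ _) (sym (∑-+ J₀ (U ∘ suc) (V ∘ suc))))) ⟩
    1# + ∑ J₀ (λ j → E (suc j))
      ≈⟨ triple-product ⟨
    ∏ M (λ t → 1# - p ^ suc t) * ∏ M (λ t → (1# - u * p ^ t) * (1# - v * p ^ t))
      ≈⟨ *-congˡ (∏-* M _ _) ⟩
    ∏ M (λ t → 1# - p ^ suc t) * (∏ M (λ t → 1# - u * p ^ t) * ∏ M (λ t → 1# - v * p ^ t))
      ≈⟨ *-assoc _ _ _ ⟨
    ∏ M (λ t → 1# - p ^ suc t) * ∏ M (λ t → 1# - u * p ^ t) * ∏ M (λ t → 1# - v * p ^ t)
      ≈⟨ *-cong (*-cong (∏-cong M (λ t → +-congˡ (-‿cong (p^≈ (suc t)))))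
          (∏-cong M (λ t → +-congˡ (-‿cong (xp≈ _ t)))))
           (∏-cong M (λ t → +-congˡ (-‿cong (xp≈ _ t)))) ⟩
    _ ∎
    where
    open JacobiTriple R q M q^M≈0 (2 ℕ.* i) (2 ℕ.* i ℕ.+ 4 ℕ.* d ℕ.+ 2)
    module N = +-*-Solver
    s≡4K : s ≡ 4 ℕ.* K
    s≡4K = ≡.trans (N.solve 2 (λ i d → (N.con 1 N.:+ N.con 2 N.:* i) N.:+
        (N.con 1 N.:+ (N.con 2 N.:* i N.:+ N.con 4 N.:* d N.:+ N.con 2)) N.:= N.con 4 N.:* (N.con 1 N.:+ i N.:+ d))
        refl i d) (cong (4 ℕ.*_) i+d≡K)
    p^≈ : ∀ t → p ^ t ≈ q ^ (4 ℕ.* K ℕ.* t)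
    p^≈ t = trans (p^≈q^ t) (q^-cong (cong (ℕ._* t) s≡4K))
    xp≈ : ∀ e t → q ^ e * p ^ t ≈ q ^ (4 ℕ.* K ℕ.* t ℕ.+ e)
    xp≈ e t = trans (*-congˡ (p^≈ t)) (q^-+ e (4 ℕ.* K ℕ.* t) (ℕₚ.+-comm e _))
    f U V : ℕ → Carrier
    f n = sgn n * (q ^ lo 0 n d - q ^ suc (hi 0 n i))
    U = thetaTerm u
    V = thetaTerm v
    V-term : ∀ n → V n ≈ sgn n * q ^ lo 0 n d
    V-term n = trans (thetaTerm-closed (suc (2 ℕ.* i ℕ.+ 4 ℕ.* d ℕ.+ 2)) n) (*-congˡ (q^-cong (lo-tri n i d i+d≡K)))
    U-term : ∀ n → U (suc n) ≈ sgn n * - q ^ suc (hi 0 n i)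
    U-term n = trans (thetaTerm-closed (suc (2 ℕ.* i)) (suc n)) (trans (*-congˡ (q^-cong (hi-tri n i d i+d≡K)))
      (solve 2 (λ s x → :- s :* x := s :* :- x) ≈-refl (sgn n) _))
    ∑-stable : ∑ J₀ f ≈ ∑ M f
    ∑-stable = extend M
      where
      extend : ∀ m → ∑ (M ℕ.+ m) f ≈ ∑ M f
      extend zero    = reflexive (cong (λ n → ∑ n f) (ℕₚ.+-identityʳ M))
      extend (suc m) = trans (reflexive (cong (λ n → ∑ n f) (ℕₚ.+-suc M m))) (trans (∑-snoc (M ℕ.+ m) f)
        (trans (+-cong (extend m) (trans (*-congˡ (trans (+-cong (q^-vanish (ℕₚ.≤-trans M≤ (n≤lo 0 _ d)))
                                                       (-‿cong (q^-vanish (ℕₚ.≤-trans M≤ (ℕₚ.m≤n⇒m≤1+n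
                                                           (n≤hi 0 _ i)))))) (-‿inverseʳ 0#))) (zeroʳ _)))
                                                           (+-identityʳ _)))
        where
        M≤ : M ℕ.≤ M ℕ.+ m
        M≤ = ℕₚ.m≤m+n M m

-- The generating function of B

-- The entry (f , g) in position m (counted from 0) prescribes f non-overlined
-- parts of size m + 1, and an overlined one iff g holds.
Config : Set
Config = List (ℕ × Bool)

bit : Bool → ℕ
bit g = if g then 1 else 0

configWeight : ℕ → Config → ℕ
configWeight m []            = 0
configWeight m ((f , g) ∷ c) = suc m ℕ.* (f ℕ.+ bit g) ℕ.+ configWeight (suc m) c

-- A block (g , f , h) at level m records an overlined 2m+1, f copies of 2m+2 and
-- an overlined 2m+2.  In state i a block must satisfy bit g + f < i; the capacity
-- c is K + 1 if bit g + f ≡ i - 1 (mod 2) and K otherwise, and the following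
-- state is what the parts of size 2m+2 leave of it.
Block : Set
Block = Bool × ℕ × Bool

-- An overlined 2m+2 has its own window of j + 1 parts. The test j + 2 ≤ c expresses both its length
-- bound and its parity condition, the parity being already encoded in the capacity.
tops : ℕ → ℕ → Bool → ℕ → List (Block × ℕ)
tops c j g f = ((g , f , false) , c ℕ.∸ f) ∷
  (if does (suc (suc j) ℕₚ.≤? c) then ((g , f , true) , c ℕ.∸ suc f) ∷ [] else [])

options : ℕ → ℕ → List (Block × ℕ)
options c zero    = tops c zero false zero
options c (suc j) = tops c (suc j) false (suc j) ++ tops c (suc j) true j

-- The capacity depends only on the parity of i - 1 - j. Beyond the sums i - 1 and i - 2 the choices
-- are therefore those of the state i - 2, which is why differences D(i) - D(i-2) appear.
choices : ℕ → ℕ → List (Block × ℕ)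
choices K zero          = []
choices K (suc zero)    = options (suc K) 0
choices K (suc (suc i)) = options (suc K) (suc i) ++ options K i ++ choices K i

prepend : Block → Config → Config
prepend (g , f , h) c = (0 , g) ∷ (f , h) ∷ c

configsB : ℕ → ℕ → ℕ → List Config
configsB K zero    i = [] ∷ []
configsB K (suc L) i = concatMap (λ s → map (prepend (proj₁ s)) (configsB K L (proj₂ s))) (choices K i)

module GeneratingFunctions
  (R : CommutativeRing 0ℓ 0ℓ) (q : CommutativeRing.Carrier R) (M : ℕ)
  (q^M≈0 : CommutativeRing._≈_ R (power R q M) (CommutativeRing.0# R)) where

  open Nilpotent R q M q^M≈0

  module _ {X : Set} where

    lsum : (X → Carrier) → List X → Carrier
    lsum φ []       = 0#
    lsum φ (x ∷ xs) = φ x + lsum φ xs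

    gf : (X → ℕ) → List X → Carrier
    gf w = lsum (λ x → q ^ w x)

    lsum-++ : ∀ φ xs ys → lsum φ (xs ++ ys) ≈ lsum φ xs + lsum φ ys
    lsum-++ φ []       ys = sym (+-identityˡ _)
    lsum-++ φ (x ∷ xs) ys = trans (+-congˡ (lsum-++ φ xs ys)) (sym (+-assoc _ _ _))

    lsum-cong : ∀ {φ ψ} → (∀ x → φ x ≈ ψ x) → ∀ xs → lsum φ xs ≈ lsum ψ xs
    lsum-cong φ≈ψ []       = ≈-refl
    lsum-cong φ≈ψ (x ∷ xs) = +-cong (φ≈ψ x) (lsum-cong φ≈ψ xs)

    gf-shift : ∀ e {w w′} → (∀ x → w′ x ≡ e ℕ.+ w x) → ∀ xs → gf w′ xs ≈ q ^ e * gf w xs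
    gf-shift e         h []       = sym (zeroʳ _)
    gf-shift e {w} {w′} h (x ∷ xs) = trans (+-cong (trans (q^-cong (h x)) (sym (q^-+ e (w x) refl)))
        (gf-shift e h xs)) (sym (distribˡ _ _ _))

  module _ {X Y : Set} where

    lsum-map : ∀ (φ : Y → Carrier) (f : X → Y) xs → lsum φ (map f xs) ≈ lsum (φ ∘ f) xs
    lsum-map φ f []       = ≈-refl
    lsum-map φ f (x ∷ xs) = +-congˡ (lsum-map φ f xs)

    lsum-concatMap : ∀ (φ : Y → Carrier) (f : X → List Y) xs → lsum φ (concatMap f xs) ≈ lsum (λ x → lsum φ (f x))
        xs
    lsum-concatMap φ f []       = ≈-refl
    lsum-concatMap φ f (x ∷ xs) = trans (lsum-++ φ (f x) (concatMap f xs)) (+-congˡ (lsum-concatMap φ f xs))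

∸-unique : ∀ {f x c} → f ℕ.+ x ≡ c → c ℕ.∸ f ≡ x
∸-unique {f} {x} refl = ℕₚ.m+n∸m≡n f x

-- The recurrences between states and their solution

module BlockSeries
  (R : CommutativeRing 0ℓ 0ℓ) (q : CommutativeRing.Carrier R) (M : ℕ)
  (q^M≈0 : CommutativeRing._≈_ R (power R q M) (CommutativeRing.0# R)) (K₂ : ℕ) where

  K : ℕ
  K = suc (suc K₂)

  open Nilpotent R q M q^M≈0
  open GeneratingFunctions R q M q^M≈0
  open AndrewsSeries R q M q^M≈0 K
  open import Relation.Binary.Reasoning.Setoid setoid
  private module N = +-*-Solver

  D : ℕ → ℕ → ℕ → Carrier
  D L N i = gf (configWeight (N ℕ.* 2)) (configsB K L i)

  W : ℕ → ℕ → Carrier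
  W L N = ∏ L (λ t → 1# + q ^ (2 ℕ.* suc (N ℕ.+ t)))

  W-step : ∀ L N → W (suc L) N ≈ (1# + q ^ (2 ℕ.* suc N)) * W L (suc N)
  W-step L N = *-cong (+-congˡ (q^-cong (cong (λ t → 2 ℕ.* suc t) (ℕₚ.+-identityʳ N))))
    (∏-cong L (λ t → +-congˡ (q^-cong (cong (λ t → 2 ℕ.* suc t) (ℕₚ.+-suc N t)))))

  module Step (L N : ℕ) where

    x : ℕ → Carrier
    x f = q ^ (2 ℕ.* suc N ℕ.* f)

    y z : Carrier
    y = q ^ (2 ℕ.* N ℕ.+ 1)
    z = q ^ (2 ℕ.* suc N)

    when : Bool → Carrier → Carrier
    when b a = if b then a else 1#

    blockTerm : Block × ℕ → Carrier
    blockTerm ((g , f , h) , i) = when g y * x f * when h z * D L (suc N) i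

    x-suc : ∀ f → x (suc f) ≈ x f * z
    x-suc f = sym (q^-+ (2 ℕ.* suc N ℕ.* f) (2 ℕ.* suc N) (≡.trans (ℕₚ.+-comm _ (2 ℕ.* suc N))
        (≡.sym (ℕₚ.*-suc (2 ℕ.* suc N) f))))

    x-zero : x 0 ≈ 1#
    x-zero = q^-cong (ℕₚ.*-zeroʳ (2 ℕ.* suc N))

    D-suc : ∀ i → D (suc L) N i ≈ lsum blockTerm (choices K i)
    D-suc i = trans (lsum-concatMap _ _ (choices K i)) (lsum-cong per-block (choices K i))
      where
      bw : Block → ℕ
      bw (g , f , h) = suc (N ℕ.* 2) ℕ.* bit g ℕ.+ suc (suc (N ℕ.* 2)) ℕ.* (f ℕ.+ bit h)
      when≈ : ∀ b e → q ^ (e ℕ.* bit b) ≈ when b (q ^ e)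
      when≈ true  e = q^-cong (ℕₚ.*-identityʳ e)
      when≈ false e = q^-cong (ℕₚ.*-zeroʳ e)
      bw≈ : ∀ g f h → q ^ bw (g , f , h) ≈ when g y * x f * when h z
      bw≈ g f h = begin
        q ^ bw (g , f , h)
          ≈⟨ q^-cong (N.solve 4 (λ N g f h → (N.con 1 N.:+ N N.:* N.con 2) N.:* g N.:+ (N.con 2 N.:+ N N.:* N.con 2)
              N.:* (f N.:+ h)
               N.:= (N.con 2 N.:* N N.:+ N.con 1) N.:* g N.:+ N.con 2 N.:* (N.con 1 N.:+ N) N.:* f N.:+ N.con 2 N.:*
                   (N.con 1 N.:+ N) N.:* h) refl N (bit g) f (bit h)) ⟩
        q ^ ((2 ℕ.* N ℕ.+ 1) ℕ.* bit g ℕ.+ 2 ℕ.* suc N ℕ.* f ℕ.+ 2 ℕ.* suc N ℕ.* bit h)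
          ≈⟨ q^-+ ((2 ℕ.* N ℕ.+ 1) ℕ.* bit g ℕ.+ 2 ℕ.* suc N ℕ.* f) (2 ℕ.* suc N ℕ.* bit h) refl ⟨
        q ^ ((2 ℕ.* N ℕ.+ 1) ℕ.* bit g ℕ.+ 2 ℕ.* suc N ℕ.* f) * q ^ (2 ℕ.* suc N ℕ.* bit h)
          ≈⟨ *-cong (sym (q^-+ ((2 ℕ.* N ℕ.+ 1) ℕ.* bit g) (2 ℕ.* suc N ℕ.* f) refl)) (when≈ h (2 ℕ.* suc N)) ⟩
        q ^ ((2 ℕ.* N ℕ.+ 1) ℕ.* bit g) * x f * when h z
          ≈⟨ *-congʳ (*-congʳ (when≈ g (2 ℕ.* N ℕ.+ 1))) ⟩
        when g y * x f * when h z ∎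
      per-block : ∀ s → gf (configWeight (N ℕ.* 2)) (map (prepend (proj₁ s)) (configsB K L (proj₂ s))) ≈ blockTerm s
      per-block ((g , f , h) , i′) = trans (lsum-map _ (prepend (g , f , h)) (configsB K L i′))
        (trans (gf-shift (bw (g , f , h)) (λ c → ≡.sym (ℕₚ.+-assoc (suc (N ℕ.* 2) ℕ.* bit g) _ _))
            (configsB K L i′))
          (*-congʳ (bw≈ g f h)))

    tops-wide : ∀ c j g f → suc (suc j) ℕ.≤ c →
      lsum blockTerm (tops c j g f) ≈ when g y * x f * (D L (suc N) (c ℕ.∸ f) + z * D L (suc N) (c ℕ.∸ suc f))
    tops-wide c j g f j+2≤c rewrite dec-true (suc (suc j) ℕₚ.≤? c) j+2≤c =
      solve 4 (λ w z a b → w :* con 1ℤ :* a :+ (w :* z :* b :+ con 0ℤ) := w :* (a :+ z :* b)) ≈-refl _ _ _ _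

    tops-tight : ∀ c j g f → suc j ≡ c → lsum blockTerm (tops c j g f) ≈ when g y * x f * D L (suc N) (c ℕ.∸ f)
    tops-tight c j g f refl rewrite dec-false (suc (suc j) ℕₚ.≤? suc j) (ℕₚ.<-irrefl refl) =
      solve 2 (λ w a → w :* con 1ℤ :* a :+ con 0ℤ := w :* a) ≈-refl _ _

    options-zero : ∀ c → 2 ℕ.≤ c → ∀ {i₀ i₁} → i₀ ≡ c → suc i₁ ≡ c →
      lsum blockTerm (options c 0) ≈ D L (suc N) i₀ + z * D L (suc N) i₁
    options-zero c 2≤c {i₀} {i₁} refl refl = trans (tops-wide c 0 false 0 2≤c)
      (trans (*-congʳ (trans (*-congˡ x-zero) (*-identityˡ 1#))) (*-identityˡ _))

    -- Apart from `x j`, the result depends on `c` and `j` only through c - j. Hence the sums i - 1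
    -- with capacity K + 1 and i - 2 with capacity K give the same bracket.
    options-wide : ∀ c j → suc (suc (suc j)) ℕ.≤ c → ∀ {i₀ i₁ i₂} →
      j ℕ.+ i₀ ≡ c → suc j ℕ.+ i₁ ≡ c → suc (suc j) ℕ.+ i₂ ≡ c →
      lsum blockTerm (options c (suc j)) ≈
        x j * (z * (D L (suc N) i₁ + z * D L (suc N) i₂) + y * (D L (suc N) i₀ + z * D L (suc N) i₁))
    options-wide c j j+3≤c {i₀} {i₁} {i₂} e₀ e₁ e₂ = begin
      lsum blockTerm (tops c (suc j) false (suc j) ++ tops c (suc j) true j)
        ≈⟨ lsum-++ blockTerm (tops c (suc j) false (suc j)) _ ⟩
      _ ≈⟨ +-cong (tops-wide c (suc j) false (suc j) j+3≤c) (tops-wide c (suc j) true j j+3≤c) ⟩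
      1# * x (suc j) * (D L (suc N) (c ℕ.∸ suc j) + z * D L (suc N) (c ℕ.∸ suc (suc j)))
        + y * x j * (D L (suc N) (c ℕ.∸ j) + z * D L (suc N) (c ℕ.∸ suc j))
        ≈⟨ +-cong (*-cong (*-congˡ (x-suc j)) (+-cong (D≡ e₁) (*-congˡ (D≡ e₂))))
            (*-congˡ (+-cong (D≡ e₀) (*-congˡ (D≡ e₁)))) ⟩
      1# * (x j * z) * (D L (suc N) i₁ + z * D L (suc N) i₂) + y * x j * (D L (suc N) i₀ + z * D L (suc N) i₁)
        ≈⟨ solve 5 (λ x y z a b → con 1ℤ :* (x :* z) :* a :+ y :* x :* b := x :* (z :* a :+ y :* b)) ≈-refl _ _ _ _
            _ ⟩
      _ ∎
      where
      D≡ : ∀ {f i} → f ℕ.+ i ≡ c → D L (suc N) (c ℕ.∸ f) ≈ D L (suc N) i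
      D≡ e = reflexive (cong (D L (suc N)) (∸-unique e))

    -- With j + 1 = c an overlined 2m+2 no longer fits. This is the situation of the two largest
    -- sums in the state K + 1.
    options-tight : ∀ c j → suc (suc j) ≡ c →
      lsum blockTerm (options c (suc j)) ≈ x j * (z * D L (suc N) 1 + y * D L (suc N) 2)
    options-tight c j e = begin
      lsum blockTerm (tops c (suc j) false (suc j) ++ tops c (suc j) true j)
        ≈⟨ lsum-++ blockTerm (tops c (suc j) false (suc j)) _ ⟩
      _ ≈⟨ +-cong (tops-tight c (suc j) false (suc j) e) (tops-tight c (suc j) true j e) ⟩
      1# * x (suc j) * D L (suc N) (c ℕ.∸ suc j) + y * x j * D L (suc N) (c ℕ.∸ j)
        ≈⟨ +-cong (*-cong (*-congˡ (x-suc j)) (D≡ {suc j} {1} (≡.trans (ℕₚ.+-comm (suc j) 1) e)))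
            (*-congˡ (D≡ {j} {2} (≡.trans (ℕₚ.+-comm j 2) e))) ⟩
      1# * (x j * z) * D L (suc N) 1 + y * x j * D L (suc N) 2
        ≈⟨ solve 5 (λ x y z a b → con 1ℤ :* (x :* z) :* a :+ y :* x :* b := x :* (z :* a :+ y :* b)) ≈-refl _ _ _ _
            _ ⟩
      _ ∎
      where
      D≡ : ∀ {f i} → f ℕ.+ i ≡ c → D L (suc N) (c ℕ.∸ f) ≈ D L (suc N) i
      D≡ e = reflexive (cong (D L (suc N)) (∸-unique e))

  c₀ : Carrier
  c₀ = evenRun M 0

  -- The factor `c₀` is the (q² ; q²) carried by `J`, and `d` is K - 1 - i. The second clause gives
  -- the state K + 1 the same solution as the state K.
  Solved : ℕ → ℕ → Set
  Solved L N = (∀ i d → suc i ℕ.+ d ≡ K → c₀ * D L N (suc i) ≈ W L N * J N i d)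
             × (c₀ * D L N (suc K) ≈ W L N * J N (suc K₂) 0)

  solved-step : ∀ L N → Solved L (suc N) → Solved (suc L) N
  solved-step L N (ih , ih-top) = below , top
    where
    open Step L N
    W′ : Carrier
    W′ = W L (suc N)

    c₀-out : ∀ {a b a′ b′} → c₀ * a ≈ W′ * a′ → c₀ * b ≈ W′ * b′ → c₀ * (a + z * b) ≈ W′ * (a′ + z * b′)
    c₀-out {a} {b} {a′} {b′} ea eb = begin
      c₀ * (a + z * b)             ≈⟨ solve 4 (λ c a z b → c :* (a :+ z :* b) := c :* a :+ z :* (c :* b)) ≈-refl _ _
          _ _ ⟩
      c₀ * a + z * (c₀ * b)        ≈⟨ +-cong ea (*-congˡ eb) ⟩
      W′ * a′ + z * (W′ * b′)      ≈⟨ solve 4 (λ c a z b → c :* (a :+ z :* b) := c :* a :+ z :* (c :* b)) ≈-refl _ _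
          _ _ ⟨
      W′ * (a′ + z * b′)           ∎

    c₀-out₂ : ∀ j {A B A′ B′} → c₀ * A ≈ W′ * A′ → c₀ * B ≈ W′ * B′ →
      c₀ * (x j * (z * A + y * B)) ≈ W′ * (x j * (z * A′ + y * B′))
    c₀-out₂ j {A} {B} {A′} {B′} eA eB = begin
      c₀ * (x j * (z * A + y * B))               ≈⟨ lemma c₀ (x j) z A y B ⟩
      x j * (z * (c₀ * A) + y * (c₀ * B))        ≈⟨ *-congˡ (+-cong (*-congˡ eA) (*-congˡ eB)) ⟩
      x j * (z * (W′ * A′) + y * (W′ * B′))      ≈⟨ lemma W′ (x j) z A′ y B′ ⟨
      W′ * (x j * (z * A′ + y * B′))             ∎
      where
      lemma : ∀ c x z a y b → c * (x * (z * a + y * b)) ≈ x * (z * (c * a) + y * (c * b))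
      lemma = solve 6 (λ c x z a y b → c :* (x :* (z :* a :+ y :* b)) := x :* (z :* (c :* a) :+ y :* (c :* b)))
          ≈-refl

    below : ∀ i d → suc i ℕ.+ d ≡ K → c₀ * D (suc L) N (suc i) ≈ W (suc L) N * J N i d
    below zero d e = begin
      c₀ * D (suc L) N 1
        ≈⟨ *-congˡ (trans (D-suc 1) (options-zero (suc K) (s≤s (s≤s z≤n)) {suc K} {K} refl refl)) ⟩
      c₀ * (D L (suc N) (suc K) + z * D L (suc N) K)
        ≈⟨ c₀-out ih-top (ih (suc K₂) 0 (ℕₚ.+-identityʳ K)) ⟩
      W′ * (J (suc N) (suc K₂) 0 + z * J (suc N) (suc K₂) 0)
        -- The factor 1 + z arises because the states K + 1 and K of the next level share one
        -- solution.
        ≈⟨ solve 3 (λ w j z → w :* (j :+ z :* j) := (con 1ℤ :+ z) :* w :* j) ≈-refl _ _ _ ⟩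
      (1# + z) * W′ * J (suc N) (suc K₂) 0
        ≈⟨ *-cong (sym (W-step L N)) (trans (reflexive (cong (λ t → J (suc N) t 0) (≡.sym (ℕₚ.suc-injective e))))
            (sym (J-first N d e))) ⟩
      W (suc L) N * J N 0 d ∎
    below (suc zero) d e = begin
      c₀ * D (suc L) N 2
        ≈⟨ *-congˡ (trans (D-suc 2) (trans (lsum-++ blockTerm (options (suc K) 1) (options K 0 ++ [])) (+-cong
             (options-wide (suc K) 0 (s≤s (s≤s (s≤s z≤n))) {suc K} {K} {suc K₂} refl refl refl)
             (trans (lsum-++ blockTerm (options K 0) []) (+-identityʳ _))))) ⟩
      c₀ * (x 0 * (z * (D′ K + z * D′ (suc K₂)) + y * (D′ (suc K) + z * D′ K)) + lsum blockTerm (options K 0))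
        ≈⟨ *-congˡ (+-congˡ (options-zero K (s≤s (s≤s z≤n)) {K} {suc K₂} refl refl)) ⟩
      c₀ * (x 0 * (z * (D′ K + z * D′ (suc K₂)) + y * (D′ (suc K) + z * D′ K)) + (D′ K + z * D′ (suc K₂)))
        ≈⟨ distribˡ _ _ _ ⟩
      _ ≈⟨ +-cong (c₀-out₂ 0 (c₀-out ihK ihK₁) (c₀-out ih-top ihK)) (c₀-out ihK ihK₁) ⟩
      W′ * (x 0 * (z * (A + z * B) + y * (A + z * A))) + W′ * (A + z * B)
        -- The solver treats `x 0` as an atom so that the result has the shape of `J-rec`. The two
        -- correction terms vanish because `x 0` is 1.
        ≈⟨ solve 6 (λ w x y z A B → w :* (x :* (z :* (A :+ z :* B) :+ y :* (A :+ z :* A))) :+ w :* (A :+ z :* B)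
             := (con 1ℤ :+ z) :* w :* (A :+ (x :* z :* B :+ y :* (x :* A))) :+ (x :- con 1ℤ) :* (w :* z :* A) :+
                 (con 1ℤ :- x) :* (z :* w :* B)) ≈-refl W′ (x 0) y z A B ⟩
      (1# + z) * W′ * (A + (x 0 * z * B + y * (x 0 * A))) + (x 0 - 1#) * (W′ * z * A) + (1# - x 0) * (z * W′ * B)
        ≈⟨ +-cong (+-cong (*-cong (sym (W-step L N)) (+-cong A≈ (+-cong (*-cong (sym (x-suc 0)) B≈) ≈-refl)))
             (*-congʳ (trans (+-congʳ x-zero) (-‿inverseʳ 1#))))
                 (*-congʳ (trans (+-congˡ (-‿cong x-zero)) (-‿inverseʳ 1#))) ⟩
      W (suc L) N * (J N 0 (suc d) + (x 1 * J (suc N) d 1 + y * (x 0 * A))) + 0# * _ + 0# * _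
        ≈⟨ solve 3 (λ a b c → a :+ con 0ℤ :* b :+ con 0ℤ :* c := a) ≈-refl _ _ _ ⟩
      W (suc L) N * (J N 0 (suc d) + (x 1 * J (suc N) d 1 + y * (x 0 * A)))
        ≈⟨ *-congˡ (trans (J-rec N 0 d e) (+-congˡ
            (+-congˡ (*-congˡ (*-congˡ (reflexive (cong (λ t → J (suc N) t 0) (ℕₚ.suc-injective e)))))))) ⟨
      W (suc L) N * J N 1 d ∎
      where
      D′ : ℕ → Carrier
      D′ = D L (suc N)
      A B : Carrier
      A = J (suc N) (suc K₂) 0
      B = J (suc N) K₂ 1
      ihK : c₀ * D′ K ≈ W′ * A
      ihK = ih (suc K₂) 0 (ℕₚ.+-identityʳ K)
      ihK₁ : c₀ * D′ (suc K₂) ≈ W′ * B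
      ihK₁ = ih K₂ 1 (ℕₚ.+-comm (suc K₂) 1)
      A≈ : A ≈ J N 0 (suc d)
      A≈ = trans (reflexive (cong (λ t → J (suc N) t 0) (≡.sym (ℕₚ.suc-injective e)))) (sym (J-first N (suc d) e))
      B≈ : B ≈ J (suc N) d 1
      B≈ = reflexive (cong (λ t → J (suc N) t 1) (≡.sym (ℕₚ.suc-injective (ℕₚ.suc-injective e))))
    -- The two largest block sums share the bracket `Z`, so x (i+1) + x i = x i (1 + z) comes out.
    -- Here 1 + z extends `W`, and `Z` decomposes into two consecutive steps of `J-rec`.
    below (suc (suc i)) d e = begin
      c₀ * D (suc L) N (suc (suc (suc i)))
        ≈⟨ *-congˡ (trans (D-suc (suc (suc (suc i)))) (trans (lsum-++ blockTerm (options (suc K) (suc (suc i)))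
            (options K (suc i) ++ choices K (suc i))) (+-cong
             (options-wide (suc K) (suc i) (s≤s i+3≤K) {suc (suc (suc d))} {suc (suc d)} {suc d} (cong suc f₀)
                 (cong suc f₁) (cong suc f₂))
             (trans (lsum-++ blockTerm (options K (suc i)) (choices K (suc i)))
                 (+-cong (options-wide K i i+3≤K {suc (suc (suc d))} {suc (suc d)} {suc d} f₀ f₁ f₂)
                 (sym (D-suc (suc i)))))))) ⟩
      c₀ * (x (suc i) * Z + (x i * Z + D (suc L) N (suc i)))
        ≈⟨ trans (distribˡ _ _ _) (+-congˡ (distribˡ _ _ _)) ⟩
      c₀ * (x (suc i) * Z) + (c₀ * (x i * Z) + c₀ * D (suc L) N (suc i))
        ≈⟨ +-cong (c₀-out₂ (suc i) (c₀-out ihA ihB) (c₀-out ihC ihA))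
            (+-cong (c₀-out₂ i (c₀-out ihA ihB) (c₀-out ihC ihA))
             (trans (below i (suc (suc d)) (≡.trans (N.solve 2 (λ i d → N.con 1 N.:+ i N.:+ (N.con 2 N.:+ d) N.:=
                 N.con 3 N.:+ i N.:+ d) refl i d) e)) (*-congʳ (W-step L N)))) ⟩
      W′ * (x (suc i) * (z * (A + z * B) + y * (C′ + z * A))) + (W′ * (x i * (z * (A + z * B) + y * (C′ + z * A))) +
          (1# + z) * W′ * J₀)
        ≈⟨ +-congʳ (*-congˡ (*-congʳ (x-suc i))) ⟩
      W′ * (x i * z * (z * (A + z * B) + y * (C′ + z * A))) + (W′ * (x i * (z * (A + z * B) + y * (C′ + z * A))) +
          (1# + z) * W′ * J₀)
        ≈⟨ solve 8 (λ w x y z A B C J → w :* (x :* z :* (z :* (A :+ z :* B) :+ y :* (C :+ z :* A))) :+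
            (w :* (x :* (z :* (A :+ z :* B) :+ y :* (C :+ z :* A))) :+ (con 1ℤ :+ z) :* w :* J)
             := (con 1ℤ :+ z) :* w :* (J :+ (x :* z :* A :+ y :* (x :* C)) :+ (x :* z :* z :* B :+ y :*
                 (x :* z :* A)))) ≈-refl W′ (x i) y z A B C′ J₀ ⟩
      (1# + z) * W′ * (J₀ + (x i * z * A + y * (x i * C′)) + (x i * z * z * B + y * (x i * z * A)))
        ≈⟨ *-cong (sym (W-step L N)) (+-cong (+-congˡ (+-congʳ (*-congʳ (sym (x-suc i)))))
             (+-cong (*-congʳ (sym (trans (x-suc (suc i)) (*-congʳ (x-suc i)))))
                 (*-congˡ (*-congʳ (sym (x-suc i)))))) ⟩
      W (suc L) N * (J₀ + (x (suc i) * A + y * (x i * C′)) + (x (suc (suc i)) * B + y * (x (suc i) * A)))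
        ≈⟨ *-congˡ (trans (J-rec N (suc i) d e) (+-congʳ
            (J-rec N i (suc d) (≡.trans (ℕₚ.+-suc (suc (suc i)) d) e)))) ⟨
      W (suc L) N * J N (suc (suc i)) d ∎
      where
      D′ : ℕ → Carrier
      D′ = D L (suc N)
      A B C′ J₀ Z : Carrier
      A  = J (suc N) (suc d) (suc i)
      B  = J (suc N) d (suc (suc i))
      C′ = J (suc N) (suc (suc d)) i
      J₀ = J N i (suc (suc d))
      Z  = z * (D′ (suc (suc d)) + z * D′ (suc d)) + y * (D′ (suc (suc (suc d))) + z * D′ (suc (suc d)))
      f₀ : i ℕ.+ suc (suc (suc d)) ≡ K
      f₀ = ≡.trans (N.solve 2 (λ i d → i N.:+ (N.con 3 N.:+ d) N.:= N.con 3 N.:+ i N.:+ d) refl i d) e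
      f₁ : suc i ℕ.+ suc (suc d) ≡ K
      f₁ = ≡.trans (N.solve 2 (λ i d → N.con 1 N.:+ i N.:+ (N.con 2 N.:+ d) N.:= N.con 3 N.:+ i N.:+ d) refl i d) e
      f₂ : suc (suc i) ℕ.+ suc d ≡ K
      f₂ = ≡.trans (N.solve 2 (λ i d → N.con 2 N.:+ i N.:+ (N.con 1 N.:+ d) N.:= N.con 3 N.:+ i N.:+ d) refl i d) e
      i+3≤K : suc (suc (suc i)) ℕ.≤ K
      i+3≤K = subst (suc (suc (suc i)) ℕ.≤_) e (ℕₚ.m≤m+n _ d)
      ihA : c₀ * D′ (suc (suc d)) ≈ W′ * A
      ihA = ih (suc d) (suc i) (≡.trans (ℕₚ.+-comm (suc (suc d)) (suc i)) f₁)
      ihB : c₀ * D′ (suc d) ≈ W′ * B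
      ihB = ih d (suc (suc i)) (≡.trans (ℕₚ.+-comm (suc d) (suc (suc i))) f₂)
      ihC : c₀ * D′ (suc (suc (suc d))) ≈ W′ * C′
      ihC = ih (suc (suc d)) i (≡.trans (ℕₚ.+-comm (suc (suc (suc d))) i) f₀)

    top : c₀ * D (suc L) N (suc K) ≈ W (suc L) N * J N (suc K₂) 0
    -- Without overlined 2m+2 in the two largest sums, the bracket `Z` amounts to a single step of
    -- `J-rec`. Starting from the state K - 1, that step ends at the solution for K.
    top = begin
      c₀ * D (suc L) N (suc K)
        ≈⟨ *-congˡ (trans (D-suc (suc K)) (trans (lsum-++ blockTerm (options (suc K) K)
            (options K (suc K₂) ++ choices K (suc K₂))) (+-cong
             (options-tight (suc K) (suc K₂) refl)
             (trans (lsum-++ blockTerm (options K (suc K₂)) (choices K (suc K₂))) (+-cong (options-tight K K₂ refl)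
                 (sym (D-suc (suc K₂)))))))) ⟩
      c₀ * (x (suc K₂) * Z + (x K₂ * Z + D (suc L) N (suc K₂)))
        ≈⟨ trans (distribˡ _ _ _) (+-congˡ (distribˡ _ _ _)) ⟩
      c₀ * (x (suc K₂) * Z) + (c₀ * (x K₂ * Z) + c₀ * D (suc L) N (suc K₂))
        ≈⟨ +-cong (c₀-out₂ (suc K₂) ihA ihB) (+-cong (c₀-out₂ K₂ ihA ihB) (trans (below K₂ 1 (ℕₚ.+-comm (suc K₂) 1))
            (*-congʳ (W-step L N)))) ⟩
      W′ * (x (suc K₂) * (z * A + y * B)) + (W′ * (x K₂ * (z * A + y * B)) + (1# + z) * W′ * J₀)
        ≈⟨ +-congʳ (*-congˡ (*-congʳ (x-suc K₂))) ⟩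
      W′ * (x K₂ * z * (z * A + y * B)) + (W′ * (x K₂ * (z * A + y * B)) + (1# + z) * W′ * J₀)
        ≈⟨ solve 7 (λ w x y z A B J → w :* (x :* z :* (z :* A :+ y :* B)) :+ (w :* (x :* (z :* A :+ y :* B)) :+
            (con 1ℤ :+ z) :* w :* J)
             := (con 1ℤ :+ z) :* w :* (J :+ (x :* z :* A :+ y :* (x :* B)))) ≈-refl W′ (x K₂) y z A B J₀ ⟩
      (1# + z) * W′ * (J₀ + (x K₂ * z * A + y * (x K₂ * B)))
        ≈⟨ *-cong (sym (W-step L N)) (+-congˡ (+-congʳ (*-congʳ (sym (x-suc K₂))))) ⟩
      W (suc L) N * (J₀ + (x (suc K₂) * A + y * (x K₂ * B)))
        ≈⟨ *-congˡ (J-rec N K₂ 0 (ℕₚ.+-identityʳ K)) ⟨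
      W (suc L) N * J N (suc K₂) 0 ∎
      where
      D′ : ℕ → Carrier
      D′ = D L (suc N)
      A B J₀ Z : Carrier
      A  = J (suc N) 0 (suc K₂)
      B  = J (suc N) 1 K₂
      J₀ = J N K₂ 1
      Z  = z * D′ 1 + y * D′ 2
      ihA : c₀ * D′ 1 ≈ W′ * A
      ihA = ih 0 (suc K₂) refl
      ihB : c₀ * D′ 2 ≈ W′ * B
      ihB = ih 1 K₂ refl

  -- Downward induction on the level: at N = M only the empty configuration is left, and `J-limit`
  -- supplies the value.
  solved : ∀ L N → N ℕ.+ L ≡ M → Solved L N
  solved zero N e with ≡.trans (≡.sym (ℕₚ.+-identityʳ N)) e
  ... | refl = (λ i d h → base i d h) , base (suc K₂) 0 (ℕₚ.+-identityʳ K)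
    where
    base : ∀ i d → suc i ℕ.+ d ≡ K → c₀ * (1# + 0#) ≈ 1# * J M i d
    base i d h = trans (trans (*-congˡ (+-identityʳ 1#)) (*-identityʳ c₀)) (trans (sym (J-limit i d h))
        (sym (*-identityˡ _)))
  solved (suc L) N e = solved-step L N (solved L (suc N) (≡.trans (≡.sym (ℕₚ.+-suc N L)) e))

-- The generating function of A

module Congruence where
  open import Data.Integer.Base using (+_)
  open ℤ-Solver.+-*-Solver using (solve; _:+_; _:-_; :-_; _:=_; _:*_)

  mod? : ∀ d x s → Dec ((+ s) ≡ x [mod d ])
  mod? d x s = d ℕ∣.∣? ℤ.∣ + s ℤ.- x ∣

  mod-sym : ∀ {d} a b → a ≡ b [mod d ] → b ≡ a [mod d ]
  mod-sym {d} a b = subst (d ℕ∣.∣_) (ℤₚ.∣i-j∣≡∣j-i∣ a b)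

  mod-trans : ∀ {d} a b c → a ≡ b [mod d ] → b ≡ c [mod d ] → a ≡ c [mod d ]
  mod-trans {d} a b c a≡b b≡c = subst (λ x → d ℕ∣.∣ ℤ.∣ x ∣)
    (solve 3 (λ a b c → (a :- b) :+ (b :- c) := a :- c) refl a b c)
    (ℤ∣.∣⇒∣ᵤ {+ d} (ℤ∣.∣m∣n⇒∣m+n (ℤ∣.∣ᵤ⇒∣ {+ d} {a ℤ.- b} a≡b) (ℤ∣.∣ᵤ⇒∣ {+ d} {b ℤ.- c} b≡c)))

  mod-shift : ∀ d s → (+ (d ℕ.+ s)) ≡ (+ s) [mod d ]
  mod-shift d s = subst (λ x → d ℕ∣.∣ ℤ.∣ x ∣) (solve 2 (λ d s → d := (d :+ s) :- s) refl (+ d) (+ s)) ℕ∣.∣-refl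

  mod-neg : ∀ {d} α β → α ℕ.+ β ≡ d → (ℤ.- + α) ≡ (+ β) [mod d ]
  mod-neg α β refl = subst (λ x → α ℕ.+ β ℕ∣.∣ x)
      (≡.sym (≡.trans (cong ℤ.∣_∣ (solve 2 (λ a b → :- a :- b := :- (a :+ b)) refl (+ α) (+ β)))
      (ℤₚ.∣-i∣≡∣i∣ (+ (α ℕ.+ β))))) ℕ∣.∣-refl

  mod-coarsen : ∀ {d d′} a b → d′ ℕ∣.∣ d → a ≡ b [mod d ] → a ≡ b [mod d′ ]
  mod-coarsen a b = ℕ∣.∣-trans

  -- Residues are represented by 1, ..., d and not by 0, ..., d - 1, because sizes of parts start at
  -- 1.
  mod-unique : ∀ {d s t} → 1 ℕ.≤ s → s ℕ.≤ d → 1 ℕ.≤ t → t ℕ.≤ d → (+ s) ≡ (+ t) [mod d ] → s ≡ t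
  mod-unique {d} {s} {t} 1≤s s≤d 1≤t t≤d d∣ = by-order (ℕₚ.≤-total s t)
    where
    ordered : ∀ {s t} → s ℕ.≤ t → 1 ℕ.≤ s → t ℕ.≤ d → (+ s) ≡ (+ t) [mod d ] → s ≡ t
    ordered {s} {t} s≤t 1≤s t≤d d∣ = ℕₚ.≤-antisym s≤t (ℕₚ.m∸n≡0⇒m≤n (small _ refl))
      where
      d∣t∸s : d ℕ∣.∣ t ℕ.∸ s
      d∣t∸s = subst (d ℕ∣.∣_) (≡.trans (cong ℤ.∣_∣ (ℤₚ.m-n≡m⊖n s t)) (ℤₚ.∣⊖∣-≤ s≤t)) d∣
      small : ∀ x → t ℕ.∸ s ≡ x → t ℕ.∸ s ≡ 0
      small zero    eq = eq
      small (suc x) eq = ⊥-elim (ℕₚ.<⇒≱ (ℕₚ.∸-monoʳ-< {t} {s} {0} 1≤s s≤t)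
        (ℕₚ.≤-trans t≤d (subst (d ℕ.≤_) (≡.sym eq) (ℕ∣.∣⇒≤ (subst (d ℕ∣.∣_) eq d∣t∸s)))))
    by-order : s ℕ.≤ t ⊎ t ℕ.≤ s → s ≡ t
    by-order (inj₁ s≤t) = ordered s≤t 1≤s t≤d d∣
    by-order (inj₂ t≤s) = ≡.sym (ordered t≤s 1≤t s≤d (mod-sym (+ s) (+ t) d∣))

  does-iff : ∀ {A B : Set} (a? : Dec A) (b? : Dec B) → (A → B) → (B → A) → does a? ≡ does b?
  does-iff (yes a) b? f g = ≡.sym (dec-true b? (f a))
  does-iff (no ¬a) b? f g = ≡.sym (dec-false b? (¬a ∘ g))

  mod?-periodic : ∀ d x s → does (mod? d x (d ℕ.+ s)) ≡ does (mod? d x s)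
  mod?-periodic d x s = does-iff (mod? d x (d ℕ.+ s)) (mod? d x s)
    (mod-trans (+ s) (+ (d ℕ.+ s)) x (mod-sym (+ (d ℕ.+ s)) (+ s) (mod-shift d s)))
    (mod-trans (+ (d ℕ.+ s)) (+ s) x (mod-shift d s))

  mod?-representative : ∀ d x ρ → 1 ℕ.≤ ρ → ρ ℕ.≤ d → x ≡ (+ ρ) [mod d ] →
    ∀ s → 1 ℕ.≤ s → s ℕ.≤ d → does (mod? d x s) ≡ does (s ℕₚ.≟ ρ)
  mod?-representative d x ρ 1≤ρ ρ≤d x≡ρ s 1≤s s≤d = does-iff (mod? d x s) (s ℕₚ.≟ ρ)
    (λ s≡x → mod-unique 1≤s s≤d 1≤ρ ρ≤d (mod-trans (+ s) x (+ ρ) s≡x x≡ρ))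
    (λ { refl → mod-sym x (+ ρ) x≡ρ })

open Congruence

-- The sizes of non-overlined parts that A-part permits, for the modulus D = 4k - 4
-- and α = 2r - 1.
allowed : ℕ → ℕ → ℕ → Bool
allowed D α s = not (does (mod? 4 (ℤ.+ 2) s) ∨ does (mod? D (ℤ.+ 0) s) ∨ does (mod? D (ℤ.+ α) s) ∨ does
    (mod? D (ℤ.- ℤ.+ α) s))

-- With B = M the multiplicities below B give a cut geometric series which is already the exact
-- inverse of 1 - q ^ s.
multiplicities : (ℕ → Bool) → ℕ → ℕ → List ℕ
multiplicities ok B s = if ok s then upTo B else 0 ∷ []

overlinings : ℕ → List Bool
overlinings s = if does (mod? 2 (ℤ.+ 0) s) then false ∷ true ∷ [] else false ∷ []

configsA : (ℕ → Bool) → ℕ → ℕ → ℕ → List Config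
configsA ok B m zero    = [] ∷ []
configsA ok B m (suc L) = cartesianProductWith _∷_
  (cartesianProduct (multiplicities ok B (suc m)) (overlinings (suc m))) (configsA ok B (suc m) L)

-- Products over residue classes

module ResidueProducts
  (R : CommutativeRing 0ℓ 0ℓ) (q : CommutativeRing.Carrier R) (M : ℕ)
  (q^M≈0 : CommutativeRing._≈_ R (power R q M) (CommutativeRing.0# R)) where
  open import Data.Integer.Base using (+_)

  open Nilpotent R q M q^M≈0
  open GeneratingFunctions R q M q^M≈0
  open import Relation.Binary.Reasoning.Setoid setoid

  when : Bool → Carrier → Carrier
  when b a = if b then a else 1#

  when-cong : ∀ {b b′ a a′} → b ≡ b′ → a ≈ a′ → when b a ≈ when b′ a′
  when-cong {true}  refl a≈a′ = a≈a′
  when-cong {false} refl _    = ≈-refl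

  ∏-single : ∀ n t (g : ℕ → Carrier) → t ℕ.< n → (∀ s → s ≢ t → g s ≈ 1#) → ∏ n g ≈ g t
  ∏-single (suc n) zero    g _         g≈1 = trans (*-congˡ (∏-one n (λ s → g≈1 (suc s) (λ ())))) (*-identityʳ _)
  ∏-single (suc n) (suc t) g (s≤s t<n) g≈1 = trans (*-cong (g≈1 0 (λ ()))
    (∏-single n t (g ∘ suc) t<n (λ s s≢t → g≈1 (suc s) (s≢t ∘ ℕₚ.suc-injective)))) (*-identityˡ _)

  -- Among any d consecutive factors exactly one has its index in the class, so the product is taken
  -- period by period.
  ∏-residue : ∀ d ρ (h : ℕ → Bool) → suc ρ ℕ.≤ d → (∀ s → h (d ℕ.+ s) ≡ h s) →
    (∀ s → 1 ℕ.≤ s → s ℕ.≤ d → h s ≡ does (s ℕₚ.≟ suc ρ)) → ∀ T (F : ℕ → Carrier) →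
    ∏ (d ℕ.* T) (λ t → when (h (suc t)) (F (suc t))) ≈ ∏ T (λ t → F (d ℕ.* t ℕ.+ suc ρ))
  ∏-residue d ρ h ρ<d per rep zero    F =
    reflexive (cong (λ n → ∏ n (λ t → when (h (suc t)) (F (suc t)))) (ℕₚ.*-zeroʳ d))
  ∏-residue d ρ h ρ<d per rep (suc T) F = begin
    ∏ (d ℕ.* suc T) G
      ≡⟨ cong (λ n → ∏ n G) (ℕₚ.*-suc d T) ⟩
    ∏ (d ℕ.+ d ℕ.* T) G
      ≈⟨ ∏-split d (d ℕ.* T) G ⟩
    ∏ d G * ∏ (d ℕ.* T) (λ t → G (d ℕ.+ t))
      ≈⟨ *-cong block (∏-cong (d ℕ.* T) (λ t → when-cong (≡.trans (cong h (≡.sym (ℕₚ.+-suc d t))) (per (suc t)))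
          (reflexive (cong F (≡.sym (ℕₚ.+-suc d t)))))) ⟩
    F (suc ρ) * ∏ (d ℕ.* T) (λ t → when (h (suc t)) (F (d ℕ.+ suc t)))
      ≈⟨ *-cong (reflexive (cong (λ x → F (x ℕ.+ suc ρ)) (≡.sym (ℕₚ.*-zeroʳ d)))) (∏-residue d ρ h ρ<d per rep T
          (λ s → F (d ℕ.+ s))) ⟩
    F (d ℕ.* 0 ℕ.+ suc ρ) * ∏ T (λ t → F (d ℕ.+ (d ℕ.* t ℕ.+ suc ρ)))
      ≈⟨ *-congˡ (∏-cong T (λ t → reflexive (cong F (≡.trans (≡.sym (ℕₚ.+-assoc d (d ℕ.* t) (suc ρ)))
          (cong (ℕ._+ suc ρ) (≡.sym (ℕₚ.*-suc d t))))))) ⟩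
    ∏ (suc T) (λ t → F (d ℕ.* t ℕ.+ suc ρ)) ∎
    where
    G G′ : ℕ → Carrier
    G t  = when (h (suc t)) (F (suc t))
    G′ t = when (does (suc t ℕₚ.≟ suc ρ)) (F (suc t))
    block : ∏ d G ≈ F (suc ρ)
    block = begin
      ∏ d G       ≈⟨ ∏-congᵇ d (λ t t<d → when-cong (rep (suc t) (s≤s z≤n) t<d) ≈-refl) ⟩
      ∏ d G′      ≈⟨ ∏-single d ρ G′ ρ<d (λ s s≢ρ → when-cong (dec-false (suc s ℕₚ.≟ suc ρ)
          (s≢ρ ∘ ℕₚ.suc-injective)) ≈-refl) ⟩
      G′ ρ        ≈⟨ when-cong (dec-true (suc ρ ℕₚ.≟ suc ρ) refl) ≈-refl ⟩
      F (suc ρ)   ∎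

  ∏-mod : ∀ d x ρ → suc ρ ℕ.≤ d → x ≡ (+ suc ρ) [mod d ] → ∀ T (F : ℕ → Carrier) →
    ∏ (d ℕ.* T) (λ t → when (does (mod? d x (suc t))) (F (suc t))) ≈ ∏ T (λ t → F (d ℕ.* t ℕ.+ suc ρ))
  ∏-mod d x ρ ρ<d x≡ρ = ∏-residue d ρ (does ∘ mod? d x) ρ<d (mod?-periodic d x) (mod?-representative d x (suc ρ)
      (s≤s z≤n) ρ<d x≡ρ)

  gf-product : ∀ {X Y Z : Set} (f : X → Y → Z) w w₁ w₂ → (∀ x y → w (f x y) ≡ w₁ x ℕ.+ w₂ y) →
    ∀ xs ys → gf w (cartesianProductWith f xs ys) ≈ gf w₁ xs * gf w₂ ys
  gf-product f w w₁ w₂ h []       ys = sym (zeroˡ _)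
  gf-product f w w₁ w₂ h (x ∷ xs) ys = begin
    gf w (map (f x) ys ++ cartesianProductWith f xs ys)
      ≈⟨ lsum-++ _ (map (f x) ys) _ ⟩
    gf w (map (f x) ys) + gf w (cartesianProductWith f xs ys)
      ≈⟨ +-cong (trans (lsum-map _ (f x) ys) (gf-shift (w₁ x) (h x) ys)) (gf-product f w w₁ w₂ h xs ys) ⟩
    q ^ w₁ x * gf w₂ ys + gf w₁ xs * gf w₂ ys
      ≈⟨ distribʳ _ _ _ ⟨
    gf w₁ (x ∷ xs) * gf w₂ ys ∎

  lsum-applyUpTo : ∀ {X : Set} (φ : X → Carrier) (f : ℕ → X) n → lsum φ (applyUpTo f n) ≈ ∑ n (φ ∘ f)
  lsum-applyUpTo φ f zero    = ≈-refl
  lsum-applyUpTo φ f (suc n) = +-congˡ (lsum-applyUpTo φ (f ∘ suc) n)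

  bar : ℕ → Carrier
  bar s = when (does (mod? 2 (+ 0) s)) (1# + q ^ s)

  module _ (ok : ℕ → Bool) where

    plain : ℕ → Carrier
    plain s = gf (s ℕ.*_) (multiplicities ok M s)

    gf-configsA : ∀ L m → gf (configWeight m) (configsA ok M m L) ≈ ∏ L (λ t → plain (suc (m ℕ.+ t)) * bar
        (suc (m ℕ.+ t)))
    gf-configsA zero    m = +-identityʳ 1#
    gf-configsA (suc L) m = begin
      gf (configWeight m) (configsA ok M m (suc L))
        ≈⟨ gf-product _∷_ (configWeight m) (λ e → suc m ℕ.* (proj₁ e ℕ.+ bit (proj₂ e))) (configWeight (suc m))
            (λ _ _ → refl) (cartesianProduct (multiplicities ok M (suc m)) (overlinings (suc m)))
            (configsA ok M (suc m) L) ⟩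
      gf (λ e → suc m ℕ.* (proj₁ e ℕ.+ bit (proj₂ e))) (cartesianProduct (multiplicities ok M (suc m))
          (overlinings (suc m))) * gf (configWeight (suc m)) (configsA ok M (suc m) L)
        ≈⟨ *-cong (trans (gf-product _,_ (λ e → suc m ℕ.* (proj₁ e ℕ.+ bit (proj₂ e))) (suc m ℕ.*_)
            (λ g → suc m ℕ.* bit g) (λ f g → ℕₚ.*-distribˡ-+ (suc m) f (bit g)) (multiplicities ok M (suc m))
            (overlinings (suc m)))
                         (*-congˡ (gf-overlinings (suc m)))) (gf-configsA L (suc m)) ⟩
      plain (suc m) * bar (suc m) * ∏ L (λ t → plain (suc (suc m ℕ.+ t)) * bar (suc (suc m ℕ.+ t)))
        ≈⟨ *-cong (reflexive (cong (λ s → plain (suc s) * bar (suc s)) (≡.sym (ℕₚ.+-identityʳ m))))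
                  (∏-cong L (λ t → reflexive (cong (λ s → plain (suc s) * bar (suc s)) (≡.sym (ℕₚ.+-suc m t))))) ⟩
      ∏ (suc L) (λ t → plain (suc (m ℕ.+ t)) * bar (suc (m ℕ.+ t))) ∎
      where
      gf-overlinings : ∀ s → gf (λ g → s ℕ.* bit g) (overlinings s) ≈ bar s
      gf-overlinings s with does (mod? 2 (+ 0) s)
      ... | true  = +-cong (q^-cong (ℕₚ.*-zeroʳ s)) (trans (+-identityʳ _) (q^-cong (ℕₚ.*-identityʳ s)))
      ... | false = trans (+-identityʳ _) (q^-cong (ℕₚ.*-zeroʳ s))

    plain-inverse : ∀ s → (1# - q ^ suc s) * plain (suc s) ≈ when (not (ok (suc s))) (1# - q ^ suc s)
    plain-inverse s with ok (suc s)
    ... | true  = trans (*-congˡ (lsum-applyUpTo _ (λ t → t) M)) (geometric-inverse s M ℕₚ.≤-refl)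
    ... | false = trans (*-congˡ (trans (+-identityʳ _) (q^-cong (ℕₚ.*-zeroʳ (suc s))))) (*-identityʳ _)

    -- An allowed size contributes the inverse of its factor 1 - q ^ s and a forbidden size
    -- contributes 1. After clearing, exactly the forbidden sizes keep their factor.
    product-configsA : ∀ L → ∏ L (λ t → 1# - q ^ suc t) * gf (configWeight 0) (configsA ok M 0 L)
      ≈ ∏ L (λ t → when (not (ok (suc t))) (1# - q ^ suc t)) * ∏ L (λ t → bar (suc t))
    product-configsA L = begin
      ∏ L e * gf (configWeight 0) (configsA ok M 0 L)     ≈⟨ *-congˡ (trans (gf-configsA L 0) (∏-* L _ _)) ⟩
      ∏ L e * (∏ L (plain ∘ suc) * ∏ L (bar ∘ suc))       ≈⟨ *-assoc _ _ _ ⟨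
      ∏ L e * ∏ L (plain ∘ suc) * ∏ L (bar ∘ suc)         ≈⟨ *-congʳ (trans (sym (∏-* L e (plain ∘ suc)))
          (∏-cong L plain-inverse)) ⟩
      _ ∎
      where
      e : ℕ → Carrier
      e t = 1# - q ^ suc t


does-true : ∀ {A : Set} (a? : Dec A) → does a? ≡ true → A
does-true (yes a) _ = a

-- The four forbidden classes are pairwise disjoint: parity separates ±α from the even classes, the
-- residue modulo 4 separates 2 from 0, and α from -α because 2α ≡ 2 modulo 4.
module Exclusion (K e s : ℕ) where
  open import Data.Integer.Base using (+_)

  α : ℕ
  α = suc (2 ℕ.* e)

  even≢odd : ∀ x → x ≡ (+ 0) [mod 2 ] → x ≡ (+ α) [mod 2 ] → ⊥
  even≢odd x x≡0 x≡α = toWitnessFalse {a? = 2 ℕ∣.∣? 1} _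
      (ℕ∣.∣m+n∣m⇒∣n {n = 1} (subst (2 ℕ∣.∣_) (ℕₚ.+-comm 1 (2 ℕ.* e)) 2∣α) (ℕ∣.m∣m*n e))
    where
    2∣α : 2 ℕ∣.∣ α
    2∣α = mod-trans (+ 0) x (+ α) (mod-sym x (+ 0) x≡0) x≡α

  2∣4 : 2 ℕ∣.∣ 4
  2∣4 = ℕ∣.divides 2 refl

  4∣4K : 4 ℕ∣.∣ 4 ℕ.* K
  4∣4K = ℕ∣.m∣m*n K

  2∣4K : 2 ℕ∣.∣ 4 ℕ.* K
  2∣4K = ℕ∣.∣-trans 2∣4 4∣4K

  neg-odd : (ℤ.- + α) ≡ (+ α) [mod 2 ]
  neg-odd = mod-trans (ℤ.- + α) (+ 1) (+ α)
    (subst (2 ℕ∣.∣_) (≡.sym (≡.trans (cong ℤ.∣_∣ (S.solve 1 (λ a → S.:- a S.:- S.con 1ℤ S.:= S.:- (a S.:+ S.con 1ℤ))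
        refl (+ α))) (ℤₚ.∣-i∣≡∣i∣ (+ α ℤ.+ 1ℤ))))
      (ℕ∣.divides (suc e) (N.solve 1 (λ e → N.con 1 N.:+ N.con 2 N.:* e N.:+ N.con 1 N.:= (N.con 1 N.:+ e) N.:*
          N.con 2) refl e)))
    (mod-sym (+ α) (+ 1) (subst (2 ℕ∣.∣_) (≡.sym (≡.trans (cong ℤ.∣_∣ (ℤₚ.m-n≡m⊖n α 1))
        (cong ℤ.∣_∣ (ℤₚ.⊖-≥ {α} {1} (s≤s z≤n))))) (ℕ∣.m∣m*n e)))
    where
    module S = ℤ-Solver.+-*-Solver
    module N = +-*-Solver

  2≢0 : (+ s) ≡ (+ 2) [mod 4 ] → (+ s) ≡ (+ 0) [mod 4 ℕ.* K ] → ⊥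
  2≢0 s≡2 s≡0 = toWitnessFalse {a? = 4 ℕ∣.∣? 2} _
    (mod-trans (+ 0) (+ s) (+ 2) (mod-sym (+ s) (+ 0) (mod-coarsen (+ s) (+ 0) 4∣4K s≡0)) s≡2)

  2-even : (+ s) ≡ (+ 2) [mod 4 ] → (+ s) ≡ (+ 0) [mod 2 ]
  2-even s≡2 = mod-trans (+ s) (+ 2) (+ 0) (mod-coarsen (+ s) (+ 2) 2∣4 s≡2) ℕ∣.∣-refl

  α≢-α : (+ s) ≡ (+ α) [mod 4 ℕ.* K ] → (+ s) ≡ (ℤ.- + α) [mod 4 ℕ.* K ] → ⊥
  α≢-α s≡α s≡-α = toWitnessFalse {a? = 4 ℕ∣.∣? 2} _ (ℕ∣.∣m+n∣m⇒∣n {n = 2} (subst (4 ℕ∣.∣_) 2α 4∣2α) (ℕ∣.m∣m*n e))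
    where
    module N = +-*-Solver
    4∣2α : 4 ℕ∣.∣ ℤ.∣ + α ℤ.- (ℤ.- + α) ∣
    4∣2α = mod-trans (+ α) (+ s) (ℤ.- + α) (mod-sym (+ s) (+ α) (mod-coarsen (+ s) (+ α) 4∣4K s≡α))
        (mod-coarsen (+ s) (ℤ.- + α) 4∣4K s≡-α)
    2α : ℤ.∣ + α ℤ.- (ℤ.- + α) ∣ ≡ 4 ℕ.* e ℕ.+ 2
    2α = N.solve 1 (λ e → N.con 1 N.:+ N.con 2 N.:* e N.:+ (N.con 1 N.:+ N.con 2 N.:* e) N.:= N.con 4 N.:* e N.:+
        N.con 2) refl e

-- The infinite products for A and B

module Comparison
  (R : CommutativeRing 0ℓ 0ℓ) (q : CommutativeRing.Carrier R) (M : ℕ)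
  (q^M≈0 : CommutativeRing._≈_ R (power R q M) (CommutativeRing.0# R)) (K₂ : ℕ) where
  open import Data.Integer.Base using (+_)

  open Nilpotent R q M q^M≈0
  open GeneratingFunctions R q M q^M≈0
  open ResidueProducts R q M q^M≈0
  open BlockSeries R q M q^M≈0 K₂
  open AndrewsSeries R q M q^M≈0 K
  open import Relation.Binary.Reasoning.Setoid setoid
  private module N = +-*-Solver

  -- A multiple of 2, 4 and 4K, so that each residue class is covered in whole periods, with at
  -- least M periods for each of them.
  Len : ℕ
  Len = 4 ℕ.* K ℕ.* M

  ∏-pairs : ∀ T (f : ℕ → Carrier) → ∏ (T ℕ.* 2) f ≈ ∏ T (λ t → f (t ℕ.* 2) * f (suc (t ℕ.* 2)))
  ∏-pairs zero    f = ≈-refl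
  ∏-pairs (suc T) f = trans (sym (*-assoc _ _ _)) (*-congˡ (∏-pairs T (f ∘ suc ∘ suc)))

  -- At most one of the four conditions holds, so at most one factor on the right differs from 1.
  when-∨ : ∀ b₁ b₂ b₃ b₄ x → (b₁ ≡ true → b₂ ≡ true → ⊥) → (b₁ ≡ true → b₃ ≡ true → ⊥) → (b₁ ≡ true → b₄ ≡ true → ⊥)
      →
    (b₂ ≡ true → b₃ ≡ true → ⊥) → (b₂ ≡ true → b₄ ≡ true → ⊥) → (b₃ ≡ true → b₄ ≡ true → ⊥) →
    when (not (not (b₁ ∨ b₂ ∨ b₃ ∨ b₄))) x ≈ when b₁ x * (when b₂ x * when b₃ x * when b₄ x)
  when-∨ true  true  _     _     x h₁₂ h₁₃ h₁₄ h₂₃ h₂₄ h₃₄ = ⊥-elim (h₁₂ refl refl)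
  when-∨ true  false true  _     x h₁₂ h₁₃ h₁₄ h₂₃ h₂₄ h₃₄ = ⊥-elim (h₁₃ refl refl)
  when-∨ true  false false true  x h₁₂ h₁₃ h₁₄ h₂₃ h₂₄ h₃₄ = ⊥-elim (h₁₄ refl refl)
  when-∨ true  false false false x h₁₂ h₁₃ h₁₄ h₂₃ h₂₄ h₃₄ = solve 1 (λ x → x := x :* (con 1ℤ :* con 1ℤ :* con 1ℤ))
      ≈-refl x
  when-∨ false true  true  _     x h₁₂ h₁₃ h₁₄ h₂₃ h₂₄ h₃₄ = ⊥-elim (h₂₃ refl refl)
  when-∨ false true  false true  x h₁₂ h₁₃ h₁₄ h₂₃ h₂₄ h₃₄ = ⊥-elim (h₂₄ refl refl)
  when-∨ false true  false false x h₁₂ h₁₃ h₁₄ h₂₃ h₂₄ h₃₄ = solve 1 (λ x → x := con 1ℤ :* (x :* con 1ℤ :* con 1ℤ))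
      ≈-refl x
  when-∨ false false true  true  x h₁₂ h₁₃ h₁₄ h₂₃ h₂₄ h₃₄ = ⊥-elim (h₃₄ refl refl)
  when-∨ false false true  false x h₁₂ h₁₃ h₁₄ h₂₃ h₂₄ h₃₄ = solve 1 (λ x → x := con 1ℤ :* (con 1ℤ :* x :* con 1ℤ))
      ≈-refl x
  when-∨ false false false true  x h₁₂ h₁₃ h₁₄ h₂₃ h₂₄ h₃₄ = solve 1 (λ x → x := con 1ℤ :* (con 1ℤ :* con 1ℤ :* x))
      ≈-refl x
  when-∨ false false false false x h₁₂ h₁₃ h₁₄ h₂₃ h₂₄ h₃₄ = solve 0
      (con 1ℤ := con 1ℤ :* (con 1ℤ :* con 1ℤ :* con 1ℤ)) ≈-refl

  X₂ X₀ : Carrier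
  X₂ = ∏ M (λ t → 1# - q ^ (4 ℕ.* t ℕ.+ 2))
  X₀ = ∏ M (λ t → 1# - q ^ (4 ℕ.* K ℕ.* suc t))

  X : ℕ → Carrier
  X ρ = ∏ M (λ t → 1# - q ^ (4 ℕ.* K ℕ.* t ℕ.+ ρ))

  M≤a*M : ∀ a → M ℕ.≤ suc a ℕ.* M
  M≤a*M a = ℕₚ.m≤n*m M (suc a)

  excluded : ∀ e b → suc (2 ℕ.* e) ℕ.+ suc b ≡ 4 ℕ.* K →
    ∏ Len (λ t → when (not (allowed (4 ℕ.* K) (suc (2 ℕ.* e)) (suc t))) (1# - q ^ suc t)) ≈ X₂ *
        (X₀ * X (suc (2 ℕ.* e)) * X (suc b))
  excluded e b αβ = begin
    ∏ Len (λ t → when (not (allowed (4 ℕ.* K) α (suc t))) (F (suc t)))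
      ≈⟨ ∏-cong Len (λ t → factor (suc t)) ⟩
    ∏ Len (λ t → h₁ t * (h₂ t * h₃ t * h₄ t))
      ≈⟨ trans (∏-* Len _ _) (*-congˡ (trans (∏-* Len _ _) (*-congʳ (∏-* Len _ _)))) ⟩
    ∏ Len h₁ * (∏ Len h₂ * ∏ Len h₃ * ∏ Len h₄)
      ≈⟨ *-cong p₂ (*-cong (*-cong p₀ p₃) p₄) ⟩
    X₂ * (X₀ * X α * X (suc b)) ∎
    where
    α : ℕ
    α = suc (2 ℕ.* e)
    F h₁ h₂ h₃ h₄ : ℕ → Carrier
    F s = 1# - q ^ s
    h₁ t = when (does (mod? 4 (+ 2) (suc t))) (F (suc t))
    h₂ t = when (does (mod? (4 ℕ.* K) (+ 0) (suc t))) (F (suc t))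
    h₃ t = when (does (mod? (4 ℕ.* K) (+ α) (suc t))) (F (suc t))
    h₄ t = when (does (mod? (4 ℕ.* K) (ℤ.- + α) (suc t))) (F (suc t))

    factor : ∀ s → when (not (allowed (4 ℕ.* K) α s)) (F s) ≈
      when (does (mod? 4 (+ 2) s)) (F s) * (when (does (mod? (4 ℕ.* K) (+ 0) s)) (F s) * when
          (does (mod? (4 ℕ.* K) (+ α) s)) (F s) * when (does (mod? (4 ℕ.* K) (ℤ.- + α) s)) (F s))
    factor s = when-∨ _ _ _ _ (F s)
      (λ t₁ t₂ → 2≢0 (w₁ t₁) (w₂ t₂))
      (λ t₁ t₃ → even≢odd (+ s) (2-even (w₁ t₁)) (mod-coarsen (+ s) (+ α) 2∣4K (w₃ t₃)))
      (λ t₁ t₄ → even≢odd (+ s) (2-even (w₁ t₁)) (odd₄ t₄))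
      (λ t₂ t₃ → even≢odd (+ s) (mod-coarsen (+ s) (+ 0) 2∣4K (w₂ t₂)) (mod-coarsen (+ s) (+ α) 2∣4K (w₃ t₃)))
      (λ t₂ t₄ → even≢odd (+ s) (mod-coarsen (+ s) (+ 0) 2∣4K (w₂ t₂)) (odd₄ t₄))
      (λ t₃ t₄ → α≢-α (w₃ t₃) (w₄ t₄))
      where
      open Exclusion K e s hiding (α)
      w₁ = does-true (mod? 4 (+ 2) s)
      w₂ = does-true (mod? (4 ℕ.* K) (+ 0) s)
      w₃ = does-true (mod? (4 ℕ.* K) (+ α) s)
      w₄ = does-true (mod? (4 ℕ.* K) (ℤ.- + α) s)
      odd₄ : does (mod? (4 ℕ.* K) (ℤ.- + α) s) ≡ true → (+ s) ≡ (+ α) [mod 2 ]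
      odd₄ t₄ = mod-trans (+ s) (ℤ.- + α) (+ α) (mod-coarsen (+ s) (ℤ.- + α) 2∣4K (w₄ t₄)) neg-odd

    p₂ : ∏ Len h₁ ≈ X₂
    p₂ = begin
      ∏ Len h₁                                            ≡⟨ cong (λ n → ∏ n h₁) (ℕₚ.*-assoc 4 K M) ⟩
      ∏ (4 ℕ.* (K ℕ.* M)) h₁                              ≈⟨ ∏-mod 4 (+ 2) 1 (s≤s (s≤s z≤n)) (ℕ∣.divides 0 refl)
          (K ℕ.* M) F ⟩
      ∏ (K ℕ.* M) (λ t → 1# - q ^ (4 ℕ.* t ℕ.+ 2))
          ≈⟨ ∏-stable (λ t M≤t → 1-q^-one (ℕₚ.≤-trans M≤t (ℕₚ.≤-trans (ℕₚ.m≤n*m t 4) (ℕₚ.m≤m+n (4 ℕ.* t) 2))))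
          (M≤a*M (suc K₂)) ⟩
      X₂                                                  ∎

    0≡4K : (+ 0) ≡ (+ (4 ℕ.* K)) [mod 4 ℕ.* K ]
    0≡4K = mod-sym (+ (4 ℕ.* K)) (+ 0) (subst (λ x → 4 ℕ.* K ℕ∣.∣ x) (≡.sym (ℕₚ.+-identityʳ (4 ℕ.* K))) ℕ∣.∣-refl)

    p₀ : ∏ Len h₂ ≈ X₀
    p₀ = trans (∏-mod (4 ℕ.* K) (+ 0) _ ℕₚ.≤-refl 0≡4K M F)
      (∏-cong M (λ t → +-congˡ (-‿cong (q^-cong (≡.trans (ℕₚ.+-comm (4 ℕ.* K ℕ.* t) (4 ℕ.* K))
          (≡.sym (ℕₚ.*-suc (4 ℕ.* K) t)))))))

    p₃ : ∏ Len h₃ ≈ X α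
    p₃ = ∏-mod (4 ℕ.* K) (+ α) (2 ℕ.* e) (subst (α ℕ.≤_) αβ (ℕₚ.m≤m+n α (suc b)))
      (subst (4 ℕ.* K ℕ∣.∣_) (cong ℤ.∣_∣ (≡.sym (ℤₚ.i≡j⇒i-j≡0 {+ α} refl))) (ℕ∣._∣0 (4 ℕ.* K))) M F

    p₄ : ∏ Len h₄ ≈ X (suc b)
    p₄ = ∏-mod (4 ℕ.* K) (ℤ.- + α) b (subst (suc b ℕ.≤_) αβ (ℕₚ.m≤n+m (suc b) α)) (mod-neg α (suc b) αβ) M F

  bars : ∏ Len (λ t → bar (suc t)) ≈ W M 0
  bars = begin
    ∏ Len (bar ∘ suc)
      ≡⟨ cong (λ n → ∏ n (bar ∘ suc)) (N.solve 2 (λ K M → N.con 4 N.:* K N.:* M N.:= N.con 2 N.:*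
          (N.con 2 N.:* K N.:* M)) refl K M) ⟩
    ∏ (2 ℕ.* (2 ℕ.* K ℕ.* M)) (bar ∘ suc)
      ≈⟨ ∏-mod 2 (+ 0) 1 ℕₚ.≤-refl ℕ∣.∣-refl (2 ℕ.* K ℕ.* M) (λ s → 1# + q ^ s) ⟩
    ∏ (2 ℕ.* K ℕ.* M) (λ t → 1# + q ^ (2 ℕ.* t ℕ.+ 2))
      ≈⟨ ∏-stable (λ t M≤t → 1+q^-one (ℕₚ.≤-trans M≤t (ℕₚ.≤-trans (ℕₚ.m≤n*m t 2) (ℕₚ.m≤m+n (2 ℕ.* t) 2))))
          (M≤a*M (suc K₂ ℕ.+ 1 ℕ.* K)) ⟩
    ∏ M (λ t → 1# + q ^ (2 ℕ.* t ℕ.+ 2))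
      ≈⟨ ∏-cong M (λ t → +-congˡ (q^-cong (N.solve 1 (λ t → N.con 2 N.:* t N.:+ N.con 2 N.:= N.con 2 N.:*
          (N.con 1 N.:+ t)) refl t))) ⟩
    W M 0 ∎

  -- The classical (q ; q) (-q ; q²) = (q² ; q²) (q² ; q⁴): the even factors form `c₀`, and each odd
  -- factor 1 - q ^ s meets 1 + q ^ s.
  euler : ∏ Len (λ t → 1# - q ^ suc t) * oddTail 0 ≈ c₀ * X₂
  euler = begin
    ∏ Len e * oddTail 0
      ≡⟨ cong (λ n → ∏ n e * oddTail 0) (N.solve 2 (λ K M → N.con 4 N.:* K N.:* M N.:= N.con 2 N.:* K N.:* M N.:*
          N.con 2) refl K M) ⟩
    ∏ (2 ℕ.* K ℕ.* M ℕ.* 2) e * oddTail 0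
      ≈⟨ *-congʳ (trans (∏-pairs (2 ℕ.* K ℕ.* M) e) (trans (∏-stable e≈1 (M≤a*M (suc K₂ ℕ.+ 1 ℕ.* K))) (∏-* M _ _)))
          ⟩
    ∏ M (λ t → e (t ℕ.* 2)) * ∏ M (λ t → e (suc (t ℕ.* 2))) * oddTail 0
      ≈⟨ solve 3 (λ x y z → x :* y :* z := y :* (x :* z)) ≈-refl _ _ _ ⟩
    ∏ M (λ t → e (suc (t ℕ.* 2))) * (∏ M (λ t → e (t ℕ.* 2)) * oddTail 0)
      ≈⟨ *-cong (∏-cong M (λ t → +-congˡ (-‿cong
          (q^-cong (N.solve 1 (λ t → N.con 2 N.:+ t N.:* N.con 2 N.:= N.con 2 N.:* (N.con 1 N.:+ t)) refl t)))))
                (trans (sym (∏-* M _ _)) (∏-cong M difference)) ⟩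
    c₀ * X₂ ∎
    where
    e : ℕ → Carrier
    e t = 1# - q ^ suc t
    e≈1 : ∀ t → M ℕ.≤ t → e (t ℕ.* 2) * e (suc (t ℕ.* 2)) ≈ 1#
    e≈1 t M≤t = trans (*-cong (1-q^-one (ℕₚ.m≤n⇒m≤1+n M≤2t)) (1-q^-one (ℕₚ.m≤n⇒m≤1+n (ℕₚ.m≤n⇒m≤1+n M≤2t))))
        (*-identityˡ 1#)
      where
      M≤2t : M ℕ.≤ t ℕ.* 2
      M≤2t = ℕₚ.≤-trans M≤t (ℕₚ.m≤m*n t 2)
    difference : ∀ t → e (t ℕ.* 2) * od t ≈ 1# - q ^ (4 ℕ.* t ℕ.+ 2)
    difference t = begin
      (1# - q ^ suc (t ℕ.* 2)) * (1# + q ^ (2 ℕ.* t ℕ.+ 1))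
        ≈⟨ *-congˡ (+-congˡ (q^-cong (N.solve 1 (λ t → N.con 2 N.:* t N.:+ N.con 1 N.:= N.con 1 N.:+ t N.:* N.con 2)
            refl t))) ⟩
      (1# - q ^ suc (t ℕ.* 2)) * (1# + q ^ suc (t ℕ.* 2))
        ≈⟨ solve 1 (λ x → (con 1ℤ :- x) :* (con 1ℤ :+ x) := con 1ℤ :- x :* x) ≈-refl (q ^ suc (t ℕ.* 2)) ⟩
      1# - q ^ suc (t ℕ.* 2) * q ^ suc (t ℕ.* 2)
        ≈⟨ +-congˡ (-‿cong (q^-+ (suc (t ℕ.* 2)) (suc (t ℕ.* 2)) (N.solve 1 (λ t → N.con 1 N.:+ t N.:* N.con 2 N.:+
            (N.con 1 N.:+ t N.:* N.con 2) N.:= N.con 4 N.:* t N.:+ N.con 2) refl t))) ⟩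
      1# - q ^ (4 ℕ.* t ℕ.+ 2) ∎

  -- The excluded class 2e + 1 and the index i of the theta series are kept apart, because they
  -- disagree when r = k.
  compare : ∀ e b i d → suc (2 ℕ.* e) ℕ.+ suc b ≡ 4 ℕ.* K → ∀ B → c₀ * B ≈ W M 0 * J 0 i d →
    theta i d ≈ X₀ * X (suc (2 ℕ.* e)) * X (suc b) →
    gf (configWeight 0) (configsA (allowed (4 ℕ.* K) (suc (2 ℕ.* e))) M 0 Len) ≈ B
  compare e b i d αβ B c₀B≈ θ≈ = unit-cancel (unit-* (unit-∏ M (λ t → unit-1-q^ (t ℕ.+ 1 ℕ.* suc t)))
      (unit-∏ Len unit-1-q^)) (begin
    c₀ * P * A                                 ≈⟨ *-assoc _ _ _ ⟩
    c₀ * (P * A)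
        ≈⟨ *-congˡ (trans (product-configsA (allowed (4 ℕ.* K) (suc (2 ℕ.* e))) Len)
        (*-cong (excluded e b αβ) bars)) ⟩
    c₀ * (X₂ * (X₀ * X (suc (2 ℕ.* e)) * X (suc b)) * W M 0)
      ≈⟨ *-congˡ (*-congʳ (*-congˡ (sym θ≈))) ⟩
    c₀ * (X₂ * theta i d * W M 0)              ≈⟨ solve 4 (λ c x t w → c :* (x :* t :* w) := c :* x :* t :* w)
        ≈-refl _ _ _ _ ⟩
    c₀ * X₂ * theta i d * W M 0                ≈⟨ *-congʳ (*-congʳ (sym euler)) ⟩
    P * oddTail 0 * theta i d * W M 0          ≈⟨ solve 4 (λ p o t w → p :* o :* t :* w := p :* (w :* (o :* t)))
        ≈-refl _ _ _ _ ⟩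
    P * (W M 0 * (oddTail 0 * theta i d))      ≈⟨ *-congˡ (*-congˡ (J-theta i d)) ⟨
    P * (W M 0 * J 0 i d)                      ≈⟨ *-congˡ c₀B≈ ⟨
    P * (c₀ * B)                               ≈⟨ solve 3 (λ p c b → p :* (c :* b) := c :* p :* b) ≈-refl _ _ _ ⟩
    c₀ * P * B                                 ∎)
    where
    P A : Carrier
    P = ∏ Len (λ t → 1# - q ^ suc t)
    A = gf (configWeight 0) (configsA (allowed (4 ℕ.* K) (suc (2 ℕ.* e))) M 0 Len)

  gf-equal : ∀ i → i ℕ.≤ K → gf (configWeight 0) (configsA (allowed (4 ℕ.* K) (suc (2 ℕ.* i))) M 0 Len) ≈ gf
      (configWeight 0) (configsB K M (suc i))
  gf-equal i i≤K with ℕₚ.m≤n⇒m<n∨m≡n i≤K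
  ... | inj₁ i<K = compare i _ i d αβ _ (proj₁ (solved M 0 refl) i d i+d≡K) (theta-product i d i+d≡K)
    where
    d : ℕ
    d = K ℕ.∸ suc i
    i+d≡K : suc i ℕ.+ d ≡ K
    i+d≡K = ℕₚ.m+[n∸m]≡n i<K
    αβ : suc (2 ℕ.* i) ℕ.+ suc (2 ℕ.* i ℕ.+ 4 ℕ.* d ℕ.+ 2) ≡ 4 ℕ.* K
    αβ = ≡.trans (N.solve 2 (λ i d → (N.con 1 N.:+ N.con 2 N.:* i) N.:+
        (N.con 1 N.:+ (N.con 2 N.:* i N.:+ N.con 4 N.:* d N.:+ N.con 2)) N.:= N.con 4 N.:* (N.con 1 N.:+ i N.:+ d))
        refl i d) (cong (4 ℕ.*_) i+d≡K)
  -- For r = k the classes ±(2K + 1) are ±(2K - 1) modulo 4K. The theta product of index K - 1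
  -- applies with its last two factors exchanged.
  ... | inj₂ refl = compare K (2 ℕ.* suc K₂) (suc K₂) 0
      (N.solve 1 (λ k → (N.con 1 N.:+ N.con 2 N.:* (N.con 2 N.:+ k)) N.:+ (N.con 1 N.:+ N.con 2 N.:*
          (N.con 1 N.:+ k)) N.:= N.con 4 N.:* (N.con 2 N.:+ k)) refl K₂)
      _ (proj₂ (solved M 0 refl))
      (trans (theta-product (suc K₂) 0 (ℕₚ.+-identityʳ K))
          (trans (solve 3 (λ x y z → x :* y :* z := x :* z :* y) ≈-refl _ _ _)
        (*-congʳ (*-congˡ (reflexive (cong X (N.solve 1 (λ k → N.con 1 N.:+ (N.con 2 N.:* (N.con 1 N.:+ k) N.:+
            N.con 4 N.:* N.con 0 N.:+ N.con 2) N.:= N.con 1 N.:+ N.con 2 N.:* (N.con 2 N.:+ k)) refl K₂)))))))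

open import Data.Fin.Base using (Fin; zero; suc; toℕ; fromℕ<)
open import Data.Nat.Base using (_+_; _*_; _∸_)

-- Overpartitions as configurations

overlined : Bool → ℕ → List Part
overlined g m = if g then (m , true) ∷ [] else []

layer : ℕ → ℕ × Bool → List Part
layer m (f , g) = overlined g m ++ replicate f (m , false)

-- Sizes are read upwards and each layer is put in front, so the resulting list is descending. The
-- accumulator holds the smaller parts, the only ones that the conditions at a new part look at.
expand : ℕ → Config → List Part → List Part
expand m []      xs = xs
expand m (e ∷ c) xs = expand (suc m) c (layer (suc m) e ++ xs)

weight-++ : ∀ xs ys → weight (xs ++ ys) ≡ weight xs + weight ys
weight-++ xs ys = ≡.trans (cong sum (Listₚ.map-++ size xs ys)) (sum-++ (map size xs) (map size ys))

weight-layer : ∀ m f g → weight (layer m (f , g)) ≡ m * (f + bit g)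
weight-layer m f g = begin
  weight (overlined g m ++ replicate f (m , false))         ≡⟨ weight-++ (overlined g m) _ ⟩
  weight (overlined g m) + weight (replicate f (m , false)) ≡⟨ cong₂ _+_ (bar g) (plain f) ⟩
  m * bit g + m * f                                         ≡⟨ ℕₚ.*-distribˡ-+ m (bit g) f ⟨
  m * (bit g + f)                                           ≡⟨ cong (m *_) (ℕₚ.+-comm (bit g) f) ⟩
  m * (f + bit g)                                           ∎
  where
  open ≡.≡-Reasoning
  bar : ∀ g → weight (overlined g m) ≡ m * bit g
  bar true  = ≡.trans (ℕₚ.+-identityʳ m) (≡.sym (ℕₚ.*-identityʳ m))
  bar false = ≡.sym (ℕₚ.*-zeroʳ m)
  plain : ∀ f → weight (replicate f (m , false)) ≡ m * f
  plain zero    = ≡.sym (ℕₚ.*-zeroʳ m)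
  plain (suc f) = ≡.trans (cong (m +_) (plain f)) (≡.sym (ℕₚ.*-suc m f))

weight-expand : ∀ m c xs → weight (expand m c xs) ≡ configWeight m c + weight xs
weight-expand m []            xs = refl
weight-expand m ((f , g) ∷ c) xs = begin
  weight (expand (suc m) c (layer (suc m) (f , g) ++ xs))            ≡⟨ weight-expand (suc m) c _ ⟩
  configWeight (suc m) c + weight (layer (suc m) (f , g) ++ xs)      ≡⟨ cong (configWeight (suc m) c +_)
      (weight-++ (layer (suc m) (f , g)) xs) ⟩
  configWeight (suc m) c + (weight (layer (suc m) (f , g)) + weight xs) ≡⟨ cong (λ w → configWeight (suc m) c +
      (w + weight xs)) (weight-layer (suc m) f g) ⟩
  configWeight (suc m) c + (suc m * (f + bit g) + weight xs)         ≡⟨ ℕₚ.+-assoc (configWeight (suc m) c) _ _ ⟨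
  configWeight (suc m) c + suc m * (f + bit g) + weight xs           ≡⟨ cong (_+ weight xs)
      (ℕₚ.+-comm (configWeight (suc m) c) _) ⟩
  configWeight m ((f , g) ∷ c) + weight xs                           ∎
  where open ≡.≡-Reasoning

overlined-size : ∀ {P : ℕ → Set} g m → P m → All (P ∘ size) (overlined g m)
overlined-size true  m pm = pm ∷ []
overlined-size false m pm = []

layer-size : ∀ {P : ℕ → Set} m e → P m → All (P ∘ size) (layer m e)
layer-size {P} m (f , g) pm = Allₚ.++⁺ (overlined-size {P} g m pm) (Allₚ.replicate⁺ f pm)

key-<-size : ∀ {x y} → size x < size y → key x < key y
key-<-size {m , b} {n , c} m<n = begin-strict
  2 * m + (if b then 1 else 0)   ≤⟨ ℕₚ.+-monoʳ-≤ (2 * m) (bit≤1 b) ⟩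
  2 * m + 1                      <⟨ ℕₚ.+-monoʳ-< (2 * m) (s≤s (s≤s z≤n)) ⟩
  2 * m + 2                      ≡⟨ ≡.trans (ℕₚ.+-comm (2 * m) 2) (≡.sym (ℕₚ.*-suc 2 m)) ⟩
  2 * suc m                      ≤⟨ ℕₚ.*-monoʳ-≤ 2 m<n ⟩
  2 * n                          ≤⟨ ℕₚ.m≤m+n (2 * n) _ ⟩
  2 * n + (if c then 1 else 0)   ∎
  where
  open ℕₚ.≤-Reasoning
  bit≤1 : ∀ b → (if b then 1 else 0) ≤ 1
  bit≤1 true  = ℕₚ.≤-refl
  bit≤1 false = z≤n

key-≤-size : ∀ {x y} → key x ≤ key y → size x ≤ size y
key-≤-size {x} {y} kx≤ky with ℕₚ.≤-<-connex (size x) (size y)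
... | inj₁ sx≤sy = sx≤sy
... | inj₂ sy<sx = ⊥-elim (ℕₚ.<⇒≱ (key-<-size {y} {x} sy<sx) kx≤ky)

consec-≼ : ∀ {x y} → ConsecOK x y → y ≼ x
consec-≼ (inj₁ y≺x)        = ℕₚ.<⇒≤ y≺x
consec-≼ (inj₂ (refl , _)) = ℕₚ.≤-refl

linked-cons : ∀ {x xs} → All (ConsecOK x) xs → Linked ConsecOK xs → Linked ConsecOK (x ∷ xs)
linked-cons []       []  = [-]
linked-cons (c ∷ _)  [-] = c ∷ [-]
linked-cons (c ∷ _)  (l ∷ ls) = c ∷ l ∷ ls

linked-layer : ∀ m e xs → All ((_< m) ∘ size) xs → Linked ConsecOK xs → Linked ConsecOK (layer m e ++ xs)
linked-layer m (f , g) xs lo lxs = subst (Linked ConsecOK) (≡.sym (Listₚ.++-assoc (overlined g m) _ xs))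
    (bar g (plain f))
  where
  below : All (ConsecOK (m , true)) xs
  below = All.map (λ {y} y<m → inj₁ (key-<-size {y} {m , true} y<m)) lo
  below′ : All (ConsecOK (m , false)) xs
  below′ = All.map (λ {y} y<m → inj₁ (key-<-size {y} {m , false} y<m)) lo
  plain : ∀ f → Linked ConsecOK (replicate f (m , false) ++ xs)
  plain zero    = lxs
  plain (suc f) = linked-cons (Allₚ.++⁺ (Allₚ.replicate⁺ f (inj₂ (refl , refl))) below′) (plain f)
  bar : ∀ g → Linked ConsecOK (replicate f (m , false) ++ xs) → Linked ConsecOK (overlined g m ++ replicate f
      (m , false) ++ xs)
  bar false l = l
  bar true  l = linked-cons (Allₚ.++⁺ (Allₚ.replicate⁺ f (inj₁ (ℕₚ.+-monoʳ-< (2 * m) (s≤s z≤n)))) below) l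

expand-overpartition : ∀ m c xs → All ((_≤ m) ∘ size) xs → IsOverpartition xs → IsOverpartition (expand m c xs)
expand-overpartition m []      xs lo op = op
expand-overpartition m (e ∷ c) xs lo (pos , lxs) = expand-overpartition (suc m) c (layer (suc m) e ++ xs)
  (Allₚ.++⁺ (layer-size {_≤ suc m} (suc m) e ℕₚ.≤-refl) (All.map ℕₚ.m≤n⇒m≤1+n lo))
  (Allₚ.++⁺ (layer-size {1 ≤_} (suc m) e (s≤s z≤n)) pos , linked-layer (suc m) e xs (All.map s≤s lo) lxs)

_≟ₚ_ : (x y : Part) → Dec (x ≡ y)
_≟ₚ_ = Productₚ.≡-dec ℕₚ._≟_ Boolₚ._≟_

count : Part → List Part → ℕ
count p xs = length (filter (p ≟ₚ_) xs)

count-++ : ∀ p xs ys → count p (xs ++ ys) ≡ count p xs + count p ys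
count-++ p xs ys = ≡.trans (cong length (Listₚ.filter-++ (p ≟ₚ_) xs ys)) (Listₚ.length-++ (filter (p ≟ₚ_) xs))

count-none : ∀ p xs → All (p ≢_) xs → count p xs ≡ 0
count-none p xs none = cong length (Listₚ.filter-none (p ≟ₚ_) none)

count-expand : ∀ p m c xs → size p ≤ m → count p (expand m c xs) ≡ count p xs
count-expand p m []      xs p≤m = refl
count-expand p m (e ∷ c) xs p≤m = ≡.trans (count-expand p (suc m) c _ (ℕₚ.m≤n⇒m≤1+n p≤m))
  (≡.trans (count-++ p (layer (suc m) e) xs)
    (cong (_+ count p xs) (count-none p _ (All.map (λ { eq refl → ℕₚ.<⇒≢ (s≤s p≤m) eq })
        (layer-size {λ n → n ≡ suc m} (suc m) e refl)))))

count-plain : ∀ m f g → count (m , false) (layer m (f , g)) ≡ f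
count-plain m f g = ≡.trans (count-++ (m , false) (overlined g m) _)
  (cong₂ _+_ (count-none _ _ (none g)) (≡.trans (cong length (Listₚ.filter-all ((m , false) ≟ₚ_)
      (Allₚ.replicate⁺ f refl))) (Listₚ.length-replicate f)))
  where
  none : ∀ g → All ((m , false) ≢_) (overlined g m)
  none true  = (λ ()) ∷ []
  none false = []

count-bar : ∀ m f g → count (m , true) (layer m (f , g)) ≡ bit g
count-bar m f g = ≡.trans (count-++ (m , true) (overlined g m) _)
  (≡.trans (cong₂ _+_ (one g) (count-none _ _ (Allₚ.replicate⁺ f (λ ())))) (ℕₚ.+-identityʳ _))
  where
  one : ∀ g → count (m , true) (overlined g m) ≡ bit g
  one true  = cong length (Listₚ.filter-all ((m , true) ≟ₚ_) (refl ∷ []))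
  one false = refl

bit-injective : ∀ {g h} → bit g ≡ bit h → g ≡ h
bit-injective {true}  {true}  _ = refl
bit-injective {false} {false} _ = refl

-- Later layers contain only larger sizes, so the multiplicities of the two parts of size m + 1
-- reveal the first entry. Equal lengths are assumed because trailing empty entries leave no trace.
expand-injective : ∀ m c c′ xs → All ((_≤ m) ∘ size) xs → length c ≡ length c′ → expand m c xs ≡ expand m c′ xs →
    c ≡ c′
expand-injective m []            []              xs lo len eq = refl
expand-injective m ((f , g) ∷ c) ((f′ , g′) ∷ c′) xs lo len eq with heads
  where
  counts : ∀ b f g c → count (suc m , b) (expand m ((f , g) ∷ c) xs) ≡ count (suc m , b) (layer (suc m) (f , g))
  counts b f g c = begin
    count p (expand (suc m) c (layer (suc m) (f , g) ++ xs))   ≡⟨ count-expand p (suc m) c _ ℕₚ.≤-refl ⟩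
    count p (layer (suc m) (f , g) ++ xs)                      ≡⟨ count-++ p (layer (suc m) (f , g)) xs ⟩
    count p (layer (suc m) (f , g)) + count p xs               ≡⟨ cong (count p (layer (suc m) (f , g)) +_)
        (count-none p xs (All.map (λ { le refl → ℕₚ.<-irrefl refl le }) lo)) ⟩
    count p (layer (suc m) (f , g)) + 0                        ≡⟨ ℕₚ.+-identityʳ _ ⟩
    count p (layer (suc m) (f , g))                            ∎
    where
    open ≡.≡-Reasoning
    p : Part
    p = suc m , b
  same : ∀ b → count (suc m , b) (layer (suc m) (f , g)) ≡ count (suc m , b) (layer (suc m) (f′ , g′))
  same b = ≡.trans (≡.sym (counts b f g c)) (≡.trans (cong (count (suc m , b)) eq) (counts b f′ g′ c′))
  heads : (f , g) ≡ (f′ , g′)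
  heads = cong₂ _,_ (≡.trans (≡.sym (count-plain (suc m) f g)) (≡.trans (same false) (count-plain (suc m) f′ g′)))
    (bit-injective (≡.trans (≡.sym (count-bar (suc m) f g)) (≡.trans (same true) (count-bar (suc m) f′ g′))))
... | refl = cong ((f , g) ∷_) (expand-injective (suc m) c c′ _
  (Allₚ.++⁺ (layer-size {_≤ suc m} (suc m) (f , g) ℕₚ.≤-refl) (All.map ℕₚ.m≤n⇒m≤1+n lo)) (ℕₚ.suc-injective len) eq)

linked-tail : ∀ {x xs} → Linked ConsecOK (x ∷ xs) → Linked ConsecOK xs
linked-tail [-]     = []
linked-tail (_ ∷ l) = l

split-layer : ∀ m π → Linked ConsecOK π → All ((m <_) ∘ size) π →
  ∃[ σ ] ∃[ e ] (π ≡ σ ++ layer (suc m) e × Linked ConsecOK σ × All ((suc m <_) ∘ size) σ)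
split-layer m []            l []         = [] , (0 , false) , refl , [] , []
split-layer m ((n , b) ∷ π) l (m<n ∷ m<π) with split-layer m π (linked-tail l) m<π
... | σ , e , refl , lσ , hi with ℕₚ.m≤n⇒m<n∨m≡n m<n
...   | inj₁ 1+m<n = (n , b) ∷ σ , e , refl , prefix σ l lσ , 1+m<n ∷ hi
  where
  prefix : ∀ σ {τ} → Linked ConsecOK ((n , b) ∷ σ ++ τ) → Linked ConsecOK σ → Linked ConsecOK ((n , b) ∷ σ)
  prefix []      _       _  = [-]
  prefix (_ ∷ _) (c ∷ _) lσ = c ∷ lσ
...   | inj₂ refl = low σ e l hi b refl
  where
  low : ∀ σ e → Linked ConsecOK ((suc m , b) ∷ σ ++ layer (suc m) e) → All ((suc m <_) ∘ size) σ → ∀ b′ → b ≡ b′ →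
    ∃[ σ′ ] ∃[ e′ ] ((suc m , b) ∷ σ ++ layer (suc m) e ≡ σ′ ++ layer (suc m) e′ × Linked ConsecOK σ′ × All
        ((suc m <_) ∘ size) σ′)
  low (y ∷ σ) e           (c ∷ _)                 (m<y ∷ _) _     _    = ⊥-elim
      (ℕₚ.<⇒≱ m<y (key-≤-size {y} {suc m , b} (consec-≼ {suc m , b} {y} c)))
  -- No part of size m + 1 can precede the overlined one, which is the greatest of that size and may
  -- not repeat.
  low []      (f , true)  (inj₁ y≺x ∷ _)          _         true  refl = ⊥-elim (ℕₚ.<-irrefl refl y≺x)
  low []      (f , true)  (inj₁ y≺x ∷ _)          _         false refl = ⊥-elim
      (ℕₚ.<⇒≱ y≺x (ℕₚ.+-monoʳ-≤ (2 * suc m) z≤n))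
  low []      (f , true)  (inj₂ (_ , ()) ∷ _)     _         _     _
  low []      (f , false) _                       _         true  refl = [] , (f , true) , refl , [] , []
  low []      (f , false) _                       _         false refl = [] , (suc f , false) , refl , [] , []

expand-surjective : ∀ L m π xs → Linked ConsecOK π → All ((m <_) ∘ size) π → All ((_≤ L + m) ∘ size) π →
  ∃[ c ] (length c ≡ L × expand m c xs ≡ π ++ xs)
expand-surjective zero    m []      xs l lo         hi         = [] , refl , refl
expand-surjective zero    m (x ∷ π) xs l (m<x ∷ lo) (x≤m ∷ hi) = ⊥-elim (ℕₚ.<⇒≱ m<x x≤m)
expand-surjective (suc L) m π       xs l lo         hi with split-layer m π l lo
... | σ , e , refl , lσ , loσ with expand-surjective L (suc m) σ (layer (suc m) e ++ xs) lσ loσ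
        (All.map (λ {y} → subst (size y ≤_) (≡.sym (ℕₚ.+-suc L m))) (Allₚ.++⁻ˡ σ hi))
...   | c , len , eq = e ∷ c , cong suc len , ≡.trans eq (≡.sym (Listₚ.++-assoc σ (layer (suc m) e) xs))

size≤weight : ∀ π → All ((_≤ weight π) ∘ size) π
size≤weight []      = []
size≤weight (x ∷ π) = ℕₚ.m≤m+n (size x) (weight π) ∷ All.map (λ le → ℕₚ.≤-trans le (ℕₚ.m≤n+m (weight π) (size x)))
    (size≤weight π)

unique-map : ∀ {A B : Set} (f : A → B) xs → (∀ {x y} → x ∈ xs → y ∈ xs → f x ≡ f y → x ≡ y) → Unique xs → Unique
    (map f xs)
unique-map f []       inj []         = []
unique-map f (x ∷ xs) inj (x∉ ∷ uxs) =
  Allₚ.map⁺ (All.tabulate (λ {y} y∈ fx≡fy → All.lookup x∉ y∈ (inj (here refl) (there y∈) fx≡fy)))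
  ∷ unique-map f xs (λ x∈ y∈ → inj (there x∈) (there y∈)) uxs

ofWeight : ℕ → List Config → List Config
ofWeight n = filter (λ c → configWeight 0 c ℕₚ.≟ n)

-- In an overpartition of n every size is at most n ≤ Len, so it is the expansion of exactly one
-- configuration of length `Len`. Both counts thereby become counts of configurations by weight.
number-by-configs : ∀ n Len → n ≤ Len → (P : Overpartition → Set) (configs : List Config) → Unique configs →
  (∀ {c} → c ∈ configs → length c ≡ Len × P (expand 0 c [])) →
  (∀ c → length c ≡ Len → configWeight 0 c ≡ n → P (expand 0 c []) → c ∈ configs) →
  NumberIs (λ π → OverpartitionOf n π × P π) (length (ofWeight n configs))
number-by-configs n Len n≤Len P configs unique sound complete =
    map ex chosen , unique-map ex chosen injective (Uniqueₚ.filter⁺ _ unique)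
  , (λ π → mk⇔ to from) , Listₚ.length-map ex chosen
  where
  chosen : List Config
  chosen = ofWeight n configs
  ex : Config → List Part
  ex c = expand 0 c []
  weight-ex : ∀ c → weight (ex c) ≡ configWeight 0 c
  weight-ex c = ≡.trans (weight-expand 0 c []) (ℕₚ.+-identityʳ _)
  members : ∀ {c} → c ∈ chosen → c ∈ configs × configWeight 0 c ≡ n
  members = ∈-filter⁻ (λ c → configWeight 0 c ℕₚ.≟ n) {xs = configs}
  injective : ∀ {c c′} → c ∈ chosen → c′ ∈ chosen → ex c ≡ ex c′ → c ≡ c′
  injective {c} {c′} c∈ c′∈ = expand-injective 0 c c′ [] []
    (≡.trans (proj₁ (sound (proj₁ (members c∈)))) (≡.sym (proj₁ (sound (proj₁ (members c′∈))))))
  to : ∀ {π} → π ∈ map ex chosen → OverpartitionOf n π × P π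
  to π∈ with ∈-map⁻ ex π∈
  ... | c , c∈ , refl = (expand-overpartition 0 c [] [] ([] , []) , ≡.trans (weight-ex c) (proj₂ (members c∈))) ,
      proj₂ (sound (proj₁ (members c∈)))
  from : ∀ {π} → OverpartitionOf n π × P π → π ∈ map ex chosen
  from {π} (((pos , l) , refl) , pπ) with expand-surjective Len 0 π [] l pos
    (All.map (λ {y} le → ℕₚ.≤-trans le (ℕₚ.≤-trans n≤Len (ℕₚ.≤-reflexive (≡.sym (ℕₚ.+-identityʳ Len)))))
        (size≤weight π))
  ... | c , len , eq = subst (_∈ map ex chosen) ex≡π (∈-map⁺ ex (∈-filter⁺ (λ c → configWeight 0 c ℕₚ.≟ n)
      (complete c len w (subst P (≡.sym ex≡π) pπ)) w))
    where
    ex≡π : ex c ≡ π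
    ex≡π = ≡.trans eq (Listₚ.++-identityʳ π)
    w : configWeight 0 c ≡ weight π
    w = ≡.trans (≡.sym (weight-ex c)) (cong weight ex≡π)

-- Windows of B-overpartitions

odd : ℕ → Bool
odd zero    = false
odd (suc n) = not (odd n)

odd-double : ∀ k → odd (k * 2) ≡ false
odd-double zero    = refl
odd-double (suc k) = ≡.trans (Boolₚ.not-involutive _) (odd-double k)

odd-k*2+ : ∀ k n → odd (k * 2 + n) ≡ odd n
odd-k*2+ zero    n = refl
odd-k*2+ (suc k) n = ≡.trans (Boolₚ.not-involutive _) (odd-k*2+ k n)

odd-≡⇒sum : ∀ a b → odd a ≡ odd b → odd (a + b) ≡ false
odd-≡⇒sum zero          b e = ≡.sym e
odd-≡⇒sum (suc zero)    b e = ≡.trans (cong not (≡.sym e)) refl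
odd-≡⇒sum (suc (suc a)) b e = ≡.trans (Boolₚ.not-involutive _)
    (odd-≡⇒sum a b (≡.trans (≡.sym (Boolₚ.not-involutive _)) e))

odd-sum⇒≡ : ∀ a b → odd (a + b) ≡ false → odd a ≡ odd b
odd-sum⇒≡ zero          b e = ≡.sym e
odd-sum⇒≡ (suc zero)    b e = ≡.trans (cong not (≡.sym e)) (Boolₚ.not-involutive _)
odd-sum⇒≡ (suc (suc a)) b e = ≡.trans (Boolₚ.not-involutive _)
    (odd-sum⇒≡ a b (≡.trans (≡.sym (Boolₚ.not-involutive _)) e))

-- Two numbers have the same parity iff their sum is even. An equation between the two sums, up to
-- an even number, therefore carries a congruence over without any subtraction.
parity-transfer : ∀ z {a b c d} → a + b ≡ z * 2 + (c + d) → odd a ≡ odd b → odd c ≡ odd d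
parity-transfer z {a} {b} {c} {d} e h = odd-sum⇒≡ c d (≡.trans (≡.sym (odd-k*2+ z (c + d)))
    (≡.trans (cong odd (≡.sym e)) (odd-≡⇒sum a b h)))

parity-transfer⁻ : ∀ z {a b c d} → a + b ≡ z * 2 + (c + d) → odd c ≡ odd d → odd a ≡ odd b
parity-transfer⁻ z {a} {b} {c} {d} e h = odd-sum⇒≡ a b (≡.trans (cong odd e) (≡.trans (odd-k*2+ z (c + d))
    (odd-≡⇒sum c d h)))

2∣⇒even : ∀ n → 2 ℕ∣.∣ n → odd n ≡ false
2∣⇒even n (ℕ∣.divides k refl) = odd-double k

even⇒2∣ : ∀ n → odd n ≡ false → 2 ℕ∣.∣ n
even⇒2∣ zero          _ = 2 ℕ∣.∣0
even⇒2∣ (suc (suc n)) e = ℕ∣.∣m∣n⇒∣m+n ℕ∣.∣-refl (even⇒2∣ n (≡.trans (≡.sym (Boolₚ.not-involutive _)) e))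

-- The distance of a and b differs from a + b by twice the smaller one.
odd-distance : ∀ a b → odd ℤ.∣ ℤ.+ a ℤ.- ℤ.+ b ∣ ≡ odd (a + b)
odd-distance a b with ℕₚ.≤-total a b
... | inj₁ a≤b = ≡.trans (cong odd (≡.trans (cong ℤ.∣_∣ (ℤₚ.m-n≡m⊖n a b)) (ℤₚ.∣⊖∣-≤ a≤b)))
  (≡.trans (≡.sym (odd-k*2+ a (b ∸ a))) (cong odd
      (≡.trans (N.solve 2 (λ a x → a N.:* N.con 2 N.:+ x N.:= a N.:+ (a N.:+ x)) refl a (b ∸ a))
      (cong (a +_) (ℕₚ.m+[n∸m]≡n a≤b)))))
  where module N = +-*-Solver
... | inj₂ b≤a = ≡.trans (cong odd (≡.trans (cong ℤ.∣_∣ (ℤₚ.m-n≡m⊖n a b)) (cong ℤ.∣_∣ (ℤₚ.⊖-≥ b≤a))))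
  (≡.trans (≡.sym (odd-k*2+ b (a ∸ b))) (cong odd
      (≡.trans (N.solve 2 (λ b x → b N.:* N.con 2 N.:+ x N.:= (b N.:+ x) N.:+ b) refl b (a ∸ b))
      (cong (_+ b) (ℕₚ.m+[n∸m]≡n b≤a)))))
  where module N = +-*-Solver

mod2⇒odd : ∀ a b → (ℤ.+ a) ≡ (ℤ.+ b) [mod 2 ] → odd a ≡ odd b
mod2⇒odd a b h = odd-sum⇒≡ a b (≡.trans (≡.sym (odd-distance a b)) (2∣⇒even _ h))

odd⇒mod2 : ∀ a b → odd a ≡ odd b → (ℤ.+ a) ≡ (ℤ.+ b) [mod 2 ]
odd⇒mod2 a b h = even⇒2∣ _ (≡.trans (odd-distance a b) (odd-≡⇒sum a b h))

module _ {P : Part → Set} (P? : Decidable P) where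

  countIs-filter : ∀ π → CountIs P π (length (filter P? π))
  countIs-filter π = filter (P? ∘ lookup π) (allFin (length π)) , Uniqueₚ.filter⁺ _ (Uniqueₚ.allFin⁺ _)
    , (λ i → mk⇔ (proj₂ ∘ ∈-filter⁻ (P? ∘ lookup π) {xs = allFin (length π)}) (∈-filter⁺ (P? ∘ lookup π)
        (∈-allFin i)))
    , lengths
    where
    lengths : length (filter (P? ∘ lookup π) (allFin (length π))) ≡ length (filter P? π)
    lengths = ≡.trans (≡.sym (Listₚ.length-map (lookup π) (filter (P? ∘ lookup π) (allFin (length π)))))
        (cong length (≡.trans (≡.sym (filter-map (allFin (length π))))
      (cong (filter P?) (≡.trans (Listₚ.map-tabulate (λ i → i) (lookup π)) (Listₚ.tabulate-lookup π)))))
      where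
      filter-map : ∀ is → filter P? (map (lookup π) is) ≡ map (lookup π) (filter (P? ∘ lookup π) is)
      filter-map []       = refl
      filter-map (i ∷ is) with does (P? (lookup π i))
      ... | true  = cong (lookup π i ∷_) (filter-map is)
      ... | false = filter-map is

  -- Duplicate-free lists with the same members are permutations of each other, so they have the
  -- same length.
  countIs-unique : ∀ π {c} → CountIs P π c → c ≡ length (filter P? π)
  countIs-unique π (L , uL , mL , refl) with countIs-filter π
  ... | L′ , uL′ , mL′ , e = ≡.trans (↭-length
      (∼bag⇒↭ (unique∧set⇒bag uL uL′ (λ {i} → ⇔ₚ.trans (mL i) (⇔ₚ.sym (mL′ i)))))) e

ovcount : List Part → ℕ
ovcount []       = 0
ovcount (x ∷ xs) = bit (proj₂ x) + ovcount xs

ovcount-++ : ∀ xs ys → ovcount (xs ++ ys) ≡ ovcount xs + ovcount ys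
ovcount-++ []       ys = refl
ovcount-++ (x ∷ xs) ys = ≡.trans (cong (bit (proj₂ x) +_) (ovcount-++ xs ys))
    (≡.sym (ℕₚ.+-assoc (bit (proj₂ x)) _ _))

barBelow? : ∀ N → Decidable (λ p → IsOverlined p × (p ≼ N))
barBelow? N p = (proj₂ p Boolₚ.≟ true) ×-dec (key p ℕₚ.≤? key N)

all≼head : ∀ {x xs} → Linked ConsecOK (x ∷ xs) → All (_≼ x) xs
all≼head [-]     = []
all≼head {x} (_∷_ {y = y} c l) = y≼x ∷ All.map (λ z≼y → ℕₚ.≤-trans z≼y y≼x) (all≼head l)
  where
  y≼x : y ≼ x
  y≼x = consec-≼ {x} {y} c

all≺overlined : ∀ {m xs} → Linked ConsecOK ((m , true) ∷ xs) → All (_≺ (m , true)) xs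
all≺overlined [-]                      = []
all≺overlined (inj₁ y≺x ∷ l)           = y≺x ∷ All.map (λ z≼y → ℕₚ.≤-<-trans z≼y y≺x) (all≼head l)
all≺overlined (inj₂ (refl , ()) ∷ l)

barBelow-all : ∀ N xs → All (_≼ N) xs → length (filter (barBelow? N) xs) ≡ ovcount xs
barBelow-all N []                 []         = refl
barBelow-all N ((m , true) ∷ xs)  (le ∷ les) = ≡.trans
    (cong length (Listₚ.filter-accept (barBelow? N) {m , true} {xs} (refl , le))) (cong suc (barBelow-all N xs les))
barBelow-all N ((m , false) ∷ xs) (le ∷ les) = ≡.trans
    (cong length (Listₚ.filter-reject (barBelow? N) {m , false} {xs} (λ ()))) (barBelow-all N xs les)

-- An overlined part is strictly greater than everything after it, so overlined parts before
-- position i exceed `lookup π i`, and those from i on do not. The parity condition thus depends on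
-- a suffix only.
Vbar-drop : ∀ π → Linked ConsecOK π → ∀ i → length (filter (barBelow? (lookup π i)) π) ≡ ovcount (drop (toℕ i) π)
Vbar-drop (x ∷ xs)           l zero    = barBelow-all x (x ∷ xs) (ℕₚ.≤-refl ∷ all≼head l)
Vbar-drop ((m , false) ∷ xs) l (suc i) = ≡.trans
    (cong length (Listₚ.filter-reject (barBelow? (lookup xs i)) {m , false} {xs} (λ ())))
    (Vbar-drop xs (linked-tail l) i)
Vbar-drop ((m , true) ∷ xs)  l (suc i) = ≡.trans
    (cong length (Listₚ.filter-reject (barBelow? (lookup xs i)) {m , true} {xs} (λ (_ , le) →
  ℕₚ.<⇒≱ (All.lookup (all≺overlined l) (∈-lookup i)) le))) (Vbar-drop xs (linked-tail l) i)

Near Far : Part → Part → Set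
Near = LeqPlus2
Far  = GeqPlus2

near∧far⇒⊥ : ∀ {x y} → Near x y → Far x y → ⊥
near∧far⇒⊥ (inj₁ (_ , lt))    (inj₁ (_ , ge))    = ℕₚ.<⇒≱ lt ge
near∧far⇒⊥ (inj₁ (refl , _))  (inj₂ (() , _))
near∧far⇒⊥ (inj₂ (refl , _))  (inj₁ (() , _))
near∧far⇒⊥ (inj₂ (_ , le))    (inj₂ (_ , gt))    = ℕₚ.<⇒≱ gt le

halves : List Part → ℕ
halves = sum ∘ map half

halves-++ : ∀ xs ys → halves (xs ++ ys) ≡ halves xs + halves ys
halves-++ xs ys = ≡.trans (cong sum (Listₚ.map-++ half xs ys)) (sum-++ (map half xs) (map half ys))

lookup-++-near : ∀ {P Q : Part → Set} ys {zs} → All P ys → All Q zs → (j : Fin (length (ys ++ zs))) →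
  (toℕ j < length ys × P (lookup (ys ++ zs) j)) ⊎ (length ys ≤ toℕ j × Q (lookup (ys ++ zs) j))
lookup-++-near []       []       qs j       = inj₂ (z≤n , All.lookup qs (∈-lookup j))
lookup-++-near (y ∷ ys) (p ∷ ps) qs zero    = inj₁ (s≤s z≤n , p)
lookup-++-near (y ∷ ys) (p ∷ ps) qs (suc j) with lookup-++-near ys ps qs j
... | inj₁ (lt , h) = inj₁ (s≤s lt , h)
... | inj₂ (ge , h) = inj₂ (s≤s ge , h)

take-length-++ : ∀ (ys zs : List Part) → take (length ys) (ys ++ zs) ≡ ys
take-length-++ []       zs = refl
take-length-++ (y ∷ ys) zs = cong (y ∷_) (take-length-++ ys zs)

module Windows (K′ ρ : ℕ) where

  K : ℕ
  K = suc K′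

  HeadFar HeadParity : Part → List Part → Set
  HeadFar    x l = ∀ (j : Fin (length l)) → toℕ j ≡ K → Far x (lookup l j)
  HeadParity x l = ∀ (j : Fin (length l)) → toℕ j ≡ K′ → Near x (lookup l j) → odd (halves (take K l)) ≡ odd
      (ρ + ovcount l)

  -- Both conditions at a position concern the suffix that starts there. They can be imposed one
  -- head at a time while a list grows by larger parts.
  Good : List Part → Set
  Good []       = ⊤
  Good (x ∷ xs) = HeadFar x (x ∷ xs) × HeadParity x (x ∷ xs) × Good xs

  good-suffix : ∀ xs {ys} → Good (xs ++ ys) → Good ys
  good-suffix []       g           = g
  good-suffix (x ∷ xs) (_ , _ , g) = good-suffix xs g

  AllFar AllParity : List Part → Set
  AllFar    π = ∀ (i j : Fin (length π)) → toℕ j ≡ toℕ i + K → Far (lookup π i) (lookup π j)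
  AllParity π = ∀ (i j : Fin (length π)) → toℕ j ≡ toℕ i + K′ → Near (lookup π i) (lookup π j) →
    odd (halves (take K (drop (toℕ i) π))) ≡ odd (ρ + ovcount (drop (toℕ i) π))

  windows⇒good : ∀ π → AllFar π → AllParity π → Good π
  windows⇒good []       _ _ = tt
  windows⇒good (x ∷ xs) F P = F zero , P zero
    , windows⇒good xs (λ i j e → F (suc i) (suc j) (cong suc e)) (λ i j e → P (suc i) (suc j) (cong suc e))

  good⇒far : ∀ π → Good π → AllFar π
  good⇒far (x ∷ xs) (F , _ , _) zero    j       e = F j e
  good⇒far (x ∷ xs) (_ , _ , g) (suc i) (suc j) e = good⇒far xs g i j (ℕₚ.suc-injective e)

  good⇒parity : ∀ π → Good π → AllParity π
  good⇒parity (x ∷ xs) (_ , P , _) zero    j       e = P j e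
  good⇒parity (x ∷ xs) (_ , _ , g) (suc i) (suc j) e = good⇒parity xs g i j (ℕₚ.suc-injective e)

  -- Here `ys` is meant to be the run of parts near the head, the head included. The part at offset
  -- K is far iff the run has at most K parts, and the part at offset K - 1 is near iff it has at
  -- least K.
  Window : List Part → ℕ → Set
  Window ys v = length ys ≤ K × (length ys ≡ K → odd (halves ys) ≡ odd (ρ + v))

  module _ {x : Part} {ys zs : List Part} (near : All (Near x) ys) (far : All (Far x) zs) where

    private
      index : ∀ t → t < length ys → Σ[ j ∈ Fin (length (ys ++ zs)) ] toℕ j ≡ t
      index t t<ys = fromℕ< t<l , Finₚ.toℕ-fromℕ< t<l
        where
        t<l : t < length (ys ++ zs)
        t<l = ℕₚ.≤-trans t<ys (ℕₚ.≤-trans (ℕₚ.m≤m+n _ (length zs)) (ℕₚ.≤-reflexive (≡.sym (Listₚ.length-++ ys))))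
      near-at : ∀ j → toℕ j < length ys → Near x (lookup (ys ++ zs) j)
      near-at j lt with lookup-++-near ys near far j
      ... | inj₁ (_ , n)  = n
      ... | inj₂ (ge , _) = ⊥-elim (ℕₚ.<⇒≱ lt ge)
      take-ys : length ys ≡ K → take K (ys ++ zs) ≡ ys
      take-ys e = ≡.trans (cong (λ n → take n (ys ++ zs)) (≡.sym e)) (take-length-++ ys zs)

    head⇒window : HeadFar x (ys ++ zs) → HeadParity x (ys ++ zs) → Window ys (ovcount (ys ++ zs))
    head⇒window F P = bound , parity
      where
      bound : length ys ≤ K
      bound with length ys ℕₚ.≤? K
      ... | yes le = le
      ... | no  gt with index K (ℕₚ.≰⇒> gt)
      ...   | j , e = ⊥-elim (near∧far⇒⊥ {x} {lookup (ys ++ zs) j}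
          (near-at j (subst (_< length ys) (≡.sym e) (ℕₚ.≰⇒> gt))) (F j e))
      parity : length ys ≡ K → odd (halves ys) ≡ odd (ρ + ovcount (ys ++ zs))
      parity e with index K′ (ℕₚ.≤-reflexive (≡.sym e))
      ... | j , ej = ≡.trans (cong (odd ∘ halves) (≡.sym (take-ys e)))
          (P j ej (near-at j (subst (_< length ys) (≡.sym ej) (ℕₚ.≤-reflexive (≡.sym e)))))

    window⇒head : Window ys (ovcount (ys ++ zs)) → HeadFar x (ys ++ zs) × HeadParity x (ys ++ zs)
    window⇒head (bound , parity) = F , P
      where
      F : HeadFar x (ys ++ zs)
      F j e with lookup-++-near ys near far j
      ... | inj₁ (lt , _) = ⊥-elim (ℕₚ.<⇒≱ (subst (_< length ys) e lt) bound)
      ... | inj₂ (_ , f)  = f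
      P : HeadParity x (ys ++ zs)
      P j e n with lookup-++-near ys near far j
      ... | inj₂ (_ , f)  = ⊥-elim (near∧far⇒⊥ {x} {lookup (ys ++ zs) j} n f)
      ... | inj₁ (lt , _) = ≡.trans (cong (odd ∘ halves) (take-ys full)) (parity full)
        where
        full : length ys ≡ K
        full = ℕₚ.≤-antisym bound (subst (_< length ys) e lt)

module _ (m n : ℕ) (b : Bool) where

  -- A size difference of two is already far for an overlined part and still near for a
  -- non-overlined one. Windows thus reach down one size or two, from 2m+2 at most to 2m.
  near-bar : m ≤ suc n → Near (m , true) (n , b)
  near-bar m≤ = inj₁ (refl , key-<-size {m , true} {(n , b) +2} (subst (m <_) (ℕₚ.+-comm 2 n) (s≤s m≤)))

  near-plain : m ≤ suc (suc n) → Near (m , false) (n , b)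
  near-plain m≤ = inj₂ (refl , ℕₚ.+-mono-≤ (ℕₚ.*-monoʳ-≤ 2 (subst (m ≤_) (ℕₚ.+-comm 2 n) m≤)) z≤n)

  far-bar : suc n < m → Far (m , true) (n , b)
  far-bar n< = inj₁ (refl , ℕₚ.+-mono-≤ (ℕₚ.*-monoʳ-≤ 2 (subst (_≤ m) (ℕₚ.+-comm 2 n) n<)) (bit≤1 b))
    where
    bit≤1 : ∀ b → (if b then 1 else 0) ≤ 1
    bit≤1 true  = ℕₚ.≤-refl
    bit≤1 false = z≤n

  far-plain : suc (suc n) < m → Far (m , false) (n , b)
  far-plain n< = inj₂ (refl , key-<-size {(n , b) +2} {m , false} (subst (_< m) (ℕₚ.+-comm 2 n) n<))

half-even : ∀ m b → half (m * 2 , b) ≡ m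
half-even m b = DivMod.m*n/n≡m m 2

half-odd : ∀ m b → half (suc (m * 2) , b) ≡ m
half-odd m b = ≡.trans (DivMod.+-distrib-/-∣ʳ 1 (ℕ∣.n∣m*n m {2})) (DivMod.m*n/n≡m m 2)

halves-const : ∀ {h} xs → All (λ x → half x ≡ h) xs → halves xs ≡ length xs * h
halves-const []       []       = refl
halves-const (x ∷ xs) (e ∷ es) = cong₂ _+_ e (halves-const xs es)

-- The window conditions within one block

module BlockSteps (K′ ρ : ℕ) where
  open Windows K′ ρ
  private module N = +-*-Solver

  good-cons⇒ : ∀ {x rest} ys {zs} → x ∷ rest ≡ ys ++ zs → All (Near x) ys → All (Far x) zs →
    Good (x ∷ rest) → Window ys (ovcount (x ∷ rest))
  good-cons⇒ {x} ys {zs} e near far (F , P , _) = subst (λ l → Window ys (ovcount l)) (≡.sym e)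
    (head⇒window {x} {ys} {zs} near far (subst (HeadFar x) e F) (subst (HeadParity x) e P))

  good-cons⇐ : ∀ {x rest} ys {zs} → x ∷ rest ≡ ys ++ zs → All (Near x) ys → All (Far x) zs →
    Window ys (ovcount (x ∷ rest)) → Good rest → Good (x ∷ rest)
  good-cons⇐ {x} ys {zs} e near far w g with window⇒head {x} {ys} {zs} near far (subst (λ l → Window ys (ovcount l))
      e w)
  ... | F , P = subst (HeadFar x) (≡.sym e) F , subst (HeadParity x) (≡.sym e) P , g

  -- Of the earlier parts only those of size 2m, collected in `es`, can lie in a window of the new
  -- block. The parts in `lo` are far from all of it.
  module AtLevel (m : ℕ) (es lo : List Part) (es-size : All ((_≡ m * 2) ∘ size) es) (lo-size : All ((_< m * 2) ∘ size) lo) where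

    xs : List Part
    xs = es ++ lo

    s v : ℕ
    s = length es
    v = ovcount xs

    -- In a full window of K parts each half is m, or m + 1 for size 2m+2. So mK joins ρ and the
    -- count of smaller overlined parts, and only the new parts remain to be compared with this bit.
    δ : Bool
    δ = odd (ρ + v + m * K)

    -- With j = bit g + f, `Room j` belongs to the window of the last part added before an overlined
    -- 2m+2, which includes the s parts of size 2m. `Top j` belongs to the overlined 2m+2, whose
    -- window contains itself but no part of size 2m.
    Room Top : ℕ → Set
    Room j = s + j ≤ K × (s + j ≡ K → odd j ≡ δ)
    Top j  = suc j ≤ K × (suc j ≡ K → odd j ≡ δ)

    S : ℕ
    S = suc (suc (m * 2))

    odds : Bool → List Part
    odds g = layer (suc (m * 2)) (0 , g)

    -- A shorter window is not full and has no parity to satisfy, so the condition at the last part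
    -- of the block implies those at the earlier ones.
    room-≤ : ∀ {i j} → i ≤ j → Room j → Room i
    room-≤ {i} {j} i≤j (bound , parity) = ℕₚ.≤-trans (ℕₚ.+-monoʳ-≤ s i≤j) bound , λ e →
      let i≡j = ℕₚ.≤-antisym i≤j (ℕₚ.+-cancelˡ-≤ s j i (ℕₚ.≤-trans bound (ℕₚ.≤-reflexive (≡.sym e))))
      in ≡.trans (cong odd i≡j) (parity (≡.trans (cong (s +_) (≡.sym i≡j)) e))

    halves-es : halves es ≡ s * m
    halves-es = halves-const es (All.map (λ { {_ , b} refl → half-even m b }) es-size)

    halves-odds : ∀ g → halves (odds g) ≡ bit g * m
    halves-odds false = refl
    halves-odds true  = cong (_+ 0) (half-odd m true)

    length-odds : ∀ g → length (odds g) ≡ bit g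
    length-odds false = refl
    length-odds true  = refl

    ovcount-odds : ∀ g → ovcount (odds g) ≡ bit g
    ovcount-odds false = refl
    ovcount-odds true  = refl

    halves-evens : ∀ f → halves (replicate f (S , false)) ≡ f * suc m
    halves-evens f = ≡.trans (halves-const (replicate f (S , false)) (Allₚ.replicate⁺ f (half-even (suc m) false)))
        (cong (_* suc m) (Listₚ.length-replicate f))

    ovcount-evens : ∀ f → ovcount (replicate f (S , false)) ≡ 0
    ovcount-evens zero    = refl
    ovcount-evens (suc f) = ovcount-evens f

    ovcount-plains : ∀ f g → ovcount (replicate f (S , false) ++ odds g ++ xs) ≡ bit g + v
    ovcount-plains f g = ≡.trans (ovcount-++ (replicate f (S , false)) _) (cong₂ _+_ (ovcount-evens f)
        (≡.trans (ovcount-++ (odds g) xs) (cong (_+ v) (ovcount-odds g))))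

    odd-near : All (Near (suc (m * 2) , true)) ((suc (m * 2) , true) ∷ es)
    odd-near = near-bar (suc (m * 2)) (suc (m * 2)) true (ℕₚ.n≤1+n _) ∷ All.map
        (λ { {_ , b} refl → near-bar (suc (m * 2)) (m * 2) b ℕₚ.≤-refl }) es-size

    odd-far : All (Far (suc (m * 2) , true)) lo
    odd-far = All.map (λ { {n , b} lt → far-bar (suc (m * 2)) n b (s≤s lt) }) lo-size

    odd-parity : s + 1 ≡ K → m + halves es + (ρ + suc v) ≡ 1 + (ρ + v + m * K)
    odd-parity e = ≡.trans (cong (λ h → m + h + (ρ + suc v)) halves-es) (≡.trans
      (N.solve 4 (λ m s ρ v → m N.:+ s N.:* m N.:+ (ρ N.:+ (N.con 1 N.:+ v)) N.:= N.con 1 N.:+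
          (ρ N.:+ v N.:+ m N.:* (s N.:+ N.con 1))) refl m s ρ v)
      (cong (λ k → 1 + (ρ + v + m * k)) e))

    odd-halves : halves ((suc (m * 2) , true) ∷ es) ≡ m + halves es
    odd-halves = cong (_+ halves es) (half-odd m true)

    odd-step⇒ : Good (odds true ++ xs) → Room 1
    odd-step⇒ g with good-cons⇒ ((suc (m * 2) , true) ∷ es) refl odd-near odd-far g
    ... | bound , parity = subst (_≤ K) (ℕₚ.+-comm 1 s) bound , λ e →
      parity-transfer 0 {halves ((suc (m * 2) , true) ∷ es)} {ρ + suc v} {1} {ρ + v + m * K}
        (≡.trans (cong (_+ (ρ + suc v)) odd-halves) (odd-parity e)) (parity (≡.trans (ℕₚ.+-comm 1 s) e))

    odd-step⇐ : Good xs → Room 1 → Good (odds true ++ xs)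
    odd-step⇐ g (bound , parity) = good-cons⇐ ((suc (m * 2) , true) ∷ es) refl odd-near odd-far
      (subst (_≤ K) (ℕₚ.+-comm s 1) bound , λ e → parity-transfer⁻ 0 {halves ((suc (m * 2) , true) ∷ es)}
          {ρ + suc v} {1} {ρ + v + m * K}
        (≡.trans (cong (_+ (ρ + suc v)) odd-halves) (odd-parity (≡.trans (ℕₚ.+-comm s 1) e)))
            (parity (≡.trans (ℕₚ.+-comm s 1) e))) g

    plains : ℕ → Bool → List Part
    plains f g = replicate f (S , false) ++ odds g ++ xs

    odds-size : ∀ {P : Part → Set} g → P (suc (m * 2) , true) → All P (odds g)
    odds-size false _ = []
    odds-size true  p = p ∷ []

    module Plain (f : ℕ) (g : Bool) where

      ys : List Part
      ys = replicate (suc f) (S , false) ++ odds g ++ es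

      split : plains (suc f) g ≡ ys ++ lo
      split = ≡.sym (≡.trans (Listₚ.++-assoc (replicate (suc f) (S , false)) (odds g ++ es) lo)
          (cong (replicate (suc f) (S , false) ++_) (Listₚ.++-assoc (odds g) es lo)))

      near : All (Near (S , false)) ys
      near = Allₚ.++⁺ (Allₚ.replicate⁺ (suc f) (near-plain S S false (ℕₚ.≤-trans (ℕₚ.n≤1+n _) (ℕₚ.n≤1+n _))))
        (Allₚ.++⁺ (odds-size g (near-plain S (suc (m * 2)) true (ℕₚ.n≤1+n _)))
            (All.map (λ { {_ , b} refl → near-plain S (m * 2) b ℕₚ.≤-refl }) es-size))

      far : All (Far (S , false)) lo
      far = All.map (λ { {n , b} lt → far-plain S n b (s≤s (s≤s lt)) }) lo-size

      len : length ys ≡ s + (bit g + suc f)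
      len = ≡.trans (Listₚ.length-++ (replicate (suc f) (S , false)))
          (≡.trans (cong₂ _+_ (Listₚ.length-replicate (suc f)) (≡.trans (Listₚ.length-++ (odds g))
          (cong (_+ s) (length-odds g))))
        (N.solve 3 (λ s g f → N.con 1 N.:+ f N.:+ (g N.:+ s) N.:= s N.:+ (g N.:+ (N.con 1 N.:+ f))) refl s
            (bit g) f))

      parity-eq : length ys ≡ K → halves ys + (ρ + ovcount (plains (suc f) g)) ≡ bit g + suc f + (ρ + v + m * K)
      parity-eq e = ≡.trans (cong₂ (λ h o → h + (ρ + o)) hs (ovcount-plains (suc f) g)) (≡.trans
        (N.solve 6 (λ m s ρ v g f → (N.con 1 N.:+ f) N.:* (N.con 1 N.:+ m) N.:+ (g N.:* m N.:+ s N.:* m) N.:+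
            (ρ N.:+ (g N.:+ v))
          N.:= g N.:+ (N.con 1 N.:+ f) N.:+ (ρ N.:+ v N.:+ m N.:* (s N.:+ (g N.:+ (N.con 1 N.:+ f))))) refl m s ρ v
              (bit g) f)
        (cong (λ k → bit g + suc f + (ρ + v + m * k)) (≡.trans (≡.sym len) e)))
        where
        hs : halves ys ≡ suc f * suc m + (bit g * m + s * m)
        hs = ≡.trans (halves-++ (replicate (suc f) (S , false)) (odds g ++ es)) (cong₂ _+_ (halves-evens (suc f))
            (≡.trans (halves-++ (odds g) es) (cong₂ _+_ (halves-odds g) halves-es)))

      plain-step⇒ : Good (plains (suc f) g) → Room (bit g + suc f)
      plain-step⇒ gd with good-cons⇒ ys split near far gd
      ... | bound , parity = subst (_≤ K) len bound , λ e →
        parity-transfer 0 {halves ys} {ρ + ovcount (plains (suc f) g)} {bit g + suc f} {ρ + v + m * K}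
            (parity-eq (≡.trans len e)) (parity (≡.trans len e))

      plain-step⇐ : Good (plains f g) → Room (bit g + suc f) → Good (plains (suc f) g)
      plain-step⇐ gd (bound , parity) = good-cons⇐ ys split near far
        (subst (_≤ K) (≡.sym len) bound , λ e → parity-transfer⁻ 0 {halves ys} {ρ + ovcount (plains (suc f) g)}
            {bit g + suc f} {ρ + v + m * K} (parity-eq e) (parity (≡.trans (≡.sym len) e))) gd

    open Plain using (plain-step⇒; plain-step⇐)

    module Bar (f : ℕ) (g : Bool) where

      ys : List Part
      ys = (S , true) ∷ replicate f (S , false) ++ odds g

      split : (S , true) ∷ plains f g ≡ ys ++ xs
      split = cong ((S , true) ∷_) (≡.sym (Listₚ.++-assoc (replicate f (S , false)) (odds g) xs))

      near : All (Near (S , true)) ys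
      near = near-bar S S true (ℕₚ.n≤1+n _) ∷ Allₚ.++⁺ (Allₚ.replicate⁺ f (near-bar S S false (ℕₚ.n≤1+n _)))
          (odds-size g (near-bar S (suc (m * 2)) true ℕₚ.≤-refl))

      far : All (Far (S , true)) xs
      far = Allₚ.++⁺ (All.map (λ { {_ , b} refl → far-bar S (m * 2) b ℕₚ.≤-refl }) es-size)
          (All.map (λ { {n , b} lt → far-bar S n b (s≤s (ℕₚ.m≤n⇒m≤1+n lt)) }) lo-size)

      len : length ys ≡ suc (bit g + f)
      len = cong suc (≡.trans (Listₚ.length-++ (replicate f (S , false)))
          (≡.trans (cong₂ _+_ (Listₚ.length-replicate f) (length-odds g)) (ℕₚ.+-comm f (bit g))))

      -- The overlined part adds 1 to the halves beyond m and 1 to the overlined count. The two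
      -- cancel modulo 2, which leaves the parity of bit g + f as for the other parts.
      parity-eq : length ys ≡ K → halves ys + (ρ + suc (ovcount (plains f g))) ≡ 1 * 2 +
          (bit g + f + (ρ + v + m * K))
      parity-eq e = ≡.trans (cong₂ (λ h o → h + (ρ + suc o)) hs (ovcount-plains f g)) (≡.trans
        (N.solve 5 (λ m ρ v g f → (N.con 1 N.:+ m) N.:+ (f N.:* (N.con 1 N.:+ m) N.:+ g N.:* m) N.:+
            (ρ N.:+ (N.con 1 N.:+ (g N.:+ v)))
          N.:= N.con 2 N.:+ (g N.:+ f N.:+ (ρ N.:+ v N.:+ m N.:* (N.con 1 N.:+ (g N.:+ f))))) refl m ρ v (bit g) f)
        (cong (λ k → 2 + (bit g + f + (ρ + v + m * k))) (≡.trans (≡.sym len) e)))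
        where
        hs : halves ys ≡ suc m + (f * suc m + bit g * m)
        hs = cong₂ _+_ (half-even (suc m) true) (≡.trans (halves-++ (replicate f (S , false)) (odds g))
            (cong₂ _+_ (halves-evens f) (halves-odds g)))

      bar-step⇒ : Good ((S , true) ∷ plains f g) → Top (bit g + f)
      bar-step⇒ gd with good-cons⇒ ys split near far gd
      ... | bound , parity = subst (_≤ K) len bound , λ e →
        parity-transfer 1 {halves ys} {ρ + suc (ovcount (plains f g))} {bit g + f} {ρ + v + m * K}
            (parity-eq (≡.trans len e)) (parity (≡.trans len e))

      bar-step⇐ : Good (plains f g) → Top (bit g + f) → Good ((S , true) ∷ plains f g)
      bar-step⇐ gd (bound , parity) = good-cons⇐ ys split near far
        (subst (_≤ K) (≡.sym len) bound , λ e → parity-transfer⁻ 1 {halves ys} {ρ + suc (ovcount (plains f g))}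
            {bit g + f} {ρ + v + m * K} (parity-eq e) (parity (≡.trans (≡.sym len) e))) gd

    open Bar using (bar-step⇒; bar-step⇐)

    next : ℕ → Bool → Bool → List Part
    next f g h = layer S (f , h) ++ odds g ++ xs

    next-good : ∀ f g h → Good (next f g h) → Good (plains f g)
    next-good f g false gd = gd
    next-good f g true  gd = proj₂ (proj₂ gd)

    next⇒room : ∀ f g h → Good (next f g h) → 1 ≤ bit g + f → Room (bit g + f)
    next⇒room zero    true  h gd _ = odd-step⇒ (next-good zero true h gd)
    next⇒room (suc f) g     h gd _ = plain-step⇒ f g (next-good (suc f) g h gd)

    next⇒top : ∀ f g → Good (next f g true) → Top (bit g + f)
    next⇒top f g = bar-step⇒ f g

    next⇐ : ∀ f g h → Good xs → (1 ≤ bit g + f → Room (bit g + f)) → (h ≡ true → Top (bit g + f)) → Good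
        (next f g h)
    next⇐ f g h gd room top = bars h top (plain f room)
      where
      base : ∀ g → (1 ≤ bit g + 0 → Room (bit g + 0)) → Good (odds g ++ xs)
      base false _ = gd
      base true  r = odd-step⇐ gd (r ℕₚ.≤-refl)
      plain : ∀ f → (1 ≤ bit g + f → Room (bit g + f)) → Good (plains f g)
      plain zero    r = base g r
      plain (suc f) r = plain-step⇐ f g (plain f (λ _ → room-≤ (ℕₚ.+-monoʳ-≤ (bit g) (ℕₚ.n≤1+n f)) r₁)) r₁
        where
        r₁ : Room (bit g + suc f)
        r₁ = r (ℕₚ.≤-trans (s≤s z≤n) (ℕₚ.m≤n+m (suc f) (bit g)))
      bars : ∀ h → (h ≡ true → Top (bit g + f)) → Good (plains f g) → Good (next f g h)
      bars false _   gd = gd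
      bars true  top gd = bar-step⇐ f g gd (top refl)

-- The automaton recognising B-overpartitions

-- The recursion of `choices` as a relation: `right` is the sum i - 1, `wrong` the sum i - 2, and
-- `skip` passes to the state i - 2.
data Capacity (K : ℕ) : ℕ → ℕ → ℕ → Set where
  right : ∀ {j} → Capacity K (suc j) j (suc K)
  wrong : ∀ {j} → Capacity K (suc (suc j)) j K
  skip  : ∀ {i j c} → Capacity K i j c → Capacity K (suc (suc i)) j c

capacity-inv : ∀ {K i j c} → Capacity K i j c → j < i × ((c ≡ suc K × odd i ≡ not (odd j)) ⊎
    (c ≡ K × odd i ≡ odd j))
capacity-inv right    = ℕₚ.≤-refl , inj₁ (refl , refl)
capacity-inv wrong    = ℕₚ.n≤1+n _ , inj₂ (refl , Boolₚ.not-involutive _)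
capacity-inv (skip p) with capacity-inv p
... | lt , inj₁ (e , h) = ℕₚ.m≤n⇒m≤1+n (ℕₚ.m≤n⇒m≤1+n lt) , inj₁ (e , ≡.trans (Boolₚ.not-involutive _) h)
... | lt , inj₂ (e , h) = ℕₚ.m≤n⇒m≤1+n (ℕₚ.m≤n⇒m≤1+n lt) , inj₂ (e , ≡.trans (Boolₚ.not-involutive _) h)

capacity-right : ∀ {K} i j → j < i → odd i ≡ not (odd j) → Capacity K i j (suc K)
capacity-right (suc i) j (s≤s j≤i) h with ℕₚ.m≤n⇒m<n∨m≡n j≤i
... | inj₂ refl = right
capacity-right (suc (suc i)) j (s≤s j≤i) h | inj₁ (s≤s j≤i′) with ℕₚ.m≤n⇒m<n∨m≡n j≤i′
... | inj₂ refl = ⊥-elim (Boolₚ.not-¬ refl (≡.trans (≡.sym (Boolₚ.not-involutive _)) h))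
... | inj₁ j<i  = skip (capacity-right i j j<i (≡.trans (≡.sym (Boolₚ.not-involutive _)) h))

capacity-wrong : ∀ {K} i j → j < i → odd i ≡ odd j → Capacity K i j K
capacity-wrong (suc i) j (s≤s j≤i) h with ℕₚ.m≤n⇒m<n∨m≡n j≤i
... | inj₂ refl = ⊥-elim (Boolₚ.not-¬ refl (≡.sym h))
capacity-wrong (suc (suc i)) j (s≤s j≤i) h | inj₁ (s≤s j≤i′) with ℕₚ.m≤n⇒m<n∨m≡n j≤i′
... | inj₂ refl = wrong
... | inj₁ j<i  = skip (capacity-wrong i j j<i (≡.trans (≡.sym (Boolₚ.not-involutive _)) h))

blockSum : Block → ℕ
blockSum (g , f , h) = bit g + f

Follows : ℕ → Block × ℕ → Set
Follows c ((g , f , h) , i) = (h ≡ true → suc (suc (bit g + f)) ≤ c) × i ≡ c ∸ (bit h + f)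

module _ (c j : ℕ) (g : Bool) (f : ℕ) where

  tops-yes : suc (suc j) ≤ c → tops c j g f ≡ ((g , f , false) , c ∸ f) ∷ ((g , f , true) , c ∸ suc f) ∷ []
  tops-yes h rewrite dec-true (suc (suc j) ℕₚ.≤? c) h = refl

  tops-no : ¬ (suc (suc j) ≤ c) → tops c j g f ≡ ((g , f , false) , c ∸ f) ∷ []
  tops-no h rewrite dec-false (suc (suc j) ℕₚ.≤? c) h = refl

  tops⇒ : bit g + f ≡ j → ∀ {s} → s ∈ tops c j g f → blockSum (proj₁ s) ≡ j × Follows c s × proj₁ (proj₁ s) ≡ g
  tops⇒ refl {s} s∈ with suc (suc j) ℕₚ.≤? c
  tops⇒ refl {s} s∈ | yes le with subst (s ∈_) (tops-yes le) s∈
  ... | here refl         = refl , ((λ ()) , refl) , refl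
  ... | there (here refl) = refl , ((λ _ → le) , refl) , refl
  tops⇒ refl {s} s∈ | no nle with subst (s ∈_) (tops-no nle) s∈
  ... | here refl         = refl , ((λ ()) , refl) , refl

  tops⇐ : ∀ h → (h ≡ true → suc (suc j) ≤ c) → ((g , f , h) , c ∸ (bit h + f)) ∈ tops c j g f
  tops⇐ false _ = here refl
  tops⇐ true  r = subst (((g , f , true) , c ∸ suc f) ∈_) (≡.sym (tops-yes (r refl))) (there (here refl))

  unique-tops : Unique (map proj₁ (tops c j g f))
  unique-tops with suc (suc j) ℕₚ.≤? c
  ... | yes le = subst (Unique ∘ map proj₁) (≡.sym (tops-yes le)) (((λ ()) ∷ []) ∷ [] ∷ [])
  ... | no nle = subst (Unique ∘ map proj₁) (≡.sym (tops-no nle)) ([] ∷ [])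

options⇒ : ∀ c j {s} → s ∈ options c j → blockSum (proj₁ s) ≡ j × Follows c s
options⇒ c zero    s∈ with tops⇒ c 0 false 0 refl s∈
... | e , fo , _ = e , fo
options⇒ c (suc j) s∈ with ∈-++⁻ (tops c (suc j) false (suc j)) s∈
... | inj₁ s∈₁ = let e , fo , _ = tops⇒ c (suc j) false (suc j) refl s∈₁ in e , fo
... | inj₂ s∈₂ = let e , fo , _ = tops⇒ c (suc j) true j refl s∈₂ in e , fo

options⇐ : ∀ c g f h → (h ≡ true → suc (suc (bit g + f)) ≤ c) → ((g , f , h) , c ∸ (bit h + f)) ∈ options c
    (bit g + f)
options⇐ c false zero    h r = tops⇐ c 0 false 0 h r
options⇐ c false (suc f) h r = ∈-++⁺ˡ (tops⇐ c (suc f) false (suc f) h r)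
options⇐ c true  f       h r = ∈-++⁺ʳ (tops c (suc f) false (suc f)) (tops⇐ c (suc f) true f h r)

choices⇒ : ∀ K i {s} → s ∈ choices K i → ∃[ c ] (Capacity K i (blockSum (proj₁ s)) c × Follows c s)
choices⇒ K (suc zero) s∈ with options⇒ (suc K) 0 s∈
... | e , fo = suc K , subst (λ j → Capacity K 1 j (suc K)) (≡.sym e) right , fo
choices⇒ K (suc (suc i)) s∈ with ∈-++⁻ (options (suc K) (suc i)) s∈
... | inj₁ s∈₁ = let e , fo = options⇒ (suc K) (suc i) s∈₁ in suc K , subst (λ j → Capacity K (suc (suc i)) j (suc K)) (≡.sym e) right , fo
... | inj₂ s∈′ with ∈-++⁻ (options K i) s∈′
...   | inj₁ s∈₂ = let e , fo = options⇒ K i s∈₂ in K , subst (λ j → Capacity K (suc (suc i)) j K) (≡.sym e) wrong , fo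
...   | inj₂ s∈₃ = let c , cap , fo = choices⇒ K i s∈₃ in c , skip cap , fo

choices⇐ : ∀ K {i c} g f h → Capacity K i (bit g + f) c → (h ≡ true → suc (suc (bit g + f)) ≤ c) →
    ((g , f , h) , c ∸ (bit h + f)) ∈ choices K i
choices⇐ K g f h right r = top (bit g + f) (options⇐ (suc K) g f h r)
  where
  top : ∀ j {s} → s ∈ options (suc K) j → s ∈ choices K (suc j)
  top zero    s∈ = s∈
  top (suc j) s∈ = ∈-++⁺ˡ s∈
choices⇐ K g f h wrong r = ∈-++⁺ʳ (options (suc K) (suc (bit g + f))) (∈-++⁺ˡ (options⇐ K g f h r))
choices⇐ K g f h (skip {i} cap) r = ∈-++⁺ʳ (options (suc K) (suc i)) (∈-++⁺ʳ (options K i) (choices⇐ K g f h cap r))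

unique-++-proj₁ : ∀ (xs ys : List (Block × ℕ)) → Unique (map proj₁ xs) → Unique (map proj₁ ys) →
  (∀ {s t} → s ∈ xs → t ∈ ys → proj₁ s ≢ proj₁ t) → Unique (map proj₁ (xs ++ ys))
unique-++-proj₁ xs ys ux uy disj = subst Unique (≡.sym (Listₚ.map-++ proj₁ xs ys)) (Uniqueₚ.++⁺ ux uy apart)
  where
  apart : ∀ {b} → b ∈ map proj₁ xs × b ∈ map proj₁ ys → ⊥
  apart (b∈ , b∈′) with ∈-map⁻ proj₁ b∈ | ∈-map⁻ proj₁ b∈′
  ... | s , s∈ , refl | t , t∈ , e = disj s∈ t∈ e

unique-options : ∀ c j → Unique (map proj₁ (options c j))
unique-options c zero    = unique-tops c 0 false 0
unique-options c (suc j) = unique-++-proj₁ (tops c (suc j) false (suc j)) (tops c (suc j) true j)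
  (unique-tops c (suc j) false (suc j)) (unique-tops c (suc j) true j) differ
  where
  differ : ∀ {s t} → s ∈ tops c (suc j) false (suc j) → t ∈ tops c (suc j) true j → proj₁ s ≢ proj₁ t
  differ s∈ t∈ e with tops⇒ c (suc j) false (suc j) refl s∈ | tops⇒ c (suc j) true j refl t∈
  ... | _ , _ , gs | _ , _ , gt with ≡.trans (≡.sym gs) (≡.trans (cong proj₁ e) gt)
  ...   | ()

-- The three groups have block sums i - 1, i - 2 and less than i - 2. Distinctness is asserted for
-- the blocks alone, because one block with two following states could produce the same
-- configuration twice.
unique-choices : ∀ K i → Unique (map proj₁ (choices K i))
unique-choices K zero          = []
unique-choices K (suc zero)    = unique-options (suc K) 0
unique-choices K (suc (suc i)) = unique-++-proj₁ (options (suc K) (suc i)) (options K i ++ choices K i)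
    (unique-options (suc K) (suc i))
  (unique-++-proj₁ (options K i) (choices K i) (unique-options K i) (unique-choices K i)
    (λ s∈ t∈ e → ℕₚ.<-irrefl (≡.trans (≡.sym (cong blockSum e)) (proj₁ (options⇒ K i s∈))) (below t∈)))
  differ
  where
  below : ∀ {t} → t ∈ choices K i → blockSum (proj₁ t) < i
  below t∈ = proj₁ (capacity-inv (proj₁ (proj₂ (choices⇒ K i t∈))))
  differ : ∀ {s t} → s ∈ options (suc K) (suc i) → t ∈ options K i ++ choices K i → proj₁ s ≢ proj₁ t
  differ s∈ t∈ e with ∈-++⁻ (options K i) t∈
  ... | inj₁ t∈₁ = ℕₚ.<-irrefl (≡.trans (≡.sym (proj₁ (options⇒ K i t∈₁))) (≡.trans (≡.sym (cong blockSum e))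
      (proj₁ (options⇒ (suc K) (suc i) s∈)))) ℕₚ.≤-refl
  ... | inj₂ t∈₂ = ℕₚ.<-irrefl (≡.trans (≡.sym (cong blockSum e)) (proj₁ (options⇒ (suc K) (suc i) s∈)))
      (ℕₚ.m≤n⇒m≤1+n (below t∈₂))

prepend-injective : ∀ {b b′ c c′} → prepend b c ≡ prepend b′ c′ → b ≡ b′ × c ≡ c′
prepend-injective refl = refl , refl

unique-configsB : ∀ K L i → Unique (configsB K L i)
unique-configsB K zero    i = [] ∷ []
unique-configsB K (suc L) i = go (choices K i) (unique-choices K i)
  where
  next : Block × ℕ → List Config
  next s = map (prepend (proj₁ s)) (configsB K L (proj₂ s))
  go : ∀ ss → Unique (map proj₁ ss) → Unique (concatMap next ss)
  go []       []        = []
  go (s ∷ ss) (s∉ ∷ us) = Uniqueₚ.++⁺ (Uniqueₚ.map⁺ (proj₂ ∘ prepend-injective) (unique-configsB K L (proj₂ s)))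
      (go ss us) apart
    where
    apart : ∀ {c} → c ∈ next s × c ∈ concatMap next ss → ⊥
    apart (c∈ , c∈′) with ∈-map⁻ (prepend (proj₁ s)) c∈ | find (∈-concatMap⁻ next {ss} c∈′)
    ... | _ , _ , refl | t , t∈ , c∈″ with ∈-map⁻ (prepend (proj₁ t)) c∈″
    ...   | _ , _ , e = All.lookup s∉ (∈-map⁺ proj₁ t∈) (proj₁ (prepend-injective e))

expand-prefix : ∀ m c xs → ∃[ pre ] (expand m c xs ≡ pre ++ xs × All ((m <_) ∘ size) pre)
expand-prefix m []      xs = [] , refl , []
expand-prefix m (e ∷ c) xs with expand-prefix (suc m) c (layer (suc m) e ++ xs)
... | pre , eq , big = pre ++ layer (suc m) e , ≡.trans eq (≡.sym (Listₚ.++-assoc pre (layer (suc m) e) xs))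
  , Allₚ.++⁺ (All.map ℕₚ.<⇒≤ big) (layer-size {m <_} (suc m) e ℕₚ.≤-refl)

EvenPlain : Part → Set
EvenPlain p = NonOverlined p → IsEven (size p)

module Automaton (K′ r′ : ℕ) where
  open Windows K′ r′
  open BlockSteps K′ r′
  private
    module N = +-*-Solver
    ρ : ℕ
    ρ = r′

  -- After m blocks the last of which contributes s parts of size 2m, the state i is the
  -- number in {K - s, K + 1 - s} of the parity opposite to δ, the parity of r - 1 + V + mK.
  Invariant : ℕ → ℕ → Bool → Set
  Invariant s i δ = 1 ≤ i × (s + i ≡ suc K ⊎ s + i ≡ K) × odd i ≡ not δ

  Room : ℕ → Bool → ℕ → Set
  Room s δ j = s + j ≤ K × (s + j ≡ K → odd j ≡ δ)

  -- If s + i = K + 1, the window is full only for j = i - 1, which has the parity δ. If s + i = K,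
  -- it is never full.
  invariant⇒room : ∀ {s i δ j} → Invariant s i δ → j < i → Room s δ j
  invariant⇒room {s} {i} {δ} {j} (_ , inj₁ e , h) j<i = ℕₚ.≤-pred (subst (suc (s + j) ≤_) e sj<si)
    , λ e′ → Boolₚ.not-injective (≡.trans (cong odd (ℕₚ.+-cancelˡ-≡ s (suc j) i
        (≡.trans (ℕₚ.+-suc s j) (≡.trans (cong suc e′) (≡.sym e))))) h)
    where
    sj<si : s + j < s + i
    sj<si = ℕₚ.+-monoʳ-< s j<i
  invariant⇒room {s} {i} {δ} {j} (_ , inj₂ e , h) j<i = ℕₚ.<⇒≤ sj<K , λ e′ → ⊥-elim (ℕₚ.<-irrefl e′ sj<K)
    where
    sj<K : s + j < K
    sj<K = subst (s + j <_) e (ℕₚ.+-monoʳ-< s j<i)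

  -- If s + i = K, the length bound would still admit j = i, but that fills the window with the
  -- wrong parity.
  invariant⇒tight : ∀ {s i δ j} → Invariant s i δ → (1 ≤ j → Room s δ j) → j < i
  invariant⇒tight {j = zero}  (1≤i , _ , _) _ = 1≤i
  invariant⇒tight {s} {i} {δ} {suc j} (_ , inj₁ e , h) room =
    ℕₚ.+-cancelˡ-< s (suc j) i (subst (s + suc j <_) (≡.sym e) (s≤s (proj₁ (room (s≤s z≤n)))))
  invariant⇒tight {s} {i} {δ} {suc j} (_ , inj₂ e , h) room with ℕₚ.m≤n⇒m<n∨m≡n (ℕₚ.+-cancelˡ-≤ s (suc j) i
      (subst (s + suc j ≤_) (≡.sym e) (proj₁ (room (s≤s z≤n)))))
  ... | inj₁ lt   = lt
  ... | inj₂ refl = ⊥-elim (Boolₚ.not-¬ (proj₂ (room (s≤s z≤n)) e) h)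

  -- The bit δ changes by g + h + K, and the new state is congruent to c + h + f. So it opposes the
  -- new bit iff c ≡ K + 1 + δ + (g + f) modulo 2, and this is the origin of the rule for the
  -- capacity.
  advance : ∀ m v i g f h c → i ≤ suc K → odd i ≡ not (odd (ρ + v + m * K)) → Capacity K i (bit g + f) c →
    (h ≡ true → suc (suc (bit g + f)) ≤ c) →
    Invariant (bit h + f) (c ∸ (bit h + f)) (odd (ρ + (bit h + (bit g + v)) + suc m * K)) × c ≤ suc K
  advance m v i g f h c i≤ par cap r with capacity-inv cap
  ... | j<i , inj₁ (refl , io) = (1≤ , inj₁ total , parity) , ℕₚ.≤-refl
    where
    bound : ∀ h → (h ≡ true → suc (suc (bit g + f)) ≤ suc K) → suc (bit h + f) ≤ suc K
    bound false _ = s≤s (ℕₚ.≤-trans (ℕₚ.m≤n+m f (bit g)) (ℕₚ.≤-pred (ℕₚ.≤-trans j<i i≤)))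
    bound true  r = ℕₚ.≤-trans (s≤s (s≤s (ℕₚ.m≤n+m f (bit g)))) (r refl)
    s<c : suc (bit h + f) ≤ suc K
    s<c = bound h r
    1≤ : 1 ≤ suc K ∸ (bit h + f)
    1≤ = ℕₚ.m<n⇒0<n∸m s<c
    total : bit h + f + (suc K ∸ (bit h + f)) ≡ suc K
    total = ℕₚ.m+[n∸m]≡n (ℕₚ.<⇒≤ s<c)
    i′ : ℕ
    i′ = suc K ∸ (bit h + f)
    parity : odd i′ ≡ not (odd (ρ + (bit h + (bit g + v)) + suc m * K))
    parity = parity-transfer⁻ (i′ + bit h) {i′} {suc (ρ + (bit h + (bit g + v)) + suc m * K)} {bit g + f}
        {ρ + v + m * K}
      (≡.trans (N.solve 7 (λ i ρ h g v m K → i N.:+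
          (N.con 1 N.:+ (ρ N.:+ (h N.:+ (g N.:+ v)) N.:+ (K N.:+ m N.:* K))) N.:= i N.:+
          (ρ N.:+ (h N.:+ (g N.:+ v)) N.:+ m N.:* K) N.:+ (N.con 1 N.:+ K)) refl i′ ρ (bit h) (bit g) v m K)
        (≡.trans (cong (i′ + (ρ + (bit h + (bit g + v)) + m * K) +_) (≡.sym total))
          (N.solve 8 (λ i ρ h g v m K f → i N.:+ (ρ N.:+ (h N.:+ (g N.:+ v)) N.:+ m N.:* K) N.:+ (h N.:+ f N.:+ i)
              N.:= (i N.:+ h) N.:* N.con 2 N.:+ (g N.:+ f N.:+ (ρ N.:+ v N.:+ m N.:* K))) refl i′ ρ (bit h)
              (bit g) v m K f)))
      (Boolₚ.not-injective (≡.trans (≡.sym io) par))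
  ... | j<i , inj₂ (refl , io) = (1≤ , inj₂ total , parity) , ℕₚ.n≤1+n K
    where
    1+j<i : suc (bit g + f) < i
    1+j<i with ℕₚ.m≤n⇒m<n∨m≡n j<i
    ... | inj₁ lt   = lt
    ... | inj₂ refl = ⊥-elim (Boolₚ.not-¬ refl (≡.sym io))
    bound : ∀ h → (h ≡ true → suc (suc (bit g + f)) ≤ K) → suc (bit h + f) ≤ K
    bound false _ = ℕₚ.≤-trans (s≤s (ℕₚ.m≤n+m f (bit g))) (ℕₚ.≤-pred (ℕₚ.≤-trans 1+j<i i≤))
    bound true  r = ℕₚ.≤-trans (s≤s (s≤s (ℕₚ.m≤n+m f (bit g)))) (r refl)
    s<c : suc (bit h + f) ≤ K
    s<c = bound h r
    1≤ : 1 ≤ K ∸ (bit h + f)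
    1≤ = ℕₚ.m<n⇒0<n∸m s<c
    total : bit h + f + (K ∸ (bit h + f)) ≡ K
    total = ℕₚ.m+[n∸m]≡n (ℕₚ.<⇒≤ s<c)
    i′ : ℕ
    i′ = K ∸ (bit h + f)
    parity : odd i′ ≡ not (odd (ρ + (bit h + (bit g + v)) + suc m * K))
    parity = parity-transfer⁻ (i′ + bit h) {i′} {suc (ρ + (bit h + (bit g + v)) + suc m * K)} {bit g + f}
        {suc (ρ + v + m * K)}
      (≡.trans (N.solve 7 (λ i ρ h g v m K → i N.:+
          (N.con 1 N.:+ (ρ N.:+ (h N.:+ (g N.:+ v)) N.:+ (K N.:+ m N.:* K))) N.:= N.con 1 N.:+ i N.:+
          (ρ N.:+ (h N.:+ (g N.:+ v)) N.:+ m N.:* K) N.:+ K) refl i′ ρ (bit h) (bit g) v m K)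
        (≡.trans (cong (1 + i′ + (ρ + (bit h + (bit g + v)) + m * K) +_) (≡.sym total))
          (N.solve 8 (λ i ρ h g v m K f → N.con 1 N.:+ i N.:+ (ρ N.:+ (h N.:+ (g N.:+ v)) N.:+ m N.:* K) N.:+
              (h N.:+ f N.:+ i) N.:= (i N.:+ h) N.:* N.con 2 N.:+
              (g N.:+ f N.:+ (N.con 1 N.:+ (ρ N.:+ v N.:+ m N.:* K)))) refl i′ ρ (bit h) (bit g) v m K f)))
      (≡.trans (≡.sym io) par)

  -- The field `room` is one implication only. In the initial state r the bound on parts up to 2 may
  -- be stricter than the windows, so the converse `Tight` is available only after a block has been
  -- read.
  record State (m i : ℕ) (es lo : List Part) : Set where
    field
      es-size : All ((_≡ m * 2) ∘ size) es
      lo-size : All ((_< m * 2) ∘ size) lo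
      good    : Good (es ++ lo)
      even    : All EvenPlain (es ++ lo)
      i≤      : i ≤ suc K
      parity  : odd i ≡ not (odd (ρ + ovcount (es ++ lo) + m * K))
      room    : ∀ j → j < i → Room (length es) (odd (ρ + ovcount (es ++ lo) + m * K)) j

  Tight : ℕ → ℕ → List Part → List Part → Set
  Tight m i es lo = ∀ j → (1 ≤ j → Room (length es) (odd (ρ + ovcount (es ++ lo) + m * K)) j) → j < i

  -- For the first block this is the bound on the number of parts up to 2. For later blocks it
  -- follows from `Tight`.
  FirstBelow : ℕ → Config → Set
  FirstBelow i ((_ , g) ∷ (f , _) ∷ _) = bit g + f < i
  FirstBelow i _                       = ⊤

  odd-size : ∀ m → ¬ IsEven (suc (m * 2))
  odd-size m ev with ≡.trans (≡.sym (cong not (odd-double m))) (mod2⇒odd (suc (m * 2)) 0 ev)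
  ... | ()

  length-layer : ∀ n f h → length (layer n (f , h)) ≡ bit h + f
  length-layer n f false = Listₚ.length-replicate f
  length-layer n f true  = cong suc (Listₚ.length-replicate f)

  ovcount-layer : ∀ n f h → ovcount (layer n (f , h)) ≡ bit h
  ovcount-layer n f h = ≡.trans (ovcount-++ (overlined h n) (replicate f (n , false)))
      (≡.trans (cong₂ _+_ (bar h) (plain f)) (ℕₚ.+-identityʳ _))
    where
    bar : ∀ h → ovcount (overlined h n) ≡ bit h
    bar true  = refl
    bar false = refl
    plain : ∀ f → ovcount (replicate f (n , false)) ≡ 0
    plain zero    = refl
    plain (suc f) = plain f

  module _ {m i : ℕ} {es lo : List Part} (st : State m i es lo) where
    open State st
    open AtLevel m es lo es-size lo-size using (next; next⇐; next⇒top; next⇒room; S; odds)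

    successor : ∀ g f h c → Capacity K i (bit g + f) c → (h ≡ true → suc (suc (bit g + f)) ≤ c) →
      State (suc m) (c ∸ (bit h + f)) (layer S (f , h)) (odds g ++ es ++ lo) × Tight (suc m) (c ∸ (bit h + f))
          (layer S (f , h)) (odds g ++ es ++ lo)
    successor g f h c cap r = record
      { es-size = layer-size {_≡ S} S (f , h) refl
      ; lo-size = Allₚ.++⁺ (layer-size {_< S} (suc (m * 2)) (0 , g) ℕₚ.≤-refl) (All.map (λ lt → ℕₚ.m≤n⇒m≤1+n lt)
                    (Allₚ.++⁺ (All.map (λ { refl → ℕₚ.≤-refl }) es-size)
                        (All.map (λ lt → ℕₚ.m≤n⇒m≤1+n lt) lo-size)))
      ; good    = next⇐ f g h good (λ _ → room (bit g + f) j<i) top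
      ; even    = Allₚ.++⁺ (All.map (λ ev _ → ev) (layer-size {IsEven} S (f , h) S-even))
          (Allₚ.++⁺ (odd-parts g) even)
      ; i≤      = ℕₚ.≤-trans (ℕₚ.m∸n≤m c (bit h + f)) (proj₂ adv)
      ; parity  = proj₂ (proj₂ inv)
      ; room    = λ j → invariant⇒room inv
      } , λ j → invariant⇒tight inv
      where
      j<i : bit g + f < i
      j<i = proj₁ (capacity-inv cap)
      adv = advance m (ovcount (es ++ lo)) i g f h c i≤ parity cap r
      v′ : ovcount (next f g h) ≡ bit h + (bit g + ovcount (es ++ lo))
      v′ = ≡.trans (ovcount-++ (layer S (f , h)) (odds g ++ es ++ lo)) (cong₂ _+_ (ovcount-layer S f h)
             (≡.trans (ovcount-++ (odds g) (es ++ lo)) (cong (_+ ovcount (es ++ lo))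
                 (ovcount-layer (suc (m * 2)) 0 g))))
      inv : Invariant (length (layer S (f , h))) (c ∸ (bit h + f)) (odd (ρ + ovcount (next f g h) + suc m * K))
      inv = ≡.subst₂ (λ s v → Invariant s (c ∸ (bit h + f)) (odd (ρ + v + suc m * K))) (≡.sym (length-layer S f h))
          (≡.sym v′) (proj₁ adv)
      top : h ≡ true → AtLevel.Top m es lo es-size lo-size (bit g + f)
      top refl with capacity-inv cap
      ... | _ , inj₁ (refl , io) = ℕₚ.≤-pred (r refl) , λ _ → Boolₚ.not-injective (≡.trans (≡.sym io) parity)
      ... | _ , inj₂ (refl , io) = ℕₚ.<⇒≤ (r refl) , λ e → ⊥-elim (ℕₚ.<-irrefl e (r refl))
      S-even : IsEven S
      S-even = odd⇒mod2 S 0 (odd-double (suc m))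
      odd-parts : ∀ g → All EvenPlain (odds g)
      odd-parts false = []
      odd-parts true  = (λ ()) ∷ []

    -- The parity of the block sum decides the capacity. When it is K, equality in the length bound
    -- for an overlined 2m+2 would contradict the parity condition, so the bound is strict.
    capacity-exists : ∀ g f h → bit g + f < i → (h ≡ true → AtLevel.Top m es lo es-size lo-size (bit g + f)) →
      ∃[ c ] (Capacity K i (bit g + f) c × (h ≡ true → suc (suc (bit g + f)) ≤ c))
    capacity-exists g f h j<i top with odd (bit g + f) Boolₚ.≟ odd i
    ... | yes e = K , capacity-wrong i (bit g + f) j<i (≡.sym e) , λ h≡ → strict (top h≡)
      where
      strict : AtLevel.Top m es lo es-size lo-size (bit g + f) → suc (suc (bit g + f)) ≤ K
      strict (bound , par) with ℕₚ.m≤n⇒m<n∨m≡n bound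
      ... | inj₁ lt = lt
      ... | inj₂ eq = ⊥-elim (Boolₚ.not-¬ (par eq) (≡.trans e parity))
    ... | no ne = suc K , capacity-right i (bit g + f) j<i (Boolₚ.¬-not (ne ∘ ≡.sym)) , λ h≡ → s≤s (proj₁ (top h≡))

    first-plain-zero : ∀ f₁ g f h c → All EvenPlain (expand (m * 2) ((f₁ , g) ∷ (f , h) ∷ c) (es ++ lo)) → f₁ ≡ 0
    first-plain-zero zero     g f h c ev = refl
    first-plain-zero (suc f₁) g f h c ev with expand-prefix (suc m * 2) c (layer S (f , h) ++ layer (suc (m * 2))
        (suc f₁ , g) ++ es ++ lo)
    ... | pre , eq , _ = ⊥-elim (odd-size m (All.head (Allₚ.++⁻ʳ (overlined g (suc (m * 2)))
        (Allₚ.++⁻ˡ (layer (suc (m * 2)) (suc f₁ , g))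
      (Allₚ.++⁻ʳ (layer S (f , h)) (Allₚ.++⁻ʳ pre (subst (All EvenPlain) eq ev))))) refl))

    first-below : Tight m i es lo → ∀ c → Good (expand (m * 2) c (es ++ lo)) → All EvenPlain
        (expand (m * 2) c (es ++ lo)) → FirstBelow i c
    first-below tight []      gd ev = tt
    first-below tight (_ ∷ []) gd ev = tt
    first-below tight ((f₁ , g) ∷ (f , h) ∷ c) gd ev with first-plain-zero f₁ g f h c ev
    ... | refl with expand-prefix (suc m * 2) c (next f g h)
    ...   | pre , eq , _ = tight (bit g + f) (next⇒room f g h (good-suffix pre (subst Good eq gd)))

  configsB-sound : ∀ L {m i es lo} → State m i es lo → ∀ {c} → c ∈ configsB K L i →
    length c ≡ L * 2 × Good (expand (m * 2) c (es ++ lo)) × All EvenPlain (expand (m * 2) c (es ++ lo)) × FirstBelow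
        i c
  configsB-sound zero    st (here refl) = refl , State.good st , State.even st , tt
  configsB-sound (suc L) {m} {i} {es} {lo} st c∈ with find
      (∈-concatMap⁻ (λ s → map (prepend (proj₁ s)) (configsB K L (proj₂ s))) {choices K i} c∈)
  ... | ((g , f , h) , i′) , s∈ , c∈′ with ∈-map⁻ (prepend (g , f , h)) c∈′ | choices⇒ K i s∈
  ...   | c′ , c′∈ , refl | cc , cap , r , refl with configsB-sound L (proj₁ (successor st g f h cc cap r)) c′∈
  ...     | len , gd , ev , _ = cong (λ n → suc (suc n)) len , gd , ev , proj₁ (capacity-inv cap)

  configsB-complete : ∀ L {m i es lo} → State m i es lo → ∀ c → length c ≡ L * 2 →
    Good (expand (m * 2) c (es ++ lo)) → All EvenPlain (expand (m * 2) c (es ++ lo)) → FirstBelow i c → c ∈ configsB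
        K L i
  configsB-complete zero    st []                       _   _  _  _  = here refl
  configsB-complete (suc L) {m} {i} {es} {lo} st ((f₁ , g) ∷ (f , h) ∷ c) len gd ev j<i with first-plain-zero st f₁
      g f h c ev
  ... | refl with expand-prefix (suc m * 2) c (AtLevel.next m es lo (State.es-size st) (State.lo-size st) f g h)
  ...   | pre , eq , _ with capacity-exists st g f h j<i
      (λ { refl → AtLevel.next⇒top m es lo (State.es-size st) (State.lo-size st) f g (good-suffix pre (subst Good eq gd)) })
  ...     | cc , cap , r with successor st g f h cc cap r
  ...       | st′ , tight′ = ∈-concatMap⁺ (λ s → map (prepend (proj₁ s)) (configsB K L (proj₂ s))) {choices K i}
    (lose (choices⇐ K g f h cap r) (∈-map⁺ (prepend (g , f , h)) (configsB-complete L st′ c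
        (ℕₚ.suc-injective (ℕₚ.suc-injective len)) gd ev (first-below st′ tight′ c gd ev))))

  -- With no smaller parts, δ is the parity of r - 1, which r opposes. A window filled by the first
  -- block needs j = K < r, which forces r - 1 = K and gives the right parity.
  initial : r′ ≤ K → State 0 (suc r′) [] []
  initial r′≤K = record
    { es-size = [] ; lo-size = [] ; good = tt ; even = [] ; i≤ = s≤s r′≤K
    ; parity  = cong (not ∘ odd) (≡.sym ρ≡)
    ; room    = λ j j<i → ℕₚ.≤-trans (ℕₚ.≤-pred j<i) r′≤K
                , λ j≡K → cong odd (≡.trans (ℕₚ.≤-antisym (ℕₚ.≤-pred j<i) (subst (r′ ≤_) (≡.sym j≡K) r′≤K))
                    (≡.sym ρ≡))
    }
    where
    ρ≡ : ρ + 0 + 0 ≡ r′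
    ρ≡ = ≡.trans (ℕₚ.+-identityʳ _) (ℕₚ.+-identityʳ r′)

  two? : ∀ p → Dec (p ≼ two)
  two? p = key p ℕₚ.≤? key two

  -- The overlined 2 exceeds `two`. What is counted is therefore the quantity that a state bounds,
  -- and the automaton can start in the state r.
  count-two : ∀ g f h c → length (filter two? (expand 0 ((0 , g) ∷ (f , h) ∷ c) [])) ≡ bit g + f
  count-two g f h c with expand-prefix 2 c (layer 2 (f , h) ++ layer 1 (0 , g) ++ [])
  ... | pre , eq , big = begin
    length (filter two? (expand 2 c (layer 2 (f , h) ++ layer 1 (0 , g) ++ [])))
      ≡⟨ cong (length ∘ filter two?) eq ⟩
    length (filter two? (pre ++ layer 2 (f , h) ++ layer 1 (0 , g) ++ []))
      ≡⟨ cong length (≡.trans (Listₚ.filter-++ two? pre _)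
          (cong (_++ filter two? (layer 2 (f , h) ++ layer 1 (0 , g) ++ []))
           (Listₚ.filter-none two? (All.map (λ {p} 2<p → ℕₚ.<⇒≱ (key-<-size {two} {p} 2<p)) big)))) ⟩
    length (filter two? (layer 2 (f , h) ++ layer 1 (0 , g) ++ []))
      ≡⟨ bars h ⟩
    length (filter two? (replicate f (2 , false) ++ layer 1 (0 , g) ++ []))
      ≡⟨ cong length (≡.trans (Listₚ.filter-all two? (Allₚ.++⁺ (Allₚ.replicate⁺ f ℕₚ.≤-refl) (small g))) refl) ⟩
    length (replicate f (2 , false) ++ layer 1 (0 , g) ++ [])
      ≡⟨ ≡.trans (Listₚ.length-++ (replicate f (2 , false))) (cong₂ _+_ (Listₚ.length-replicate f) (ones g)) ⟩
    f + bit g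
      ≡⟨ ℕₚ.+-comm f (bit g) ⟩
    bit g + f ∎
    where
    open ≡.≡-Reasoning
    bars : ∀ h → length (filter two? (layer 2 (f , h) ++ layer 1 (0 , g) ++ [])) ≡ length
        (filter two? (replicate f (2 , false) ++ layer 1 (0 , g) ++ []))
    bars false = refl
    bars true  = refl
    small : ∀ g → All (_≼ two) (layer 1 (0 , g) ++ [])
    small false = []
    small true  = s≤s (s≤s (s≤s z≤n)) ∷ []
    ones : ∀ g → length (layer 1 (0 , g) ++ []) ≡ bit g
    ones false = refl
    ones true  = refl

  good⇒B-cond : ∀ g f h c → Good (expand 0 ((0 , g) ∷ (f , h) ∷ c) []) → All EvenPlain
      (expand 0 ((0 , g) ∷ (f , h) ∷ c) []) →
    bit g + f < suc r′ → B-cond (suc K) (suc r′) (expand 0 ((0 , g) ∷ (f , h) ∷ c) [])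
  good⇒B-cond g f h c gd ev j<r = ev , good⇒far π gd
    , (λ n cnt → subst (_≤ r′) (≡.sym (≡.trans (countIs-unique two? π cnt) (count-two g f h c))) (ℕₚ.≤-pred j<r))
    , λ i j e near v vb → odd⇒mod2 (halves (take K (drop (toℕ i) π))) (r′ + v)
        (≡.trans (good⇒parity π gd i j e near)
        (cong (λ v → odd (r′ + v)) (≡.sym (≡.trans (countIs-unique (barBelow? (lookup π i)) π vb)
            (Vbar-drop π linked i)))))
    where
    π : List Part
    π = expand 0 ((0 , g) ∷ (f , h) ∷ c) []
    linked : Linked ConsecOK π
    linked = proj₂ (expand-overpartition 0 ((0 , g) ∷ (f , h) ∷ c) [] [] ([] , []))

  B-cond⇒good : ∀ c → B-cond (suc K) (suc r′) (expand 0 c []) → Good (expand 0 c []) × All EvenPlain (expand 0 c [])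
  B-cond⇒good c (ev , far , _ , par) = windows⇒good π far (λ i j e near → mod2⇒odd
      (halves (take K (drop (toℕ i) π))) (r′ + ovcount (drop (toℕ i) π)) (par i j e near _
      (subst (VbarIs π (lookup π i)) (Vbar-drop π linked i) (countIs-filter (barBelow? (lookup π i)) π)))) , ev
    where
    π : List Part
    π = expand 0 c []
    linked : Linked ConsecOK π
    linked = proj₂ (expand-overpartition 0 c [] [] ([] , []))

  configsB⇒B-cond : r′ ≤ K → ∀ L {c} → c ∈ configsB K (suc L) (suc r′) → length c ≡ suc L * 2 × B-cond (suc K)
      (suc r′) (expand 0 c [])
  configsB⇒B-cond r′≤K L {c} c∈ with configsB-sound (suc L) (initial r′≤K) c∈
  configsB⇒B-cond r′≤K L {(f₁ , g) ∷ (f , h) ∷ c} c∈ | len , gd , ev , fb with first-plain-zero (initial r′≤K) f₁ g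
      f h c ev
  ... | refl = len , good⇒B-cond g f h c gd ev fb

  B-cond⇒configsB : r′ ≤ K → ∀ L c → length c ≡ suc L * 2 → B-cond (suc K) (suc r′) (expand 0 c []) → c ∈ configsB K
      (suc L) (suc r′)
  B-cond⇒configsB r′≤K L ((f₁ , g) ∷ (f , h) ∷ c) len b@(_ , _ , cnt , _) with B-cond⇒good ((f₁ , g) ∷ (f , h) ∷ c)
      b
  ... | gd , ev with first-plain-zero (initial r′≤K) f₁ g f h c ev
  ...   | refl = configsB-complete (suc L) (initial r′≤K) ((0 , g) ∷ (f , h) ∷ c) len gd ev
    (s≤s (subst (_≤ r′) (count-two g f h c) (cnt _ (countIs-filter two? (expand 0 ((0 , g) ∷ (f , h) ∷ c) [])))))

-- Enumeration


allowed⇒ : ∀ D α s → allowed D α s ≡ true → ¬ ((ℤ.+ s) ≡ (ℤ.+ 2) [mod 4 ]) × ¬ ((ℤ.+ s) ≡ (ℤ.+ 0) [mod D ]) × ¬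
    ((ℤ.+ s) ≡ (ℤ.+ α) [mod D ]) × ¬ ((ℤ.+ s) ≡ (ℤ.- ℤ.+ α) [mod D ])
allowed⇒ D α s = go (mod? 4 (ℤ.+ 2) s) (mod? D (ℤ.+ 0) s) (mod? D (ℤ.+ α) s) (mod? D (ℤ.- ℤ.+ α) s)
  where
  go : ∀ {A B C E : Set} (a : Dec A) (b : Dec B) (c : Dec C) (e : Dec E) → not (does a ∨ does b ∨ does c ∨ does e) ≡
      true → ¬ A × ¬ B × ¬ C × ¬ E
  go (no a) (no b) (no c) (no e) _ = a , b , c , e
  go (yes _) _ _ _ ()
  go (no _) (yes _) _ _ ()
  go (no _) (no _) (yes _) _ ()
  go (no _) (no _) (no _) (yes _) ()

allowed⇐ : ∀ D α s → ¬ ((ℤ.+ s) ≡ (ℤ.+ 2) [mod 4 ]) × ¬ ((ℤ.+ s) ≡ (ℤ.+ 0) [mod D ]) × ¬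
    ((ℤ.+ s) ≡ (ℤ.+ α) [mod D ]) × ¬ ((ℤ.+ s) ≡ (ℤ.- ℤ.+ α) [mod D ]) → allowed D α s ≡ true
allowed⇐ D α s (a , b , c , e) = cong not (≡.cong₂ _∨_ (dec-false (mod? 4 (ℤ.+ 2) s) a)
  (≡.cong₂ _∨_ (dec-false (mod? D (ℤ.+ 0) s) b) (≡.cong₂ _∨_ (dec-false (mod? D (ℤ.+ α) s) c)
      (dec-false (mod? D (ℤ.- ℤ.+ α) s) e))))

module ConfigsA (D α B : ℕ) where

  ok : ℕ → Bool
  ok = allowed D α

  PartOK : Part → Set
  PartOK p = (IsOverlined p → IsEven (size p)) × (NonOverlined p →
      ¬ ((ℤ.+ size p) ≡ (ℤ.+ 2) [mod 4 ]) × ¬ ((ℤ.+ size p) ≡ (ℤ.+ 0) [mod D ])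
    × ¬ ((ℤ.+ size p) ≡ (ℤ.+ α) [mod D ]) × ¬ ((ℤ.+ size p) ≡ (ℤ.- ℤ.+ α) [mod D ]))

  entries : ℕ → List (ℕ × Bool)
  entries s = cartesianProduct (multiplicities ok (suc B) s) (overlinings s)

  unique-entries : ∀ s → Unique (entries s)
  unique-entries s = Uniqueₚ.cartesianProduct⁺ mult over
    where
    mult : Unique (multiplicities ok (suc B) s)
    mult with ok s
    ... | true  = Uniqueₚ.upTo⁺ (suc B)
    ... | false = [] ∷ []
    over : Unique (overlinings s)
    over with does (mod? 2 (ℤ.+ 0) s)
    ... | true  = ((λ ()) ∷ []) ∷ [] ∷ []
    ... | false = [] ∷ []

  unique-configsA : ∀ m L → Unique (configsA ok (suc B) m L)
  unique-configsA m zero    = [] ∷ []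
  unique-configsA m (suc L) = Uniqueₚ.cartesianProductWith⁺ _∷_ Listₚ.∷-injective (unique-entries (suc m))
      (unique-configsA (suc m) L)

  entry⇒ : ∀ s f g → (f , g) ∈ entries s → All PartOK (layer s (f , g))
  entry⇒ s f g e∈ with ∈-cartesianProduct⁻ (multiplicities ok (suc B) s) (overlinings s) e∈
  ... | f∈ , g∈ = Allₚ.++⁺ (bar g g∈) (plain f f∈)
    where
    bar : ∀ g → g ∈ overlinings s → All PartOK (overlined g s)
    bar false _  = []
    bar true  g∈ = ((λ _ → even (mod? 2 (ℤ.+ 0) s) refl) , λ ()) ∷ []
      where
      even : (d : Dec ((ℤ.+ s) ≡ (ℤ.+ 0) [mod 2 ])) → does d ≡ does (mod? 2 (ℤ.+ 0) s) → IsEven s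
      even (yes e) _ = e
      even (no _)  h with subst (λ b → true ∈ (if b then false ∷ true ∷ [] else false ∷ [])) (≡.sym h) g∈
      ... | here ()
      ... | there ()
    plain : ∀ f → f ∈ multiplicities ok (suc B) s → All PartOK (replicate f (s , false))
    plain zero    _  = []
    plain (suc f) f∈ with ok s in eq
    ... | true  = Allₚ.replicate⁺ (suc f) ((λ ()) , λ _ → allowed⇒ D α s eq)
    plain (suc f) (here ())  | false
    plain (suc f) (there ()) | false

  entry⇐ : ∀ s f g → f ≤ B → All PartOK (layer s (f , g)) → (f , g) ∈ entries s
  entry⇐ s f g f≤B ps = ∈-cartesianProduct⁺ (plain f f≤B (Allₚ.++⁻ʳ (overlined g s) ps))
      (bar g (Allₚ.++⁻ˡ (overlined g s) ps))
    where
    bar : ∀ g → All PartOK (overlined g s) → g ∈ overlinings s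
    bar true  ((ev , _) ∷ []) rewrite dec-true (mod? 2 (ℤ.+ 0) s) (ev refl) = there (here refl)
    bar false _ with does (mod? 2 (ℤ.+ 0) s)
    ... | true  = here refl
    ... | false = here refl
    plain : ∀ f → f ≤ B → All PartOK (replicate f (s , false)) → f ∈ multiplicities ok (suc B) s
    plain zero    _   _ with ok s
    ... | true  = here refl
    ... | false = here refl
    plain (suc f) f≤B ((_ , al) ∷ _) rewrite allowed⇐ D α s (al refl) = ∈-upTo⁺ (s≤s f≤B)

  configsA-sound : ∀ L m xs → All PartOK xs → ∀ {c} → c ∈ configsA ok (suc B) m L → length c ≡ L × All PartOK
      (expand m c xs)
  configsA-sound zero    m xs ps (here refl) = refl , ps
  configsA-sound (suc L) m xs ps c∈ with ∈-cartesianProductWith⁻ _∷_ (entries (suc m))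
      (configsA ok (suc B) (suc m) L) c∈
  ... | (f , g) , c , e∈ , c∈′ , refl with configsA-sound L (suc m) (layer (suc m) (f , g) ++ xs)
      (Allₚ.++⁺ (entry⇒ (suc m) f g e∈) ps) c∈′
  ...   | len , ps′ = cong suc len , ps′

  configsA-complete : ∀ L m xs c → length c ≡ L → configWeight m c ≤ B → All PartOK (expand m c xs) → c ∈ configsA
      ok (suc B) m L
  configsA-complete zero    m xs []            _   _ _  = here refl
  configsA-complete (suc L) m xs ((f , g) ∷ c) len w ps = ∈-cartesianProductWith⁺ _∷_
      (entry⇐ (suc m) f g f≤B layerOK)
    (configsA-complete L (suc m) (layer (suc m) (f , g) ++ xs) c (ℕₚ.suc-injective len)
        (ℕₚ.≤-trans (ℕₚ.m≤n+m _ (suc m * (f + bit g))) w) ps)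
    where
    f≤B : f ≤ B
    f≤B = ℕₚ.≤-trans (ℕₚ.m≤m+n f (bit g)) (ℕₚ.≤-trans (ℕₚ.m≤m+n (f + bit g) (m * (f + bit g)))
        (ℕₚ.≤-trans (ℕₚ.m≤m+n _ (configWeight (suc m) c)) w))
    layerOK : All PartOK (layer (suc m) (f , g))
    layerOK with expand-prefix (suc m) c (layer (suc m) (f , g) ++ xs)
    ... | pre , eq , _ = Allₚ.++⁻ˡ (layer (suc m) (f , g)) (Allₚ.++⁻ʳ pre (subst (All PartOK) eq ps))

-- Reading off counts as coefficients, and the theorem

module Coefficients (n : ℕ) where
  open Series

  R : CommutativeRing _ _
  R = truncatedRing n

  open CommutativeRing R using (_≈_; 0#)

  X^-coefficient : ∀ e m → power R X e m ≡ (if does (e ℕₚ.≟ m) then ℤ.1ℤ else ℤ.0ℤ)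
  X^-coefficient zero    zero    = refl
  X^-coefficient zero    (suc m) = refl
  X^-coefficient (suc e) zero    = refl
  X^-coefficient (suc e) (suc m) = ≡.trans (X-⊛-suc (power R X e) m) (X^-coefficient e m)

  X^-vanish : power R X (suc n) ≈ 0#
  X^-vanish m m≤n = ≡.trans (X^-coefficient (suc n) m) (cong (λ b → if b then ℤ.1ℤ else ℤ.0ℤ)
      (dec-false (suc n ℕₚ.≟ m) (λ e → ℕₚ.<⇒≢ (s≤s m≤n) (≡.sym e))))

  open GeneratingFunctions R X (suc n) X^-vanish public using (gf)

  gf-coefficient : ∀ {A : Set} (w : A → ℕ) xs → gf w xs n ≡ ℤ.+ length (filter (λ x → w x ℕₚ.≟ n) xs)
  gf-coefficient w []       = refl
  gf-coefficient w (x ∷ xs) = step (w x ℕₚ.≟ n)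
    where
    step : Dec (w x ≡ n) → gf w (x ∷ xs) n ≡ ℤ.+ length (filter (λ x → w x ℕₚ.≟ n) (x ∷ xs))
    step (yes e) = ≡.trans (cong₂ ℤ._+_ (≡.trans (X^-coefficient (w x) n) (cong (λ b → if b then ℤ.1ℤ else ℤ.0ℤ)
        (dec-true (w x ℕₚ.≟ n) e))) (gf-coefficient w xs))
      (≡.sym (cong (λ l → ℤ.+ length l) (Listₚ.filter-accept (λ x → w x ℕₚ.≟ n) {x} {xs} e)))
    step (no ¬e) = ≡.trans (cong₂ ℤ._+_ (≡.trans (X^-coefficient (w x) n) (cong (λ b → if b then ℤ.1ℤ else ℤ.0ℤ)
        (dec-false (w x ℕₚ.≟ n) ¬e))) (gf-coefficient w xs))
      (≡.sym (cong (λ l → ℤ.+ length l) (Listₚ.filter-reject (λ x → w x ℕₚ.≟ n) {x} {xs} ¬e)))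

theorem1p20 : (k r : ℕ) → 2 < k → 1 ≤ r → r ≤ k → (n : ℕ) →
    Σ[ c ∈ ℕ ] (NumberIs (A-set k r n) c × NumberIs (B-set k r n) c)
theorem1p20 (suc (suc (suc K₂))) (suc r′) (s≤s (s≤s (s≤s _))) _ (s≤s r′≤K) n =
  length (ofWeight n as) , numberA , subst (NumberIs (B-set k r n)) (≡.sym counts) numberB
  where
  k r K D α LenA : ℕ
  k = suc (suc (suc K₂))
  r = suc r′
  K = suc (suc K₂)
  D = 4 * k ∸ 4
  α = 2 * r ∸ 1
  -- This is `Len` for the nilpotency exponent M = n + 1.
  LenA = 4 * K * suc n

  open ConfigsA D α n
  open Automaton (suc K₂) r′
  open Coefficients n
  open Comparison R Series.X (suc n) X^-vanish K₂ using (gf-equal)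

  as bs : List Config
  as = configsA (allowed D α) (suc n) 0 LenA
  bs = configsB K (suc n) r

  n≤LenA : n ≤ LenA
  n≤LenA = ℕₚ.≤-trans (ℕₚ.n≤1+n n) (ℕₚ.m≤n*m (suc n) (4 * K))

  n≤LenB : n ≤ suc n * 2
  n≤LenB = ℕₚ.≤-trans (ℕₚ.n≤1+n n) (ℕₚ.m≤m*n (suc n) 2)

  numberA : NumberIs (A-set k r n) (length (ofWeight n as))
  numberA = number-by-configs n LenA n≤LenA (All (A-part k r)) as (unique-configsA 0 LenA)
      (configsA-sound LenA 0 [] [])
    (λ c len w → configsA-complete LenA 0 [] c len (ℕₚ.≤-reflexive w))

  numberB : NumberIs (B-set k r n) (length (ofWeight n bs))
  numberB = number-by-configs n (suc n * 2) n≤LenB (B-cond k r) bs (unique-configsB K (suc n) r)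
    (configsB⇒B-cond r′≤K n) (λ c len _ → B-cond⇒configsB r′≤K n c len)

  D≡ : D ≡ 4 * K
  D≡ = ≡.trans (cong (_∸ 4) (ℕₚ.*-suc 4 K)) (ℕₚ.m+n∸m≡n 4 (4 * K))

  α≡ : α ≡ suc (2 * r′)
  α≡ = ℕₚ.+-suc r′ (r′ + 0)

  counts : length (ofWeight n as) ≡ length (ofWeight n bs)
  counts = ℤₚ.+-injective (≡.trans (≡.sym (gf-coefficient (configWeight 0) as)) (≡.trans
    -- Equality in the truncated ring is a statement about all degrees up to n, and it is used here
    -- in degree n.
    (≡.subst₂ (λ D α → gf (configWeight 0) (configsA (allowed D α) (suc n) 0 LenA) n ≡ gf (configWeight 0) bs n)
        (≡.sym D≡) (≡.sym α≡)
      (gf-equal r′ r′≤K n ℕₚ.≤-refl)) (gf-coefficient (configWeight 0) bs)))
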